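{- For each $v$, let $\mathcal H^{(v)}$ be a set of graphs on the labeled vertex set $[v]$ such that: $\mathcal H^{(v)}$ is closed under relabeling of vertices; every $H\in\mathcal H^{(v)}$ is connected; and \[ \log c(\mathcal H):=\liminf_{v\to\infty}\frac1v\log\left(\frac{|\mathcal H^{(v)}|}{v!}\right)>-\infty . \] Let $v(n)$ be integers with $v(n)\to\infty$ and $v(n)\le\frac{\log n}{5\log\log n}$. If $k=k(n)\ge\lambda\sqrt n$ for a constant $\lambda>1/\sqrt{c(\mathcal H)}$, then the statistic $F_{\mathcal H^{(v(n))}}(X)$ strongly separates $\mathbb P_{n,k(n)}$ from $\mathbb Q_n$.
   Context: Logarithms are base $2$. $\mathbb Q_n$ is the law of the Erdős–Rényi graph $\mathcal G(n,1/2)$ on $[n]$; $\mathbb P_{n,k}$ is the law of $G\sim\mathcal G(n,1/2)$ with all edges added inside a uniformly random $k$-subset $C\subseteq[n]$. A graph $G$ on $[n]$ is identified with $X_{ij}=2\cdot\mathbf 1\{\{i,j\}\in E(G)\}-1\in\{\pm1\}$, $i\neq j$ (symmetric). For a graph $H$ and an injection $\phi:V(H)\hookrightarrow[n]$, $\chi_{H,\phi}(X)=\prod_{\{a,b\}\in E(H)}X_{\phi(a)\phi(b)}$; $T_H(X)=\sum_{\phi:V(H)\hookrightarrow[n]}\chi_{H,\phi}(X)$ (sum over all injections); and for a set $\mathcal H$ of graphs, $F_{\mathcal H}(X)=\sum_{H\in\mathcal H}T_H(X)$. Functions $F=F_n$ strongly separate $\mathbb Q_n$ from $\mathbb P_{n,k}$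 if $\dfrac{\operatorname{Var}_{\mathbb P_{n,k}}[F]+\operatorname{Var}_{\mathbb Q_n}[F]}{(\mathbb E_{\mathbb P_{n,k}}[F]-\mathbb E_{\mathbb Q_n}[F])^2}\to0$ as $n\to\infty$. If $c(\mathcal H)=+\infty$, then $1/\sqrt{c(\mathcal H)}$ is read as $0$. -}

module Defs where

import Algebra.Definitions.RawSemiring
open import Data.Bool using (Bool; true; false; T; _∧_; _∨_; if_then_else_)
open import Data.Bool.Properties using (T?)
open import Data.Fin using (Fin; zero; suc)
import Data.Fin as Fin
open import Data.Fin.Permutation using (Permutation′; _⟨$⟩ʳ_)
open import Data.Fin.Subset using (Subset; ∣_∣)
open import Data.Integer using (ℤ; +_; -[1+_])
open import Data.List using (List; []; _∷_; [_]; foldr; filter; filterᵇ; length; allFin; cartesianProduct; cartesianProductWith)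
open import Data.Nat using (ℕ; zero; suc; _!)
import Data.Nat as ℕ
open import Data.Nat.Properties using (_!≢0)
open import Data.Product using (∃-syntax; Σ-syntax; _×_; _,_)
open import Data.Rational using (ℚ; 0ℚ; 1ℚ; ½; _+_; _*_; _-_; -_; _÷_; _/_; _<_; _≤_; ↥_; ↧ₙ_; NonZero; +-*-rawSemiring)
open import Data.Rational.Properties using (<-dense; <-trans)
open import Data.Sum using (_⊎_)
open import Data.Vec using (Vec; []; _∷_; lookup; zipWith)
open import Data.Vec.Relation.Unary.AllPairs using (allPairs?)
open import Relation.Binary.Construct.Closure.ReflexiveTransitive using (Star)
open import Relation.Binary.PropositionalEquality using (_≡_)
open import Relation.Nullary using (¬_)
open import Relation.Nullary.Decidable using (¬?; _×-dec_)

open Algebra.Definitions.RawSemiring +-*-rawSemiring using (_^_)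

Eventually : (ℕ → Set) → Set
Eventually P = ∃[ N ] (∀ n → N ℕ.≤ n → P n)

TendsToInfinity : (ℕ → ℕ) → Set
TendsToInfinity f = ∀ M → Eventually (λ n → M ℕ.≤ f n)

-- x ∈ [-∞,+∞] is given by its lower cut {q ∈ ℚ | q < x}: the empty cut is
-- -∞, the full cut is +∞.
record Extℝ : Set₁ where
  field
    _∈↓      : ℚ → Set
    downward : ∀ {p q} → p < q → q ∈↓ → p ∈↓
    open↓    : ∀ {p} → p ∈↓ → ∃[ q ] (p < q × q ∈↓)

_<ʳ_ : ℚ → Extℝ → Set
q <ʳ x = Extℝ._∈↓ x q

-- The supremum in [-∞,+∞] of a set of rationals; sup ∅ = -∞.
sup : (ℚ → Set) → Extℝ
sup S = record
  { _∈↓      = λ q → ∃[ p ] (S p × q < p)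
  ; downward = λ { p<q (s , s∈S , q<s) → s , s∈S , <-trans p<q q<s }
  ; open↓    = λ { (s , s∈S , p<s) → let (m , p<m , m<s) = <-dense p<s in m , p<m , (s , s∈S , m<s) }
  }

-- Extended reals given by their upper cut {q ∈ ℚ | x < q}; the full cut is
-- -∞, the empty cut is +∞. Constructively, order-reversing operations take
-- lower cuts to upper cuts.
record Extℝᵘ : Set₁ where
  field
    _∈↑    : ℚ → Set
    upward : ∀ {p q} → p < q → p ∈↑ → q ∈↑
    open↑  : ∀ {q} → q ∈↑ → ∃[ p ] (p < q × p ∈↑)

inf : (ℚ → Set) → Extℝᵘ
inf S = record
  { _∈↑    = λ q → ∃[ p ] (S p × p < q)
  ; upward = λ { p<q (s , s∈S , s<p) → s , s∈S , <-trans s<p p<q }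
  ; open↑  = λ { (s , s∈S , s<q) → let (m , s<m , m<q) = <-dense s<q in m , m<q , (s , s∈S , s<m) }
  }

_≤ʳ_ : Extℝ → Extℝ → Set
x ≤ʳ y = ∀ q → q <ʳ x → q <ʳ y

_<ᵘ_ : Extℝᵘ → Extℝ → Set
x <ᵘ y = ∃[ q ] (Extℝᵘ._∈↑ x q × q <ʳ y)

-∞<_ : Extℝ → Set
-∞< x = ∃[ q ] (q <ʳ x)

_<+∞ : Extℝ → Set
x <+∞ = ∃[ q ] (¬ (q <ʳ x))

IsReal : Extℝ → Set
IsReal x = (-∞< x) × (x <+∞)

fromℚ : ℚ → Extℝ
fromℚ q = sup (λ p → p ≡ q)

fromℕ : ℕ → Extℝ
fromℕ n = fromℚ (+ n / 1)

-- Product of x, y ≥ 0.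
_·_ : Extℝ → Extℝ → Extℝ
x · y = sup λ s → s ≡ 0ℚ ⊎ (∃[ p ] ∃[ q ] (0ℚ ≤ p × 0ℚ ≤ q × p <ʳ x × q <ʳ y × s ≡ p * q))

-- Quotient of x ≥ 0 by a positive real y: q is (up to the supremum) below x/y
-- iff q s < x for some rational s ≥ y.
_÷ʳ_ : Extℝ → Extℝ → Extℝ
x ÷ʳ y = sup λ q → ∃[ s ] (0ℚ < s × y ≤ʳ fromℚ s × (q * s) <ʳ x)

-- x / v for x of arbitrary sign and v ≥ 1 (no meaning is intended for v = 0).
_/ℕ_ : Extℝ → ℕ → Extℝ
x /ℕ v = sup λ p → ((+ v / 1) * p) <ʳ x

-- Square root of x ≥ 0; √ (+∞) = +∞.
√ : Extℝ → Extℝ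
√ x = sup λ p → p ≡ 0ℚ ⊎ (p * p) <ʳ x

-- 1/x for x ≥ 0, the infimum of 1/r over rationals 0 < r < x. Thus
-- recip (+∞) = 0 and recip 0 = +∞.
recip : Extℝ → Extℝᵘ
recip x = inf λ p → ∃[ r ] (0ℚ < r × r <ʳ x × p * r ≡ 1ℚ)

2^ℤ : ℤ → ℚ
2^ℤ (+ n)    = (+ 2 / 1) ^ n
2^ℤ -[1+ n ] = ½ ^ suc n

-- 2^p ≤ r and r ≤ 2^p for rational p = a/b and r ≥ 0, as 2^a ≤ r^b and
-- r^b ≤ 2^a.
2^_≤_ _≤2^_ : ℚ → ℚ → Set
2^ p ≤ r = 2^ℤ (↥ p) ≤ r ^ (↧ₙ p)
r ≤2^ p  = r ^ (↧ₙ p) ≤ 2^ℤ (↥ p)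

-- Base-2 logarithm of x ≥ 0; log₂ 0 = -∞ and log₂ (+∞) = +∞.
log₂ : Extℝ → Extℝ
log₂ x = sup λ p → ∃[ r ] (0ℚ < r × r <ʳ x × 2^ p ≤ r)

exp₂ : Extℝ → Extℝ
exp₂ x = sup λ r → r ≡ 0ℚ ⊎ (0ℚ < r × ∃[ p ] (p <ʳ x × r ≤2^ p))

liminf : (ℕ → Extℝ) → Extℝ
liminf a = sup λ q → Eventually (λ v → q <ʳ a v)

-- A simple graph on Fin (suc n): the adjacency row of vertex zero to the
-- other vertices, followed by the graph induced on those. Every labelled simple
-- graph has exactly one representation.
data Graph : ℕ → Set where
  []  : Graph zero
  _∷_ : ∀ {n} → Vec Bool n → Graph n → Graph (suc n)

adj : ∀ {n} → Graph n → Fin n → Fin n → Bool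
adj (r ∷ G) zero    zero    = false
adj (r ∷ G) zero    (suc j) = lookup r j
adj (r ∷ G) (suc i) zero    = lookup r i
adj (r ∷ G) (suc i) (suc j) = adj G i j

Connected : ∀ {n} → Graph n → Set
Connected G = ∀ i j → Star (λ a b → T (adj G a b)) i j

edges : ∀ {n} → Graph n → List (Fin n × Fin n)
edges {n} G = filter (λ { (a , b) → (a Fin.<? b) ×-dec T? (adj G a b) })
                     (cartesianProduct (allFin n) (allFin n))

allVecs : ∀ {A : Set} → List A → ∀ n → List (Vec A n)
allVecs xs zero    = [ [] ]
allVecs xs (suc n) = cartesianProductWith _∷_ xs (allVecs xs n)

allGraphs : ∀ n → List (Graph n)
allGraphs zero    = [ [] ]
allGraphs (suc n) = cartesianProductWith _∷_ (allVecs (true ∷ false ∷ []) n) (allGraphs n)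

-- An injection [v] ↪ [n] is the vector of its (pairwise distinct) values.
injections : ∀ v n → List (Vec (Fin n) v)
injections v n = filter (allPairs? (λ i j → ¬? (i Fin.≟ j))) (allVecs (allFin n) v)

subsetsOfSize : ∀ n → ℕ → List (Subset n)
subsetsOfSize n k = filter (λ C → ∣ C ∣ ℕ.≟ k) (allVecs (true ∷ false ∷ []) n)

-- Adds all edges inside C.
plant : ∀ {n} → Subset n → Graph n → Graph n
plant []      []      = []
plant (c ∷ C) (r ∷ G) = zipWith (λ d e → e ∨ (c ∧ d)) C r ∷ plant C G

∑ : ∀ {A : Set} → List A → (A → ℚ) → ℚ
∑ xs f = foldr (λ x s → f x + s) 0ℚ xs

∏ : ∀ {A : Set} → List A → (A → ℚ) → ℚ
∏ xs f = foldr (λ x s → f x * s) 1ℚ xs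

-- The law of a uniformly random entry of a nonempty list, repetitions
-- counted.
Law : Set → Set
Law A = List A

-- No meaning is intended for the empty list.
𝔼 : ∀ {A : Set} → Law A → (A → ℚ) → ℚ
𝔼 []         f = 0ℚ
𝔼 μ@(_ ∷ xs) f = ∑ μ f * (+ 1 / suc (length xs))

Var : ∀ {A : Set} → Law A → (A → ℚ) → ℚ
Var μ f = 𝔼 μ (λ x → (f x - 𝔼 μ f) * (f x - 𝔼 μ f))

-- Independent fair edges make all labelled graphs equally likely.
𝒬 : ∀ n → Law (Graph n)
𝒬 n = allGraphs n

-- C and the graph are independent and uniform; a law only when k ≤ n.
𝒫 : ∀ n → ℕ → Law (Graph n)
𝒫 n k = cartesianProductWith plant (subsetsOfSize n k) (allGraphs n)

-- The ratio is nonnegative, so convergence to 0 is an upper bound; being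
-- eventually defined is part of the claim.
StronglySeparates : (F : ∀ n → Graph n → ℚ) (P Q : ∀ n → Law (Graph n)) → Set
StronglySeparates F P Q =
  ∀ ε → 0ℚ < ε → Eventually λ n →
    let gap = 𝔼 (P n) (F n) - 𝔼 (Q n) (F n) in
    Σ[ nz ∈ NonZero (gap * gap) ]
      ((Var (P n) (F n) + Var (Q n) (F n)) ÷ (gap * gap)) {{nz}} < ε

signs : ∀ {n} → Graph n → Fin n → Fin n → ℚ
signs G i j = if adj G i j then 1ℚ else - 1ℚ

χ : ∀ {v n} → Graph v → Vec (Fin n) v → (Fin n → Fin n → ℚ) → ℚ
χ H φ X = ∏ (edges H) (λ { (a , b) → X (lookup φ a) (lookup φ b) })

T[_] : ∀ {v n} → Graph v → (Fin n → Fin n → ℚ) → ℚ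
T[_] {v} {n} H X = ∑ (injections v n) (λ φ → χ H φ X)

GraphSet : ℕ → Set
GraphSet v = Graph v → Bool

elements : ∀ {v} → GraphSet v → List (Graph v)
elements {v} ℋ = filterᵇ ℋ (allGraphs v)

F[_] : ∀ {v n} → GraphSet v → (Fin n → Fin n → ℚ) → ℚ
F[ ℋ ] X = ∑ (elements ℋ) (λ H → T[ H ] X)

ClosedUnderRelabeling : ∀ {v} → GraphSet v → Set
ClosedUnderRelabeling {v} ℋ =
  ∀ (σ : Permutation′ v) (H H′ : Graph v) →
  (∀ i j → adj H′ (σ ⟨$⟩ʳ i) (σ ⟨$⟩ʳ j) ≡ adj H i j) → T (ℋ H) → T (ℋ H′)

-- |ℋ⁽ᵛ⁾| / v!
density : ∀ {v} → GraphSet v → ℚ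
density {v} ℋ = (+ length (elements ℋ) / (v !)) {{v !≢0}}

log-c : (∀ v → GraphSet v) → Extℝ
log-c ℋ = liminf (λ v → log₂ (fromℚ (density (ℋ v))) /ℕ v)

c : (∀ v → GraphSet v) → Extℝ
c ℋ = exp₂ (log-c ℋ)

-- For a fixed planted set C the expectation over the background graph of a
-- product of two placed characters vanishes unless every edge of their
-- symmetric difference lies inside C. If the placed vertex sets are disjoint,
-- both must lie in C, which reproduces the squared mean; if the placed graphs
-- coincide, the pair contributes to the null variance; otherwise connectedness
-- forces a common vertex into C, and such pairs are so rare that they lose a
-- factor of order 1/k, which beats v ^ O(v) since v ^ (3 v) ≤ n. The null
-- variance is beaten because k² / n exceeds 1 / c(ℋ) by a constant factor, to
-- the power v.

module Submission where

open import Defs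
import Algebra.Definitions.RawSemiring
open import Data.Bool using (Bool; true; false; T; if_then_else_; not; _∧_; _∨_)
import Data.Bool.Properties as Bool
open import Data.Bool.Properties using (T?; T-≡; T-∧; ∧-comm; ∨-zeroʳ)
import Data.Empty as Empty
open import Data.Empty using (⊥-elim)
open import Data.Fin using (Fin; zero; suc)
import Data.Fin as Fin
import Data.Fin.Properties as Fin
open import Data.Fin.Subset using (Subset; ∣_∣; ⊥)
open import Data.Fin.Subset.Properties using (∣⊥∣≡0)
open import Data.Integer using (ℤ; -[1+_])
import Data.Integer as ℤ
import Data.Integer.Properties as ℤ
open import Data.List using (List; []; _∷_; _++_; map; length; filter; allFin; tabulate; cartesianProduct; cartesianProductWith)
open import Data.List.Membership.Propositional using (_∈_)
open import Data.List.Membership.Propositional.Properties using (∈-filter⁺; ∈-filter⁻; ∈-cartesianProduct⁺; ∈-cartesianProduct⁻; ∈-cartesianProductWith⁺; ∈-allFin)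
open import Data.List.Properties using (length-tabulate)
import Data.List.Relation.Unary.All as ListAll
open import Data.List.Relation.Unary.All using ([]; _∷_)
open import Data.List.Relation.Unary.AllPairs using ([]; _∷_)
open import Data.List.Relation.Unary.Any using (here; there)
open import Data.List.Relation.Unary.Unique.Propositional using (Unique)
import Data.List.Relation.Unary.Unique.Propositional.Properties as Unique
open import Data.Nat using (ℕ; zero; suc; _!)
import Data.Nat as ℕ
open import Data.Nat.Coprimality using (1-coprimeTo)
import Data.Nat.Coprimality as Coprime
open import Data.Nat.Properties using (_!≢0)
import Data.Nat.Properties as ℕ
import Data.Nat.Solver
open import Data.Product using (∃-syntax; Σ-syntax; _×_; _,_; proj₁; proj₂)
open import Data.Product.Properties using (≡-dec)
open import Data.Rational using (ℚ; mkℚ; 0ℚ; 1ℚ; ½; _+_; _*_; _-_; -_; _÷_; _/_; 1/_; _<_; _≤_; ↥_; ↧ₙ_; NonZero; nonNegative; positive; toℚᵘ; +-*-rawSemiring)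
open import Data.Rational.Properties hiding (_≟_)
open import Data.Rational.Solver
import Data.Rational.Unnormalised as ℚᵘ
import Data.Rational.Unnormalised.Properties as ℚᵘ
open import Data.Sum using (_⊎_; inj₁; inj₂)
open import Data.Unit using (tt)
open import Data.Vec using (Vec; []; _∷_; lookup; zipWith; _[_]%=_)
import Data.Vec.Properties as Vec
open import Data.Vec.Relation.Unary.All as All using (All; []; _∷_; all?)
import Data.Vec.Relation.Unary.All.Properties as All
open import Data.Vec.Relation.Unary.AllPairs using (AllPairs; []; _∷_; allPairs?)
open import Function using (_∘_; id)
open import Function.Bundles using (Equivalence)
import Relation.Binary.Construct.Closure.ReflexiveTransitive as Walk
open import Relation.Binary.Construct.Closure.ReflexiveTransitive using (Star; _◅_)
open import Relation.Binary.Definitions using (tri<; tri≈; tri>)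
open import Relation.Binary.PropositionalEquality
open import Relation.Nullary using (¬_; Dec; yes; no; does)
open import Relation.Nullary.Decidable using (¬?; dec-true; dec-false; _×-dec_)
open import Relation.Unary using (Decidable)

open Algebra.Definitions.RawSemiring +-*-rawSemiring using (_^_)
open +-*-Solver using (solve; con; _:=_; _:+_; _:*_; _:-_)
private module ℕ-Solver = Data.Nat.Solver.+-*-Solver

-- The mean given `C` depends only on the size of `C`, so the randomness of `C` adds nothing to the
-- variance and every estimate is made for one fixed `C`; the null law is the case `C = ⊥`.
-- Vanishing expectations come from a symmetry: the sum over all graphs is invariant under flipping
-- one edge, and a product of characters that changes sign under such a flip sums to 0. Overlapping
-- pairs are not sorted by the size of the overlap. Their indicator is dominated by a product `W` of
-- vertex weights divided by `κ ^ (v + 1)`. The sum of `W` over all pairs is bounded by a product,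
-- and the exponent `v + 1` in place of `v` is the gained factor `1 / k`. Extended reals are cuts,
-- so the analytic hypotheses enter only through rational inequalities with some slack: for `q`
-- below `lam` and `r` below `√ (c ℋ)` with `1 < q r`, eventually `q² n ≤ k²`, `(r²) ^ v ≤ density`
-- and `v ^ (3 v) ≤ n`. The constants come from `q` and `r`: `K = 1 / q²`, and `δ = (q r)²`, whose
-- powers outgrow any target `M`.

private variable
  A B : Set
  n v : ℕ

-- Ordered-field arithmetic in ℚ

-- Opaque, as the gcd hidden in _/_ would otherwise block unification.
opaque
  ⟦_⟧ : ℕ → ℚ
  ⟦ n ⟧ = ℤ.+ n / 1

  ⟦⟧-/1 : ∀ n → ⟦ n ⟧ ≡ ℤ.+ n / 1
  ⟦⟧-/1 n = refl

  ⟦0⟧ : ⟦ 0 ⟧ ≡ 0ℚ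
  ⟦0⟧ = refl

  ⟦1⟧ : ⟦ 1 ⟧ ≡ 1ℚ
  ⟦1⟧ = refl

  ⟦⟧-+ : ∀ m n → ⟦ m ℕ.+ n ⟧ ≡ ⟦ m ⟧ + ⟦ n ⟧
  ⟦⟧-+ m n = toℚᵘ-injective (ℚᵘ.≃-trans (toℚᵘ-fromℚᵘ (ℚᵘ.mkℚᵘ (ℤ.+ (m ℕ.+ n)) 0))
    (ℚᵘ.≃-sym (ℚᵘ.≃-trans (toℚᵘ-homo-+ ⟦ m ⟧ ⟦ n ⟧)
      (ℚᵘ.≃-trans (ℚᵘ.+-cong (toℚᵘ-fromℚᵘ (ℚᵘ.mkℚᵘ (ℤ.+ m) 0)) (toℚᵘ-fromℚᵘ (ℚᵘ.mkℚᵘ (ℤ.+ n) 0)))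
        (ℚᵘ.*≡* (cong (ℤ._* ℤ.+ 1) (cong₂ ℤ._+_ (ℤ.*-identityʳ (ℤ.+ m)) (ℤ.*-identityʳ (ℤ.+ n)))))))))

  ⟦⟧-* : ∀ m n → ⟦ m ℕ.* n ⟧ ≡ ⟦ m ⟧ * ⟦ n ⟧
  ⟦⟧-* m n = toℚᵘ-injective (ℚᵘ.≃-trans (toℚᵘ-fromℚᵘ (ℚᵘ.mkℚᵘ (ℤ.+ (m ℕ.* n)) 0))
    (ℚᵘ.≃-sym (ℚᵘ.≃-trans (toℚᵘ-homo-* ⟦ m ⟧ ⟦ n ⟧)
      (ℚᵘ.≃-trans (ℚᵘ.*-cong (toℚᵘ-fromℚᵘ (ℚᵘ.mkℚᵘ (ℤ.+ m) 0)) (toℚᵘ-fromℚᵘ (ℚᵘ.mkℚᵘ (ℤ.+ n) 0)))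
        (ℚᵘ.*≡* (cong (ℤ._* ℤ.+ 1) (sym (ℤ.pos-* m n))))))))

  ⟦⟧-mono : ∀ {m n} → m ℕ.≤ n → ⟦ m ⟧ ≤ ⟦ n ⟧
  ⟦⟧-mono {m} {n} m≤n = toℚᵘ-cancel-≤
    (ℚᵘ.≤-trans (ℚᵘ.≤-reflexive (toℚᵘ-fromℚᵘ (ℚᵘ.mkℚᵘ (ℤ.+ m) 0)))
     (ℚᵘ.≤-trans (ℚᵘ.*≤* (ℤ.*-monoʳ-≤-nonNeg (ℤ.+ 1) (ℤ.+≤+ m≤n)))
      (ℚᵘ.≤-reflexive (ℚᵘ.≃-sym (toℚᵘ-fromℚᵘ (ℚᵘ.mkℚᵘ (ℤ.+ n) 0))))))

  /-*-cancel : ∀ m d .{{_ : ℕ.NonZero d}} → (ℤ.+ m / d) * ⟦ d ⟧ ≡ ⟦ m ⟧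
  /-*-cancel m d@(suc d-1) = toℚᵘ-injective (ℚᵘ.≃-trans (toℚᵘ-homo-* (ℤ.+ m / d) ⟦ d ⟧)
    (ℚᵘ.≃-trans (ℚᵘ.*-cong (toℚᵘ-fromℚᵘ (ℚᵘ.mkℚᵘ (ℤ.+ m) d-1)) (toℚᵘ-fromℚᵘ (ℚᵘ.mkℚᵘ (ℤ.+ d) 0)))
     (ℚᵘ.≃-trans (ℚᵘ.*≡* eq) (ℚᵘ.≃-sym (toℚᵘ-fromℚᵘ (ℚᵘ.mkℚᵘ (ℤ.+ m) 0))))))
    where
    eq : (ℤ.+ m ℤ.* ℤ.+ d) ℤ.* ℤ.+ 1 ≡ ℤ.+ m ℤ.* ℤ.+ (d ℕ.* 1)
    eq = trans (ℤ.*-identityʳ _) (cong (λ z → ℤ.+ m ℤ.* ℤ.+ z) (sym (ℕ.*-identityʳ d)))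

⟦⟧-^ : ∀ m n → ⟦ m ℕ.^ n ⟧ ≡ ⟦ m ⟧ ^ n
⟦⟧-^ m zero = ⟦1⟧
⟦⟧-^ m (suc n) = trans (⟦⟧-* m (m ℕ.^ n)) (cong (⟦ m ⟧ *_) (⟦⟧-^ m n))

0≤⟦_⟧ : ∀ n → 0ℚ ≤ ⟦ n ⟧
0≤⟦ n ⟧ = subst (_≤ ⟦ n ⟧) ⟦0⟧ (⟦⟧-mono ℕ.z≤n)

⟦⟧-suc : ∀ n → ⟦ suc n ⟧ ≡ 1ℚ + ⟦ n ⟧
⟦⟧-suc n = trans (⟦⟧-+ 1 n) (cong (_+ ⟦ n ⟧) ⟦1⟧)

p<1+p : ∀ p → p < 1ℚ + p
p<1+p p = subst (_< 1ℚ + p) (+-identityˡ p) (+-monoˡ-< p (positive⁻¹ 1ℚ))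

⟦⟧-mono-< : ∀ {m n} → m ℕ.< n → ⟦ m ⟧ < ⟦ n ⟧
⟦⟧-mono-< {m} m<n = <-≤-trans (subst (⟦ m ⟧ <_) (sym (⟦⟧-suc m)) (p<1+p ⟦ m ⟧)) (⟦⟧-mono m<n)

⟦⟧-cancel-< : ∀ {m n} → ⟦ m ⟧ < ⟦ n ⟧ → m ℕ.< n
⟦⟧-cancel-< {m} {n} lt with n ℕ.≤? m
... | no p = ℕ.≰⇒> p
... | yes p with () ← <-irrefl refl (<-≤-trans lt (⟦⟧-mono p))

*-mono-≤ : ∀ {a b c d} → 0ℚ ≤ a → a ≤ b → 0ℚ ≤ c → c ≤ d → a * c ≤ b * d
*-mono-≤ {a} {b} {c} {d} 0≤a a≤b 0≤c c≤d = ≤-trans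
  (*-monoʳ-≤-nonNeg c {{nonNegative 0≤c}} a≤b)
  (*-monoˡ-≤-nonNeg b {{nonNegative (≤-trans 0≤a a≤b)}} c≤d)

*-monoˡ : ∀ {a b c} → 0ℚ ≤ c → a ≤ b → c * a ≤ c * b
*-monoˡ {c = c} 0≤c = *-monoˡ-≤-nonNeg c {{nonNegative 0≤c}}

*-monoʳ : ∀ {a b c} → 0ℚ ≤ c → a ≤ b → a * c ≤ b * c
*-monoʳ {c = c} 0≤c = *-monoʳ-≤-nonNeg c {{nonNegative 0≤c}}

*-nonNeg : ∀ {a b} → 0ℚ ≤ a → 0ℚ ≤ b → 0ℚ ≤ a * b
*-nonNeg {a} {b} 0≤a 0≤b = subst (_≤ a * b) (*-zeroˡ b) (*-monoʳ 0≤b 0≤a)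

*-pos : ∀ {a b} → 0ℚ < a → 0ℚ < b → 0ℚ < a * b
*-pos {a} {b} 0<a 0<b = subst (_< a * b) (*-zeroˡ b) (*-monoˡ-<-pos b {{positive 0<b}} 0<a)

+-nonNeg : ∀ {a b} → 0ℚ ≤ a → 0ℚ ≤ b → 0ℚ ≤ a + b
+-nonNeg = +-mono-≤

*-cancelˡ-≤ : ∀ {a b c} → 0ℚ < c → c * a ≤ c * b → a ≤ b
*-cancelˡ-≤ {c = c} 0<c = *-cancelˡ-≤-pos c {{positive 0<c}}

1≤* : ∀ {a b} → 1ℚ ≤ a → 1ℚ ≤ b → 1ℚ ≤ a * b
1≤* = λ p q → *-mono-≤ (nonNegative⁻¹ 1ℚ) p (nonNegative⁻¹ 1ℚ) q

0≤1 : 0ℚ ≤ 1ℚ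
0≤1 = nonNegative⁻¹ 1ℚ

^-nonNeg : ∀ {a} n → 0ℚ ≤ a → 0ℚ ≤ a ^ n
^-nonNeg zero 0≤a = 0≤1
^-nonNeg (suc n) 0≤a = *-nonNeg 0≤a (^-nonNeg n 0≤a)

^-pos : ∀ {a} n → 0ℚ < a → 0ℚ < a ^ n
^-pos zero 0<a = positive⁻¹ 1ℚ
^-pos (suc n) 0<a = *-pos 0<a (^-pos n 0<a)

^-mono : ∀ {a b} n → 0ℚ ≤ a → a ≤ b → a ^ n ≤ b ^ n
^-mono zero 0≤a a≤b = ≤-refl
^-mono (suc n) 0≤a a≤b = *-mono-≤ 0≤a a≤b (^-nonNeg n 0≤a) (^-mono n 0≤a a≤b)

*-mono-< : ∀ {a b c d} → 0ℚ ≤ a → a < b → 0ℚ ≤ c → c < d → a * c < b * d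
*-mono-< {a} {b} {c} {d} 0≤a a<b 0≤c c<d = ≤-<-trans
  (*-monoʳ 0≤c (<⇒≤ a<b))
  (*-monoʳ-<-pos b {{positive (≤-<-trans 0≤a a<b)}} c<d)

^-mono-< : ∀ {a b} n → 0ℚ ≤ a → a < b → a ^ suc n < b ^ suc n
^-mono-< {a} {b} zero 0≤a a<b = subst₂ _<_ (sym (*-identityʳ a)) (sym (*-identityʳ b)) a<b
^-mono-< (suc n) 0≤a a<b = *-mono-< 0≤a a<b (^-nonNeg (suc n) 0≤a) (^-mono-< n 0≤a a<b)

^-cancel : ∀ {a b} n → 0ℚ ≤ b → a ^ suc n ≤ b ^ suc n → a ≤ b
^-cancel {a} {b} n 0≤b le with a ≤? b
... | yes p = p
... | no p with () ← <-irrefl refl (<-≤-trans (^-mono-< n 0≤b (≰⇒> p)) le)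

^-distrib-* : ∀ a b n → (a * b) ^ n ≡ a ^ n * b ^ n
^-distrib-* a b zero = refl
^-distrib-* a b (suc n) = trans (cong ((a * b) *_) (^-distrib-* a b n))
  (solve 4 (λ a b c d → (a :* b) :* (c :* d) := (a :* c) :* (b :* d)) refl a b (a ^ n) (b ^ n))

^-+ : ∀ a m n → a ^ (m ℕ.+ n) ≡ a ^ m * a ^ n
^-+ a zero n = sym (*-identityˡ _)
^-+ a (suc m) n = trans (cong (a *_) (^-+ a m n)) (sym (*-assoc a _ _))

^-* : ∀ a m n → a ^ (m ℕ.* n) ≡ (a ^ m) ^ n
^-* a m zero = cong (a ^_) (ℕ.*-zeroʳ m)
^-* a m (suc n) = trans (cong (a ^_) (ℕ.*-suc m n)) (trans (^-+ a m (m ℕ.* n)) (cong (a ^ m *_) (^-* a m n)))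

1^n : ∀ n → 1ℚ ^ n ≡ 1ℚ
1^n zero = refl
1^n (suc n) = trans (*-identityˡ _) (1^n n)

bernoulli : ∀ x n → 0ℚ ≤ x → 1ℚ + ⟦ n ⟧ * x ≤ (1ℚ + x) ^ n
bernoulli x zero 0≤x = ≤-reflexive (trans (cong (λ z → 1ℚ + z * x) ⟦0⟧) (cong (λ z → 1ℚ + z) (*-zeroˡ x)))
bernoulli x (suc n) 0≤x = ≤-trans
  (≤-trans (≤-reflexive (trans (cong (λ z → 1ℚ + z * x) (⟦⟧-suc n))
     (solve 2 (λ n x → con 1ℚ :+ (con 1ℚ :+ n) :* x := ((con 1ℚ :+ x) :* (con 1ℚ :+ n :* x)) :- (n :* (x :* x))) refl ⟦ n ⟧ x)))
     (p-q≤p (*-nonNeg 0≤⟦ n ⟧ (*-nonNeg 0≤x 0≤x))))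
  (*-monoˡ (+-nonNeg 0≤1 0≤x) (bernoulli x n 0≤x))
  where
  p-q≤p : ∀ {p q} → 0ℚ ≤ q → p - q ≤ p
  p-q≤p {p} {q} h = subst (p - q ≤_) (+-identityʳ p) (+-monoʳ-≤ p (neg-antimono-≤ h))

-- Finite sums and products

𝟙 : Bool → ℚ
𝟙 b = if b then 1ℚ else 0ℚ

0≤𝟙 : ∀ b → 0ℚ ≤ 𝟙 b
0≤𝟙 true = 0≤1
0≤𝟙 false = ≤-refl

𝟙≤1 : ∀ b → 𝟙 b ≤ 1ℚ
𝟙≤1 true = ≤-refl
𝟙≤1 false = 0≤1

∑-cong : ∀ (xs : List A) {f g : A → ℚ} → (∀ x → f x ≡ g x) → ∑ xs f ≡ ∑ xs g
∑-cong [] h = refl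
∑-cong (x ∷ xs) h = cong₂ _+_ (h x) (∑-cong xs h)

∑-mono-∈ : ∀ (xs : List A) {f g : A → ℚ} → (∀ {x} → x ∈ xs → f x ≤ g x) → ∑ xs f ≤ ∑ xs g
∑-mono-∈ [] h = ≤-refl
∑-mono-∈ (x ∷ xs) h = +-mono-≤ (h (here refl)) (∑-mono-∈ xs (h ∘ there))

∑-mono : ∀ (xs : List A) {f g : A → ℚ} → (∀ x → f x ≤ g x) → ∑ xs f ≤ ∑ xs g
∑-mono xs h = ∑-mono-∈ xs (λ {x} _ → h x)

∑-0 : ∀ (xs : List A) → ∑ xs (λ _ → 0ℚ) ≡ 0ℚ
∑-0 [] = refl
∑-0 (x ∷ xs) = trans (+-identityˡ _) (∑-0 xs)

∑-nonNeg : ∀ (xs : List A) {f : A → ℚ} → (∀ x → 0ℚ ≤ f x) → 0ℚ ≤ ∑ xs f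
∑-nonNeg xs {f} h = subst (_≤ ∑ xs f) (∑-0 xs) (∑-mono xs h)

∑-cong-∈ : ∀ (xs : List A) {f g : A → ℚ} → (∀ {x} → x ∈ xs → f x ≡ g x) → ∑ xs f ≡ ∑ xs g
∑-cong-∈ [] h = refl
∑-cong-∈ (x ∷ xs) h = cong₂ _+_ (h (here refl)) (∑-cong-∈ xs (h ∘ there))

∑-+ : ∀ (xs : List A) (f g : A → ℚ) → ∑ xs (λ x → f x + g x) ≡ ∑ xs f + ∑ xs g
∑-+ [] f g = refl
∑-+ (x ∷ xs) f g = trans (cong (λ z → f x + g x + z) (∑-+ xs f g))
  (solve 4 (λ a b c d → (a :+ b) :+ (c :+ d) := (a :+ c) :+ (b :+ d)) refl (f x) (g x) (∑ xs f) (∑ xs g))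

∑-*ˡ : ∀ (xs : List A) c (f : A → ℚ) → ∑ xs (λ x → c * f x) ≡ c * ∑ xs f
∑-*ˡ [] c f = sym (*-zeroʳ c)
∑-*ˡ (x ∷ xs) c f = trans (cong (c * f x +_) (∑-*ˡ xs c f)) (sym (*-distribˡ-+ c _ _))

∑-*ʳ : ∀ (xs : List A) c (f : A → ℚ) → ∑ xs (λ x → f x * c) ≡ ∑ xs f * c
∑-*ʳ xs c f = trans (∑-cong xs (λ x → *-comm (f x) c)) (trans (∑-*ˡ xs c f) (*-comm c _))

∑-const : ∀ (xs : List A) c → ∑ xs (λ _ → c) ≡ ⟦ length xs ⟧ * c
∑-const [] c = sym (trans (cong (_* c) ⟦0⟧) (*-zeroˡ c))
∑-const (x ∷ xs) c = trans (cong (c +_) (∑-const xs c))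
  (trans (solve 2 (λ c n → c :+ n :* c := (con 1ℚ :+ n) :* c) refl c ⟦ length xs ⟧)
         (cong (_* c) (sym (⟦⟧-suc (length xs)))))

∑-swap : ∀ (xs : List A) (ys : List B) (f : A → B → ℚ) →
         ∑ xs (λ x → ∑ ys (f x)) ≡ ∑ ys (λ y → ∑ xs (λ x → f x y))
∑-swap [] ys f = sym (∑-0 ys)
∑-swap (x ∷ xs) ys f = trans (cong (∑ ys (f x) +_) (∑-swap xs ys f))
  (sym (∑-+ ys (f x) (λ y → ∑ xs (λ x → f x y))))

∑-++ : ∀ (xs ys : List A) (f : A → ℚ) → ∑ (xs ++ ys) f ≡ ∑ xs f + ∑ ys f
∑-++ [] ys f = sym (+-identityˡ _)
∑-++ (x ∷ xs) ys f = trans (cong (f x +_) (∑-++ xs ys f)) (sym (+-assoc (f x) _ _))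

∑-map : ∀ (g : A → B) (xs : List A) (f : B → ℚ) → ∑ (map g xs) f ≡ ∑ xs (f ∘ g)
∑-map g [] f = refl
∑-map g (x ∷ xs) f = cong (f (g x) +_) (∑-map g xs f)

∑-cartesianProductWith : ∀ {D : Set} (g : A → B → D) (xs : List A) (ys : List B) (f : D → ℚ) →
  ∑ (cartesianProductWith g xs ys) f ≡ ∑ xs (λ x → ∑ ys (λ y → f (g x y)))
∑-cartesianProductWith g [] ys f = refl
∑-cartesianProductWith g (x ∷ xs) ys f =
  trans (∑-++ (map (g x) ys) _ f) (cong₂ _+_ (∑-map (g x) ys f) (∑-cartesianProductWith g xs ys f))

∑-filter : ∀ {P : A → Set} (P? : Decidable P) (xs : List A) (f : A → ℚ) →
  ∑ (filter P? xs) f ≡ ∑ xs (λ x → 𝟙 (does (P? x)) * f x)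
∑-filter P? [] f = refl
∑-filter P? (x ∷ xs) f with does (P? x)
... | true  = cong₂ _+_ (sym (*-identityˡ (f x))) (∑-filter P? xs f)
... | false = trans (∑-filter P? xs f)
  (trans (sym (+-identityˡ _)) (cong (_+ ∑ xs (λ x → 𝟙 (does (P? x)) * f x)) (sym (*-zeroˡ (f x)))))

∑-tabulate : ∀ {n} (h : Fin n → A) (f : A → ℚ) → ∑ (tabulate h) f ≡ ∑ (allFin n) (f ∘ h)
∑-tabulate {n = zero} h f = refl
∑-tabulate {n = suc n} h f = cong (f (h zero) +_)
  (trans (∑-tabulate (h ∘ suc) f) (sym (∑-tabulate suc (f ∘ h))))

∑-allFin-suc : ∀ n (f : Fin (suc n) → ℚ) → ∑ (allFin (suc n)) f ≡ f zero + ∑ (allFin n) (f ∘ suc)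
∑-allFin-suc n f = cong (f zero +_) (∑-tabulate suc f)

∑-≟ : ∀ {n} (y : Fin n) (a : Fin n → ℚ) → ∑ (allFin n) (λ x → 𝟙 (does (x Fin.≟ y)) * a x) ≡ a y
∑-≟ {suc n} zero a = trans (∑-allFin-suc n (λ x → 𝟙 (does (x Fin.≟ zero)) * a x))
  (trans (cong₂ _+_ (*-identityˡ (a zero))
           (trans (∑-cong (allFin n) (λ x → *-zeroˡ (a (suc x)))) (∑-0 (allFin n))))
         (+-identityʳ (a zero)))
∑-≟ {suc n} (suc y) a = trans (∑-allFin-suc n (λ x → 𝟙 (does (x Fin.≟ suc y)) * a x))
  (trans (cong₂ _+_ (*-zeroˡ (a zero)) (∑-≟ y (a ∘ suc))) (+-identityˡ _))

∑-allFin-const : ∀ n c → ∑ (allFin n) (λ _ → c) ≡ ⟦ n ⟧ * c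
∑-allFin-const n c = trans (∑-const (allFin n) c) (cong (λ m → ⟦ m ⟧ * c) (length-tabulate {n = n} id))

∑-subset : ∀ {n} (C : Subset n) → ∑ (allFin n) (λ x → 𝟙 (lookup C x)) ≡ ⟦ ∣ C ∣ ⟧
∑-subset [] = sym ⟦0⟧
∑-subset {suc n} (true ∷ C) = trans (∑-allFin-suc n (λ x → 𝟙 (lookup (true ∷ C) x)))
  (trans (cong (λ z → 1ℚ + z) (∑-subset C)) (sym (⟦⟧-suc ∣ C ∣)))
∑-subset {suc n} (false ∷ C) = trans (∑-allFin-suc n (λ x → 𝟙 (lookup (false ∷ C) x)))
  (trans (+-identityˡ _) (∑-subset C))

Π : ∀ {v} → (A → ℚ) → Vec A v → ℚ
Π g []      = 1ℚ
Π g (x ∷ φ) = g x * Π g φ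

Π-nonNeg : ∀ {v} {g : A → ℚ} → (∀ x → 0ℚ ≤ g x) → (φ : Vec A v) → 0ℚ ≤ Π g φ
Π-nonNeg h [] = 0≤1
Π-nonNeg h (x ∷ φ) = *-nonNeg (h x) (Π-nonNeg h φ)

∑-Π : ∀ (xs : List A) (g : A → ℚ) v → ∑ (allVecs xs v) (Π g) ≡ ∑ xs g ^ v
∑-Π xs g zero = +-identityʳ 1ℚ
∑-Π xs g (suc v) = trans (∑-cartesianProductWith _∷_ xs (allVecs xs v) (Π g))
  (trans (∑-cong xs (λ x → trans (∑-*ˡ (allVecs xs v) (g x) (Π g)) (cong (g x *_) (∑-Π xs g v))))
         (∑-*ʳ xs (∑ xs g ^ v) g))

Π-* : ∀ {v} (f g : A → ℚ) (φ : Vec A v) → Π (λ x → f x * g x) φ ≡ Π f φ * Π g φ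
Π-* f g [] = refl
Π-* f g (x ∷ φ) = trans (cong (f x * g x *_) (Π-* f g φ))
  (solve 4 (λ a b c d → (a :* b) :* (c :* d) := (a :* c) :* (b :* d)) refl (f x) (g x) (Π f φ) (Π g φ))

Π-1 : ∀ {v} (φ : Vec A v) → Π (λ _ → 1ℚ) φ ≡ 1ℚ
Π-1 [] = refl
Π-1 (x ∷ φ) = trans (*-identityˡ _) (Π-1 φ)

Π-cong : ∀ {v} {f g : A → ℚ} (φ : Vec A v) → (∀ x → f x ≡ g x) → Π f φ ≡ Π g φ
Π-cong [] h = refl
Π-cong (x ∷ φ) h = cong₂ _*_ (h x) (Π-cong φ h)

Π-swap : ∀ {v w} (f : A → B → ℚ) (φ : Vec A v) (ψ : Vec B w) →
         Π (λ x → Π (f x) ψ) φ ≡ Π (λ y → Π (λ x → f x y) φ) ψ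
Π-swap f [] ψ = sym (Π-1 ψ)
Π-swap f (x ∷ φ) ψ = trans (cong (Π (f x) ψ *_) (Π-swap f φ ψ))
  (sym (Π-* (f x) (λ y → Π (λ x → f x y) φ) ψ))

-- Counting injections

Distinct : Vec (Fin n) v → Set
Distinct = AllPairs _≢_

distinct? : (φ : Vec (Fin n) v) → Dec (Distinct φ)
distinct? = allPairs? (λ i j → ¬? (i Fin.≟ j))

∑-injections : ∀ (f : Vec (Fin n) v → ℚ) →
  ∑ (injections v n) f ≡ ∑ (allVecs (allFin n) v) (λ φ → 𝟙 (does (distinct? φ)) * f φ)
∑-injections {n} {v} = ∑-filter distinct? (allVecs (allFin n) v)

mem : Vec (Fin n) v → Fin n → Bool
mem []      x = false
mem (y ∷ φ) x = does (x Fin.≟ y) ∨ mem φ x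

mem-lookup : (φ : Vec (Fin n) v) (i : Fin v) → T (mem φ (lookup φ i))
mem-lookup (y ∷ φ) zero with y Fin.≟ y
... | yes _ = tt
... | no ¬p = ⊥-elim (¬p refl)
mem-lookup (y ∷ φ) (suc i) with does (lookup φ i Fin.≟ y)
... | true  = tt
... | false = mem-lookup φ i

mem⇒lookup : (φ : Vec (Fin n) v) {x : Fin n} → T (mem φ x) → ∃[ i ] (lookup φ i ≡ x)
mem⇒lookup (y ∷ φ) {x} h with x Fin.≟ y
... | yes p = zero , sym p
... | no  _ = let (i , e) = mem⇒lookup φ h in suc i , e

all≢?-mem : (φ : Vec (Fin n) v) (x : Fin n) → does (all? (λ y → ¬? (x Fin.≟ y)) φ) ≡ not (mem φ x)
all≢?-mem [] x = refl
all≢?-mem (y ∷ φ) x with does (x Fin.≟ y)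
... | true  = refl
... | false = all≢?-mem φ x

all≢⇒¬mem : (φ : Vec (Fin n) v) {x : Fin n} → All (x ≢_) φ → mem φ x ≡ false
all≢⇒¬mem [] [] = refl
all≢⇒¬mem (y ∷ φ) {x} (p ∷ ps) with x Fin.≟ y
... | yes q = ⊥-elim (p q)
... | no  _ = all≢⇒¬mem φ ps

distinct-lookup : {φ : Vec (Fin n) v} → Distinct φ → ∀ {i j} → lookup φ i ≡ lookup φ j → i ≡ j
distinct-lookup {φ = x ∷ φ} (p ∷ d) {zero}  {zero}  e = refl
distinct-lookup {φ = x ∷ φ} (p ∷ d) {zero}  {suc j} e = ⊥-elim (All.lookup⁺ p j e)
distinct-lookup {φ = x ∷ φ} (p ∷ d) {suc i} {zero}  e = ⊥-elim (All.lookup⁺ p i (sym e))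
distinct-lookup {φ = x ∷ φ} (p ∷ d) {suc i} {suc j} e = cong suc (distinct-lookup d e)

-- Excluding one more entry `y` costs exactly `a y = 1`, since distinctness ensures that `y` has not
-- been excluded already. For an indicator `a` this counts the ways to extend an injection by one
-- vertex.
∑-outside : ∀ (a : Fin n → ℚ) {φ : Vec (Fin n) v} → Distinct φ → All (λ y → a y ≡ 1ℚ) φ →
  ∑ (allFin n) (λ x → 𝟙 (not (mem φ x)) * a x) ≡ ∑ (allFin n) a - ⟦ v ⟧
∑-outside {n} a [] [] = trans (∑-cong (allFin n) (λ x → *-identityˡ (a x)))
  (sym (trans (cong (λ z → ∑ (allFin n) a - z) ⟦0⟧) (+-identityʳ _)))
∑-outside {n} {suc v} a {y ∷ φ} (p ∷ d) (e ∷ es) =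
  trans (∑-cong (allFin n) step)
 (trans (∑-+ (allFin n) (λ x → 𝟙 (not (mem φ x)) * a x) (λ x → - 1ℚ * (𝟙 (does (x Fin.≟ y)) * (𝟙 (not (mem φ x)) * a x))))
 (trans (cong₂ _+_ (∑-outside a d es)
          (trans (∑-*ˡ (allFin n) (- 1ℚ) (λ x → 𝟙 (does (x Fin.≟ y)) * (𝟙 (not (mem φ x)) * a x)))
                 (cong (- 1ℚ *_) (trans (∑-≟ y (λ x → 𝟙 (not (mem φ x)) * a x))
                    (cong₂ (λ b z → 𝟙 (not b) * z) (all≢⇒¬mem φ p) e)))))
 (trans (solve 2 (λ s v → (s :- v) :+ con (- 1ℚ) := s :- (con 1ℚ :+ v)) refl (∑ (allFin n) a) ⟦ v ⟧)
        (cong (λ z → ∑ (allFin n) a - z) (sym (⟦⟧-suc v))))))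
  where
  step : ∀ x → 𝟙 (not (mem (y ∷ φ) x)) * a x ≡
         𝟙 (not (mem φ x)) * a x + - 1ℚ * (𝟙 (does (x Fin.≟ y)) * (𝟙 (not (mem φ x)) * a x))
  step x with does (x Fin.≟ y)
  ... | true  = solve 2 (λ m a → con 0ℚ :* a := m :* a :+ con (- 1ℚ) :* (con 1ℚ :* (m :* a))) refl (𝟙 (not (mem φ x))) (a x)
  ... | false = solve 2 (λ m a → m :* a := m :* a :+ con (- 1ℚ) :* (con 0ℚ :* (m :* a))) refl (𝟙 (not (mem φ x))) (a x)

-- The falling factorial `q (q - 1) ... (q - v + 1)`, over ℚ so that no subtraction is truncated.
falling : ℚ → ℕ → ℚ
falling q zero    = 1ℚ
falling q (suc v) = falling q v * (q - ⟦ v ⟧)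

Π-𝟙 : ∀ (b : Fin n → Bool) (φ : Vec (Fin n) v) →
      Π (𝟙 ∘ b) φ ≡ 0ℚ ⊎ All (λ y → 𝟙 (b y) ≡ 1ℚ) φ
Π-𝟙 b [] = inj₂ []
Π-𝟙 b (x ∷ φ) with b x in eq | Π-𝟙 b φ
... | false | _      = inj₁ (*-zeroˡ (Π (𝟙 ∘ b) φ))
... | true  | inj₁ z = inj₁ (trans (cong (1ℚ *_) z) (*-zeroʳ 1ℚ))
... | true  | inj₂ h = inj₂ (cong 𝟙 eq ∷ h)

-- Counts the injections into the set `b`. The head is chosen last and has to avoid the `v` entries
-- of the tail, all of which lie in `b`.
∑-injections-Π : ∀ (b : Fin n → Bool) v →
  ∑ (injections v n) (Π (𝟙 ∘ b)) ≡ falling (∑ (allFin n) (𝟙 ∘ b)) v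
∑-injections-Π b zero = refl
∑-injections-Π {n} b (suc v) =
  trans (∑-injections {n} {suc v} (Π a))
 (trans (∑-cartesianProductWith _∷_ (allFin n) (allVecs (allFin n) v) (λ φ → 𝟙 (does (distinct? φ)) * Π a φ))
 (trans (∑-swap (allFin n) (allVecs (allFin n) v) (λ x φ → 𝟙 (does (distinct? (x ∷ φ))) * Π a (x ∷ φ)))
 (trans (∑-cong (allVecs (allFin n) v) step)
 (trans (∑-*ʳ (allVecs (allFin n) v) (s - ⟦ v ⟧) (λ φ → 𝟙 (does (distinct? φ)) * Π a φ))
        (cong (_* (s - ⟦ v ⟧)) (trans (sym (∑-injections {n} {v} (Π a))) (∑-injections-Π b v)))))))
  where
  a = 𝟙 ∘ b
  s = ∑ (allFin n) a
  pull : ∀ φ → ∑ (allFin n) (λ x → 𝟙 (does (distinct? (x ∷ φ))) * Π a (x ∷ φ)) ≡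
         (𝟙 (does (distinct? φ)) * Π a φ) * ∑ (allFin n) (λ x → 𝟙 (not (mem φ x)) * a x)
  pull φ = trans (∑-cong (allFin n) (λ x → lem x))
                 (∑-*ˡ (allFin n) (𝟙 (does (distinct? φ)) * Π a φ) (λ x → 𝟙 (not (mem φ x)) * a x))
    where
    lem : ∀ x → 𝟙 (does (distinct? (x ∷ φ))) * Π a (x ∷ φ) ≡
          (𝟙 (does (distinct? φ)) * Π a φ) * (𝟙 (not (mem φ x)) * a x)
    lem x = trans (cong (λ m → 𝟙 (m ∧ does (distinct? φ)) * (a x * Π a φ)) (all≢?-mem φ x))
                  (go (not (mem φ x)) (does (distinct? φ)))
      where
      go : ∀ m d → 𝟙 (m ∧ d) * (a x * Π a φ) ≡ (𝟙 d * Π a φ) * (𝟙 m * a x)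
      go true d = solve 3 (λ d a p → d :* (a :* p) := (d :* p) :* (con 1ℚ :* a)) refl (𝟙 d) (a x) (Π a φ)
      go false d = solve 3 (λ d a p → con 0ℚ :* (a :* p) := (d :* p) :* (con 0ℚ :* a)) refl (𝟙 d) (a x) (Π a φ)
  step : ∀ φ → ∑ (allFin n) (λ x → 𝟙 (does (distinct? (x ∷ φ))) * Π a (x ∷ φ)) ≡
         (𝟙 (does (distinct? φ)) * Π a φ) * (s - ⟦ v ⟧)
  step φ = trans (pull φ) (go (distinct? φ) (Π-𝟙 b φ))
    where
    -- If `Π a φ` is 0 or `φ` has a repetition, a zero factor makes both sides vanish; only a
    -- genuine injection into `b` calls for `∑-outside`.
    go : (d : Dec (Distinct φ)) → Π a φ ≡ 0ℚ ⊎ All (λ y → 𝟙 (b y) ≡ 1ℚ) φ →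
      (𝟙 (does d) * Π a φ) * ∑ (allFin n) (λ x → 𝟙 (not (mem φ x)) * a x) ≡ (𝟙 (does d) * Π a φ) * (s - ⟦ v ⟧)
    go d (inj₁ z) = trans (cong (λ p → (𝟙 (does d) * p) * ∑ (allFin n) (λ x → 𝟙 (not (mem φ x)) * a x)) z)
      (trans (solve 3 (λ d x y → (d :* con 0ℚ) :* x := (d :* con 0ℚ) :* y) refl (𝟙 (does d)) _ (s - ⟦ v ⟧))
        (cong (λ p → (𝟙 (does d) * p) * (s - ⟦ v ⟧)) (sym z)))
    go (no _) (inj₂ _) = solve 3 (λ p x y → (con 0ℚ :* p) :* x := (con 0ℚ :* p) :* y) refl (Π a φ) _ (s - ⟦ v ⟧)
    go (yes d) (inj₂ h) = cong ((1ℚ * Π a φ) *_) (∑-outside a d h)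

∑-mem : {φ : Vec (Fin n) v} → Distinct φ → ∑ (allFin n) (𝟙 ∘ mem φ) ≡ ⟦ v ⟧
∑-mem {n} {v} {φ} d =
  trans (∑-cong (allFin n) step)
 (trans (∑-+ (allFin n) (λ _ → 1ℚ) (λ x → - 1ℚ * (𝟙 (not (mem φ x)) * 1ℚ)))
 (trans (cong (∑ (allFin n) (λ _ → 1ℚ) +_)
           (trans (∑-*ˡ (allFin n) (- 1ℚ) (λ x → 𝟙 (not (mem φ x)) * 1ℚ))
                  (cong (- 1ℚ *_) (∑-outside (λ _ → 1ℚ) d (All.universal (λ _ → refl) φ)))))
        (solve 2 (λ s v → s :+ con (- 1ℚ) :* (s :- v) := v) refl (∑ (allFin n) (λ _ → 1ℚ)) ⟦ v ⟧)))
  where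
  step : ∀ x → 𝟙 (mem φ x) ≡ 1ℚ + - 1ℚ * (𝟙 (not (mem φ x)) * 1ℚ)
  step x with mem φ x
  ... | true  = refl
  ... | false = refl

-- The definition of `falling` splits off the smallest factor, while the recursion of the factorial
-- splits off the largest.
falling-suc : ∀ q v → falling (1ℚ + q) (suc v) ≡ (1ℚ + q) * falling q v
falling-suc q zero = trans (cong (λ z → 1ℚ * (1ℚ + q - z)) ⟦0⟧)
  (solve 1 (λ q → con 1ℚ :* (con 1ℚ :+ q :- con 0ℚ) := (con 1ℚ :+ q) :* con 1ℚ) refl q)
falling-suc q (suc v) = trans (cong₂ _*_ (falling-suc q v) (cong (λ z → 1ℚ + q - z) (⟦⟧-suc v)))
  (solve 3 (λ q f v → ((con 1ℚ :+ q) :* f) :* (con 1ℚ :+ q :- (con 1ℚ :+ v)) := (con 1ℚ :+ q) :* (f :* (q :- v)))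
    refl q (falling q v) ⟦ v ⟧)

falling-! : ∀ v → falling ⟦ v ⟧ v ≡ ⟦ v ! ⟧
falling-! zero = sym ⟦1⟧
falling-! (suc v) = trans (cong (λ z → falling z (suc v)) (⟦⟧-suc v))
  (trans (falling-suc ⟦ v ⟧ v)
  (trans (cong₂ _*_ (sym (⟦⟧-suc v)) (falling-! v)) (sym (⟦⟧-* (suc v) (v !)))))

falling-lower : ∀ {q} v w → v ℕ.≤ w → ⟦ w ⟧ ≤ q → (q - ⟦ w ⟧) ^ v ≤ falling q v
falling-lower zero w v≤w w≤q = ≤-refl
falling-lower {q} (suc v) w v<w w≤q = subst (_≤ falling q v * (q - ⟦ v ⟧)) (*-comm ((q - ⟦ w ⟧) ^ v) (q - ⟦ w ⟧))
  (*-mono-≤ (^-nonNeg v 0≤d) (falling-lower v w (ℕ.<⇒≤ v<w) w≤q) 0≤d (+-monoʳ-≤ q (neg-antimono-≤ (⟦⟧-mono (ℕ.<⇒≤ v<w)))))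
  where
  0≤d : 0ℚ ≤ q - ⟦ w ⟧
  0≤d = subst (_≤ q - ⟦ w ⟧) (+-inverseʳ ⟦ w ⟧) (+-monoˡ-≤ (- ⟦ w ⟧) w≤q)

-- Flipping an edge

adj-irrefl : (G : Graph n) (i : Fin n) → adj G i i ≡ false
adj-irrefl (r ∷ G) zero    = refl
adj-irrefl (r ∷ G) (suc i) = adj-irrefl G i

adj-sym : (G : Graph n) (i j : Fin n) → adj G i j ≡ adj G j i
adj-sym (r ∷ G) zero    zero    = refl
adj-sym (r ∷ G) zero    (suc j) = refl
adj-sym (r ∷ G) (suc i) zero    = refl
adj-sym (r ∷ G) (suc i) (suc j) = adj-sym G i j

adj-injective : {G H : Graph n} → (∀ i j → adj G i j ≡ adj H i j) → G ≡ H
adj-injective {G = []} {[]} h = refl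
adj-injective {G = r ∷ G} {s ∷ H} h = cong₂ _∷_
  (trans (sym (Vec.tabulate∘lookup r)) (trans (Vec.tabulate-cong (λ j → h zero (suc j))) (Vec.tabulate∘lookup s)))
  (adj-injective (λ i j → h (suc i) (suc j)))

adj-plant : (C : Subset n) (G : Graph n) {i j : Fin n} → i ≢ j →
  adj (plant C G) i j ≡ adj G i j ∨ (lookup C i ∧ lookup C j)
adj-plant (c ∷ C) (r ∷ G) {zero}  {zero}  i≢j = ⊥-elim (i≢j refl)
adj-plant (c ∷ C) (r ∷ G) {zero}  {suc j} i≢j = Vec.lookup-zipWith (λ d e → e ∨ (c ∧ d)) j C r
adj-plant (c ∷ C) (r ∷ G) {suc i} {zero}  i≢j =
  trans (Vec.lookup-zipWith (λ d e → e ∨ (c ∧ d)) i C r) (cong (lookup r i ∨_) (∧-comm c (lookup C i)))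
adj-plant (c ∷ C) (r ∷ G) {suc i} {suc j} i≢j = adj-plant C G (i≢j ∘ cong suc)

-- Toggles the edge `ab`, and is the identity for `a = b`. Its invariance of the sum over all graphs
-- stands in for the independence of fair edges.
flip : Fin n → Fin n → Graph n → Graph n
flip zero    zero    G       = G
flip zero    (suc b) (r ∷ G) = (r [ b ]%= not) ∷ G
flip (suc a) zero    (r ∷ G) = (r [ a ]%= not) ∷ G
flip (suc a) (suc b) (r ∷ G) = r ∷ flip a b G

adj-flip-eq : ∀ {a b : Fin n} → a ≢ b → (G : Graph n) → adj (flip a b G) a b ≡ not (adj G a b)
adj-flip-eq {a = zero}  {zero}  a≢b G       = ⊥-elim (a≢b refl)
adj-flip-eq {a = zero}  {suc b} a≢b (r ∷ G) = Vec.lookup∘updateAt b r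
adj-flip-eq {a = suc a} {zero}  a≢b (r ∷ G) = Vec.lookup∘updateAt a r
adj-flip-eq {a = suc a} {suc b} a≢b (r ∷ G) = adj-flip-eq (a≢b ∘ cong suc) G

adj-flip-neq : ∀ (a b : Fin n) {i j : Fin n} → ¬ (i ≡ a × j ≡ b) → ¬ (i ≡ b × j ≡ a) →
  (G : Graph n) → adj (flip a b G) i j ≡ adj G i j
adj-flip-neq zero    zero    h h′ G = refl
adj-flip-neq zero    (suc b) {zero} {zero} h h′ (r ∷ G) = refl
adj-flip-neq zero    (suc b) {zero} {suc j} h h′ (r ∷ G) = Vec.lookup∘updateAt′ j b (λ e → h (refl , cong suc e)) r
adj-flip-neq zero    (suc b) {suc i} {zero} h h′ (r ∷ G) = Vec.lookup∘updateAt′ i b (λ e → h′ (cong suc e , refl)) r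
adj-flip-neq zero    (suc b) {suc i} {suc j} h h′ (r ∷ G) = refl
adj-flip-neq (suc a) zero    {zero} {zero} h h′ (r ∷ G) = refl
adj-flip-neq (suc a) zero    {zero} {suc j} h h′ (r ∷ G) = Vec.lookup∘updateAt′ j a (λ e → h′ (refl , cong suc e)) r
adj-flip-neq (suc a) zero    {suc i} {zero} h h′ (r ∷ G) = Vec.lookup∘updateAt′ i a (λ e → h (cong suc e , refl)) r
adj-flip-neq (suc a) zero    {suc i} {suc j} h h′ (r ∷ G) = refl
adj-flip-neq (suc a) (suc b) {zero} {zero} h h′ (r ∷ G) = refl
adj-flip-neq (suc a) (suc b) {zero} {suc j} h h′ (r ∷ G) = refl
adj-flip-neq (suc a) (suc b) {suc i} {zero} h h′ (r ∷ G) = refl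
adj-flip-neq (suc a) (suc b) {suc i} {suc j} h h′ (r ∷ G) =
  adj-flip-neq a b (λ (p , q) → h (cong suc p , cong suc q)) (λ (p , q) → h′ (cong suc p , cong suc q)) G

bools : List Bool
bools = true ∷ false ∷ []

∑-allVecs-update : (i : Fin n) (f : Vec Bool n → ℚ) →
  ∑ (allVecs bools n) (λ r → f (r [ i ]%= not)) ≡ ∑ (allVecs bools n) f
∑-allVecs-update {suc n} zero f =
  trans (∑-cartesianProductWith _∷_ bools (allVecs bools n) (λ r → f (r [ zero ]%= not)))
 (trans (solve 2 (λ x y → x :+ (y :+ con 0ℚ) := y :+ (x :+ con 0ℚ)) refl (s false) (s true))
        (sym (∑-cartesianProductWith _∷_ bools (allVecs bools n) f)))
  where
  s : Bool → ℚ
  s b = ∑ (allVecs bools n) (λ r → f (b ∷ r))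
∑-allVecs-update {suc n} (suc i) f =
  trans (∑-cartesianProductWith _∷_ bools (allVecs bools n) (λ r → f (r [ suc i ]%= not)))
 (trans (∑-cong bools (λ b → ∑-allVecs-update i (λ r → f (b ∷ r))))
        (sym (∑-cartesianProductWith _∷_ bools (allVecs bools n) f)))

∑-flip : (a b : Fin n) (f : Graph n → ℚ) → ∑ (allGraphs n) (f ∘ flip a b) ≡ ∑ (allGraphs n) f
∑-flip zero zero f = refl
∑-flip {suc n} zero (suc b) f =
  trans (∑-cartesianProductWith _∷_ (allVecs bools n) (allGraphs n) (f ∘ flip zero (suc b)))
 (trans (∑-allVecs-update b (λ r → ∑ (allGraphs n) (λ G → f (r ∷ G))))
        (sym (∑-cartesianProductWith _∷_ (allVecs bools n) (allGraphs n) f)))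
∑-flip {suc n} (suc a) zero f =
  trans (∑-cartesianProductWith _∷_ (allVecs bools n) (allGraphs n) (f ∘ flip (suc a) zero))
 (trans (∑-allVecs-update a (λ r → ∑ (allGraphs n) (λ G → f (r ∷ G))))
        (sym (∑-cartesianProductWith _∷_ (allVecs bools n) (allGraphs n) f)))
∑-flip {suc n} (suc a) (suc b) f =
  trans (∑-cartesianProductWith _∷_ (allVecs bools n) (allGraphs n) (f ∘ flip (suc a) (suc b)))
 (trans (∑-cong (allVecs bools n) (λ r → ∑-flip a b (λ G → f (r ∷ G))))
        (sym (∑-cartesianProductWith _∷_ (allVecs bools n) (allGraphs n) f)))

-- The flip preserves the sum, so the sum equals its own negative.
∑-antisymmetric : (a b : Fin n) (f : Graph n → ℚ) → (∀ G → f (flip a b G) ≡ - 1ℚ * f G) →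
  ∑ (allGraphs n) f ≡ 0ℚ
∑-antisymmetric {n} a b f h = trans
  (solve 1 (λ s → s := con ½ :* (s :- con (- 1ℚ) :* s)) refl s)
  (trans (cong (λ z → ½ * (s - z)) (sym s≡-s))
         (solve 1 (λ s → con ½ :* (s :- s) := con 0ℚ) refl s))
  where
  s = ∑ (allGraphs n) f
  s≡-s : s ≡ - 1ℚ * s
  s≡-s = trans (sym (∑-flip a b f)) (trans (∑-cong (allGraphs n) h) (∑-*ˡ (allGraphs n) (- 1ℚ) f))

∏-* : {A : Set} (xs : List A) (f g : A → ℚ) → ∏ xs (λ x → f x * g x) ≡ ∏ xs f * ∏ xs g
∏-* [] f g = refl
∏-* (x ∷ xs) f g = trans (cong (f x * g x *_) (∏-* xs f g))
  (solve 4 (λ a b c d → (a :* b) :* (c :* d) := (a :* c) :* (b :* d)) refl (f x) (g x) (∏ xs f) (∏ xs g))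

∏-cong-∈ : {A : Set} (xs : List A) {f g : A → ℚ} → (∀ {x} → x ∈ xs → f x ≡ g x) → ∏ xs f ≡ ∏ xs g
∏-cong-∈ [] h = refl
∏-cong-∈ (x ∷ xs) h = cong₂ _*_ (h (here refl)) (∏-cong-∈ xs (h ∘ there))

∏-1 : {A : Set} (xs : List A) {f : A → ℚ} → (∀ {x} → x ∈ xs → f x ≡ 1ℚ) → ∏ xs f ≡ 1ℚ
∏-1 [] h = refl
∏-1 (x ∷ xs) h = trans (cong₂ _*_ (h (here refl)) (∏-1 xs (h ∘ there))) refl

∏-single : {A : Set} {xs : List A} {f : A → ℚ} {y : A} → Unique xs → y ∈ xs →
  (∀ {x} → x ∈ xs → x ≢ y → f x ≡ 1ℚ) → ∏ xs f ≡ f y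
∏-single {xs = x ∷ xs} {f} (p ∷ u) (here refl) h =
  trans (cong (f x *_) (∏-1 xs (λ z∈ → h (there z∈) (λ { refl → ListAll.lookup p z∈ refl })))) (*-identityʳ (f x))
∏-single {xs = x ∷ xs} {f} {y} (p ∷ u) (there y∈) h =
  trans (cong₂ _*_ (h (here refl) (λ { refl → ListAll.lookup p y∈ refl })) (∏-single u y∈ (h ∘ there))) (*-identityˡ (f y))

edges-unique : (H : Graph v) → Unique (edges H)
edges-unique {v} H = Unique.filter⁺ _ (Unique.cartesianProduct⁺ (Unique.allFin⁺ v) (Unique.allFin⁺ v))

∈-edges⁺ : (H : Graph v) {x y : Fin v} → x Fin.< y → T (adj H x y) → (x , y) ∈ edges H
∈-edges⁺ H {x} {y} x<y a = ∈-filter⁺ (λ { (a , b) → (a Fin.<? b) ×-dec T? (adj H a b) })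
  (∈-cartesianProduct⁺ (∈-allFin x) (∈-allFin y)) (x<y , a)

∈-edges⁻ : (H : Graph v) {x y : Fin v} → (x , y) ∈ edges H → x Fin.< y × T (adj H x y)
∈-edges⁻ {v} H e = proj₂ (∈-filter⁻ (λ { (a , b) → (a Fin.<? b) ×-dec T? (adj H a b) })
  {xs = cartesianProduct (allFin v) (allFin v)} e)

-- Characters of placed graphs

-- Ranges over ordered pairs `x , y`, so it is symmetric in `a` and `b`, whereas `edges` lists each
-- edge once, with the smaller vertex first.
Placed : Graph v → Vec (Fin n) v → Fin n → Fin n → Set
Placed H φ a b = ∃[ x ] ∃[ y ] (T (adj H x y) × lookup φ x ≡ a × lookup φ y ≡ b)

placed? : (H : Graph v) (φ : Vec (Fin n) v) (a b : Fin n) → Dec (Placed H φ a b)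
placed? H φ a b = Fin.any? λ x → Fin.any? λ y → T? (adj H x y) ×-dec ((lookup φ x Fin.≟ a) ×-dec (lookup φ y Fin.≟ b))

placed : Graph v → Vec (Fin n) v → Fin n → Fin n → Bool
placed H φ a b = does (placed? H φ a b)

placed⁺ : (H : Graph v) (φ : Vec (Fin n) v) {x y : Fin v} → T (adj H x y) →
  placed H φ (lookup φ x) (lookup φ y) ≡ true
placed⁺ H φ {x} {y} h = dec-true (placed? H φ _ _) (x , y , h , refl , refl)

placed⁻ : (H : Graph v) (φ : Vec (Fin n) v) {a b : Fin n} → placed H φ a b ≡ true → Placed H φ a b
placed⁻ H φ {a} {b} h with placed? H φ a b
... | yes p = p

-- The factor by which a flip changes a character: `- 1` if the flipped edge is used. The convention
-- is opposite to that of `signs`, where an edge counts as `1`.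
sign : Bool → ℚ
sign b = if b then - 1ℚ else 1ℚ

Inside : Subset n → Fin n → Fin n → Set
Inside C a b = T (lookup C a ∧ lookup C b)

module _ (C : Subset n) {a b : Fin n} (a≢b : a ≢ b) (out : ¬ Inside C a b) (G : Graph n) where

  -- `plant` overwrites only pairs inside `C`, so a flip outside `C` survives the planting.
  signs-flip-eq : signs (plant C (flip a b G)) a b ≡ signs (plant C G) a b * - 1ℚ
  signs-flip-eq rewrite adj-plant C (flip a b G) a≢b | adj-plant C G a≢b | adj-flip-eq a≢b G
    with lookup C a ∧ lookup C b | adj G a b
  ... | true  | _     = ⊥-elim (out tt)
  ... | false | true  = refl
  ... | false | false = refl

  signs-flip-neq : ∀ {i j} → i ≢ j → ¬ (i ≡ a × j ≡ b) → ¬ (i ≡ b × j ≡ a) →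
    signs (plant C (flip a b G)) i j ≡ signs (plant C G) i j
  signs-flip-neq i≢j h h′ rewrite adj-plant C (flip a b G) i≢j | adj-plant C G i≢j | adj-flip-neq a b h h′ G = refl

signs-sym : (G : Graph n) (i j : Fin n) → signs G i j ≡ signs G j i
signs-sym G i j = cong (λ e → if e then 1ℚ else - 1ℚ) (adj-sym G i j)

module _ (C : Subset n) (H : Graph v) {φ : Vec (Fin n) v} (d : Distinct φ) {a b : Fin n} (a≢b : a ≢ b)
         (out : ¬ Inside C a b) (G : Graph n) where

  private
    X X′ : Fin n → Fin n → ℚ
    X  = signs (plant C G)
    X′ = signs (plant C (flip a b G))

    apart : ∀ {x y} → x Fin.< y → lookup φ x ≢ lookup φ y
    apart x<y e = Fin.<⇒≢ x<y (distinct-lookup d e)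

  χ-flip-edge : ∀ {x y} → x Fin.< y → T (adj H x y) →
    (lookup φ x ≡ a × lookup φ y ≡ b) ⊎ (lookup φ x ≡ b × lookup φ y ≡ a) →
    χ H φ X′ ≡ - 1ℚ * χ H φ X
  χ-flip-edge {x} {y} x<y h ab =
    trans (∏-cong-∈ (edges H) step)
   (trans (∏-* (edges H) (λ { (i , j) → X (lookup φ i) (lookup φ j) }) mark)
   (trans (cong (χ H φ X *_) (trans (∏-single (edges-unique H) (∈-edges⁺ H x<y h) other) at))
          (*-comm (χ H φ X) (- 1ℚ))))
    where
    _≟²_ = ≡-dec Fin._≟_ Fin._≟_
    -- The ratio of the two products, factor by factor. As `edges H` has no duplicates, its product
    -- is the single factor at `(x , y)`.
    mark : Fin v × Fin v → ℚ
    mark e = sign (does (e ≟² (x , y)))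
    at : mark (x , y) ≡ - 1ℚ
    at = cong sign (dec-true ((x , y) ≟² (x , y)) refl)
    other : ∀ {e} → e ∈ edges H → e ≢ (x , y) → mark e ≡ 1ℚ
    other {e} _ e≢ = cong sign (dec-false (e ≟² (x , y)) e≢)
    flipped : X′ (lookup φ x) (lookup φ y) ≡ X (lookup φ x) (lookup φ y) * - 1ℚ
    flipped = go ab
      where
      go : (lookup φ x ≡ a × lookup φ y ≡ b) ⊎ (lookup φ x ≡ b × lookup φ y ≡ a) →
        X′ (lookup φ x) (lookup φ y) ≡ X (lookup φ x) (lookup φ y) * - 1ℚ
      go (inj₁ (p , q)) = subst₂ (λ i j → X′ i j ≡ X i j * - 1ℚ) (sym p) (sym q) (signs-flip-eq C a≢b out G)
      go (inj₂ (p , q)) = subst₂ (λ i j → X′ i j ≡ X i j * - 1ℚ) (sym p) (sym q)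
        (trans (signs-sym (plant C (flip a b G)) b a)
          (trans (signs-flip-eq C a≢b out G) (cong (_* - 1ℚ) (signs-sym (plant C G) a b))))
    -- By injectivity of `φ`, an edge with the same image as `xy` is `xy` itself or its reversal,
    -- and `x′ < y′` excludes the reversal.
    clash : ∀ {x′ y′} → x′ Fin.< y′ → ¬ ((x′ , y′) ≡ (x , y)) →
      ¬ (lookup φ x′ ≡ lookup φ x × lookup φ y′ ≡ lookup φ y) × ¬ (lookup φ x′ ≡ lookup φ y × lookup φ y′ ≡ lookup φ x)
    clash x′<y′ ne = (λ (p , q) → ne (cong₂ _,_ (distinct-lookup d p) (distinct-lookup d q)))
      , (λ (p , q) → Fin.<-asym x<y (subst₂ Fin._<_ (distinct-lookup d p) (distinct-lookup d q) x′<y′))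
    unflipped : ∀ {x′ y′} → x′ Fin.< y′ → ¬ ((x′ , y′) ≡ (x , y)) →
      X′ (lookup φ x′) (lookup φ y′) ≡ X (lookup φ x′) (lookup φ y′)
    unflipped {x′} {y′} x′<y′ ne = go ab (clash x′<y′ ne)
      where
      go : (lookup φ x ≡ a × lookup φ y ≡ b) ⊎ (lookup φ x ≡ b × lookup φ y ≡ a) →
        ¬ (lookup φ x′ ≡ lookup φ x × lookup φ y′ ≡ lookup φ y) × ¬ (lookup φ x′ ≡ lookup φ y × lookup φ y′ ≡ lookup φ x) →
        X′ (lookup φ x′) (lookup φ y′) ≡ X (lookup φ x′) (lookup φ y′)
      go (inj₁ (p , q)) (c₁ , c₂) = signs-flip-neq C a≢b out G (apart x′<y′)
        (λ (r , s) → c₁ (trans r (sym p) , trans s (sym q))) (λ (r , s) → c₂ (trans r (sym q) , trans s (sym p)))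
      go (inj₂ (p , q)) (c₁ , c₂) = signs-flip-neq C a≢b out G (apart x′<y′)
        (λ (r , s) → c₂ (trans r (sym q) , trans s (sym p))) (λ (r , s) → c₁ (trans r (sym p) , trans s (sym q)))
    step : ∀ {e} → e ∈ edges H →
      X′ (lookup φ (proj₁ e)) (lookup φ (proj₂ e)) ≡ X (lookup φ (proj₁ e)) (lookup φ (proj₂ e)) * mark e
    step {e} e∈ with e ≟² (x , y)
    ... | yes refl = flipped
    ... | no  ne   = trans (unflipped (proj₁ (∈-edges⁻ H e∈)) ne) (sym (*-identityʳ _))

  χ-flip : χ H φ X′ ≡ sign (placed H φ a b) * χ H φ X
  χ-flip with placed? H φ a b
  ... | no ¬p = trans (∏-cong-∈ (edges H) step) (sym (*-identityˡ (χ H φ X)))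
    where
    step : ∀ {e} → e ∈ edges H →
      X′ (lookup φ (proj₁ e)) (lookup φ (proj₂ e)) ≡ X (lookup φ (proj₁ e)) (lookup φ (proj₂ e))
    step {x , y} e∈ = let (x<y , h) = ∈-edges⁻ H e∈ in
      signs-flip-neq C a≢b out G (apart x<y)
        (λ (p , q) → ¬p (x , y , h , p , q))
        (λ (p , q) → ¬p (y , x , subst T (adj-sym H x y) h , q , p))
  ... | yes (x , y , h , p , q) with Fin.<-cmp x y
  ...   | tri< x<y _ _ = χ-flip-edge x<y h (inj₁ (p , q))
  ...   | tri≈ _ refl _ = ⊥-elim (a≢b (trans (sym p) q))
  ...   | tri> _ _ y<x = χ-flip-edge y<x (subst T (adj-sym H x y) h) (inj₂ (q , p))

placed-irrefl : (H : Graph v) {φ : Vec (Fin n) v} → Distinct φ → ∀ {a} → placed H φ a a ≡ false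
placed-irrefl H {φ} d {a} = dec-false (placed? H φ a a) λ (x , y , h , p , q) →
  subst T (adj-irrefl H x) (subst (T ∘ adj H x) (sym (distinct-lookup d (trans p (sym q)))) h)

placed⇒≢ : (H : Graph v) {φ : Vec (Fin n) v} → Distinct φ → ∀ {a b} → placed H φ a b ≡ true → a ≢ b
placed⇒≢ H d e refl with () ← trans (sym e) (placed-irrefl H d)

±1 : ℚ → Set
±1 q = q ≡ 1ℚ ⊎ q ≡ - 1ℚ

±1-* : ∀ {p q} → ±1 p → ±1 q → ±1 (p * q)
±1-* (inj₁ refl) (inj₁ refl) = inj₁ refl
±1-* (inj₁ refl) (inj₂ refl) = inj₂ refl
±1-* (inj₂ refl) (inj₁ refl) = inj₂ refl
±1-* (inj₂ refl) (inj₂ refl) = inj₁ refl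

±1⇒≤1 : ∀ {p} → ±1 p → p ≤ 1ℚ
±1⇒≤1 (inj₁ refl) = ≤-refl
±1⇒≤1 (inj₂ refl) = ≤-trans (nonPositive⁻¹ (- 1ℚ)) 0≤1

∏-±1 : {A : Set} (xs : List A) {f : A → ℚ} → (∀ x → ±1 (f x)) → ±1 (∏ xs f)
∏-±1 [] h = inj₁ refl
∏-±1 (x ∷ xs) h = ±1-* (h x) (∏-±1 xs h)

χ-±1 : (H : Graph v) (φ : Vec (Fin n) v) (G : Graph n) → ±1 (χ H φ (signs G))
χ-±1 H φ G = ∏-±1 (edges H) λ { (a , b) → one a b }
  where
  one : ∀ a b → ±1 (signs G (lookup φ a) (lookup φ b))
  one a b with adj G (lookup φ a) (lookup φ b)
  ... | true  = inj₁ refl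
  ... | false = inj₂ refl

-- Moments are kept as unnormalised sums, multiples of this count; division takes place only in
-- `𝔼-≡` and `𝔼-≤`.
#G : ℕ → ℚ
#G n = ∑ (allGraphs n) (λ _ → 1ℚ)

0≤#G : ∀ n → 0ℚ ≤ #G n
0≤#G n = ∑-nonNeg (allGraphs n) (λ _ → 0≤1)

module _ (C : Subset n) where

  ∑χ-inside : (H : Graph v) {φ : Vec (Fin n) v} → Distinct φ → (∀ i → T (lookup C (lookup φ i))) →
    ∑ (allGraphs n) (λ G → χ H φ (signs (plant C G))) ≡ #G n
  ∑χ-inside H {φ} d h = ∑-cong (allGraphs n) λ G → ∏-1 (edges H) λ { {x , y} e∈ → one G (proj₁ (∈-edges⁻ H e∈)) }
    where
    one : ∀ G {x y} → x Fin.< y → signs (plant C G) (lookup φ x) (lookup φ y) ≡ 1ℚ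
    one G {x} {y} x<y rewrite adj-plant C G (λ e → Fin.<⇒≢ x<y (distinct-lookup d e))
      with lookup C (lookup φ x) | h x | lookup C (lookup φ y) | h y
    ... | true | _ | true | _ = cong (λ e → if e then 1ℚ else - 1ℚ) (∨-zeroʳ (adj G (lookup φ x) (lookup φ y)))

  ∑χ-outside : (H : Graph v) {φ : Vec (Fin n) v} → Distinct φ → ∀ {a b} → placed H φ a b ≡ true → ¬ Inside C a b →
    ∑ (allGraphs n) (λ G → χ H φ (signs (plant C G))) ≡ 0ℚ
  ∑χ-outside H {φ} d {a} {b} e out = ∑-antisymmetric a b (λ G → χ H φ (signs (plant C G))) λ G →
    trans (χ-flip C H d (placed⇒≢ H d e) out G) (cong (λ s → sign s * χ H φ (signs (plant C G))) e)

  module _ (H K : Graph v) {φ ψ : Vec (Fin n) v} (dφ : Distinct φ) (dψ : Distinct ψ) where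

    ∑χχ : ℚ
    ∑χχ = ∑ (allGraphs n) (λ G → χ H φ (signs (plant C G)) * χ K ψ (signs (plant C G)))

    ∑χχ≤ : ∑χχ ≤ #G n
    ∑χχ≤ = ∑-mono (allGraphs n) (λ G → ±1⇒≤1 (±1-* (χ-±1 H φ (plant C G)) (χ-±1 K ψ (plant C G))))

    -- An edge used by exactly one of the two characters negates their product when flipped.
    ∑χχ-odd : ∀ {a b} → placed H φ a b ≢ placed K ψ a b → ¬ Inside C a b → ∑χχ ≡ 0ℚ
    ∑χχ-odd {a} {b} odd out = ∑-antisymmetric a b (λ G → χ H φ (signs (plant C G)) * χ K ψ (signs (plant C G))) λ G →
      trans (cong₂ _*_ (χ-flip C H dφ a≢b out G) (χ-flip C K dψ a≢b out G))
            (go (placed H φ a b) (placed K ψ a b) odd (χ H φ (signs (plant C G))) (χ K ψ (signs (plant C G))))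
      where
      a≢b : a ≢ b
      a≢b refl = odd (trans (placed-irrefl H dφ) (sym (placed-irrefl K dψ)))
      go : ∀ s t → s ≢ t → ∀ x y → (sign s * x) * (sign t * y) ≡ - 1ℚ * (x * y)
      go true  true  ne x y = ⊥-elim (ne refl)
      go false false ne x y = ⊥-elim (ne refl)
      go true  false ne = solve 2 (λ x y → (con (- 1ℚ) :* x) :* (con 1ℚ :* y) := con (- 1ℚ) :* (x :* y)) refl
      go false true  ne = solve 2 (λ x y → (con 1ℚ :* x) :* (con (- 1ℚ) :* y) := con (- 1ℚ) :* (x :* y)) refl

-- Correlation of two characters

-- The first step of a walk to some other vertex, which `2 ≤ v` supplies. With every vertex on an
-- edge, conditions on edges become conditions on vertices.
neighbour : (H : Graph v) → Connected H → 2 ℕ.≤ v → ∀ x → ∃[ y ] T (adj H x y)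
neighbour {suc (suc v)} H conn _ x = step (other x) (conn x _)
  where
  other : (x : Fin (suc (suc v))) → ∃[ y ] (x ≢ y)
  other zero    = suc zero , λ ()
  other (suc x) = zero , λ ()
  step : (o : ∃[ y ] (x ≢ y)) → Star (λ a b → T (adj H a b)) x (proj₁ o) → ∃[ y ] T (adj H x y)
  step (_ , x≢y) Walk.ε     = ⊥-elim (x≢y refl)
  step _         (h ◅ _) = _ , h
neighbour {suc zero} H conn (ℕ.s≤s ())

crossing : (H : Graph v) (Q : Fin v → Bool) {x y : Fin v} → Star (λ a b → T (adj H a b)) x y →
  Q x ≡ true → Q y ≡ false → ∃[ p ] ∃[ q ] (T (adj H p q) × Q p ≡ true × Q q ≡ false)
crossing H Q Walk.ε qx qy with () ← trans (sym qx) qy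
crossing H Q (_◅_ {x} {z} h s) qx qy with Q z in qz
... | true  = crossing H Q s qz qy
... | false = x , z , h , qx , qz

Π-𝟙-outside : ∀ (b : Fin n → Bool) (φ : Vec (Fin n) v) i → b (lookup φ i) ≡ false → Π (𝟙 ∘ b) φ ≡ 0ℚ
Π-𝟙-outside b (x ∷ φ) zero    e = trans (cong (λ c → 𝟙 c * Π (𝟙 ∘ b) φ) e) (*-zeroˡ (Π (𝟙 ∘ b) φ))
Π-𝟙-outside b (x ∷ φ) (suc i) e = trans (cong (𝟙 (b x) *_) (Π-𝟙-outside b φ i e)) (*-zeroʳ (𝟙 (b x)))

Π-𝟙-inside : ∀ (b : Fin n → Bool) (φ : Vec (Fin n) v) → (∀ i → b (lookup φ i) ≡ true) → Π (𝟙 ∘ b) φ ≡ 1ℚ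
Π-𝟙-inside b []      h = refl
Π-𝟙-inside b (x ∷ φ) h = cong₂ _*_ (cong 𝟙 (h zero)) (Π-𝟙-inside b φ (h ∘ suc))

∧-false : ∀ {x y} → x ≡ false → ¬ T (x ∧ y)
∧-false refl ()

module _ (C : Subset n) where

  -- A vertex outside `C` lies on an edge that is not inside `C`, and flipping that edge kills the
  -- sum. If all vertices lie in `C`, every factor of the character is 1.
  ∑χ : (H : Graph v) → Connected H → 2 ℕ.≤ v → {φ : Vec (Fin n) v} → Distinct φ →
    ∑ (allGraphs n) (λ G → χ H φ (signs (plant C G))) ≡ #G n * Π (𝟙 ∘ lookup C) φ
  ∑χ H conn 2≤v {φ} d with Fin.any? (λ i → lookup C (lookup φ i) Bool.≟ false)
  ... | yes (i , e) = trans
    (∑χ-outside C H d (placed⁺ H φ (proj₂ (neighbour H conn 2≤v i))) (∧-false e))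
    (sym (trans (cong (#G n *_) (Π-𝟙-outside (lookup C) φ i e)) (*-zeroʳ (#G n))))
  ... | no ¬e = trans (∑χ-inside C H d (λ i → subst T (sym (all i)) tt))
    (sym (trans (cong (#G n *_) (Π-𝟙-inside (lookup C) φ all)) (*-identityʳ (#G n))))
    where
    all : ∀ i → lookup C (lookup φ i) ≡ true
    all i = Bool.¬-not (λ e → ¬e (i , e))

-- Vertex weights of pairs of placed graphs

Π-≥ : ∀ {A : Set} {κ} {h : A → ℚ} → 0ℚ ≤ κ → (φ : Vec A v) → (∀ i → κ ≤ h (lookup φ i)) → κ ^ v ≤ Π h φ
Π-≥ 0≤κ [] le = ≤-refl
Π-≥ {v = suc v} 0≤κ (x ∷ φ) le = *-mono-≤ 0≤κ (le zero) (^-nonNeg v 0≤κ) (Π-≥ 0≤κ φ (le ∘ suc))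

Π-≥-extra : ∀ {A : Set} {κ} {h : A → ℚ} → 0ℚ ≤ κ → (φ : Vec A v) → (∀ i → κ ≤ h (lookup φ i)) →
  ∀ i → κ * κ ≤ h (lookup φ i) → κ ^ suc v ≤ Π h φ
Π-≥-extra {suc v} {κ = κ} {h} 0≤κ (x ∷ φ) le zero e = subst (_≤ h x * Π h φ) (*-assoc κ κ (κ ^ v))
  (*-mono-≤ (*-nonNeg 0≤κ 0≤κ) e (^-nonNeg v 0≤κ) (Π-≥ 0≤κ φ (le ∘ suc)))
Π-≥-extra {suc v} 0≤κ (x ∷ φ) le (suc i) e =
  *-mono-≤ 0≤κ (le zero) (^-nonNeg (suc v) 0≤κ) (Π-≥-extra 0≤κ φ (le ∘ suc) i e)

Π-mono : ∀ {A : Set} {f g : A → ℚ} (φ : Vec A v) → (∀ x → 0ℚ ≤ f x) → (∀ i → f (lookup φ i) ≤ g (lookup φ i)) → Π f φ ≤ Π g φ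
Π-mono [] 0≤f le = ≤-refl
Π-mono (x ∷ φ) 0≤f le = *-mono-≤ (0≤f x) (le zero) (Π-nonNeg 0≤f φ) (Π-mono φ 0≤f (le ∘ suc))

private
  ≟-sym : (x y : Fin n) → does (x Fin.≟ y) ≡ does (y Fin.≟ x)
  ≟-sym x y with x Fin.≟ y
  ... | yes refl = sym (dec-true (x Fin.≟ x) refl)
  ... | no  x≢y  = sym (dec-false (y Fin.≟ x) (x≢y ∘ sym))

module Weight {κ : ℚ} (1≤κ : 1ℚ ≤ κ) where

  0≤κ : 0ℚ ≤ κ
  0≤κ = ≤-trans 0≤1 1≤κ

  weight : Bool → ℚ
  weight b = if b then κ else 1ℚ

  0≤weight : ∀ b → 0ℚ ≤ weight b
  0≤weight true  = 0≤κ
  0≤weight false = 0≤1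

  -- By distinctness at most one factor differs from 1.
  Π-weight : {φ : Vec (Fin n) v} → Distinct φ → ∀ y → Π (λ x → weight (does (y Fin.≟ x))) φ ≡ weight (mem φ y)
  Π-weight [] y = refl
  Π-weight {φ = x ∷ φ} (p ∷ d) y with y Fin.≟ x
  ... | no _     = trans (*-identityˡ _) (Π-weight d y)
  ... | yes refl = trans (cong (κ *_) (trans (Π-weight d y) (cong weight (all≢⇒¬mem φ p)))) (*-identityʳ κ)

  -- Both sides run over the pairs of equal entries of φ and ψ.
  Π-mem-swap : {φ ψ : Vec (Fin n) v} → Distinct φ → Distinct ψ →
    Π (weight ∘ mem φ) ψ ≡ Π (weight ∘ mem ψ) φ
  Π-mem-swap {φ = φ} {ψ} dφ dψ =
    trans (Π-cong ψ (λ y → sym (Π-weight dφ y)))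
   (trans (Π-swap (λ y x → weight (does (y Fin.≟ x))) ψ φ)
   (trans (Π-cong φ (λ x → Π-cong ψ (λ y → cong weight (≟-sym y x))))
          (Π-cong φ (Π-weight dψ))))

  -- Pairs sharing a vertex in C satisfy κ ^ suc v ≤ W (see W-≥), while the sum
  -- of W over all pairs factorises; κ = k balances the two.
  W : Subset n → Vec (Fin n) v → Vec (Fin n) v → ℚ
  W C φ ψ = Π (λ y → κ * 𝟙 (mem φ y) + 𝟙 (lookup C y)) ψ * Π (λ x → κ * 𝟙 (lookup C x) + 1ℚ) φ

  0≤W : (C : Subset n) (φ ψ : Vec (Fin n) v) → 0ℚ ≤ W C φ ψ
  0≤W C φ ψ = *-nonNeg (Π-nonNeg (λ y → +-nonNeg (*-nonNeg 0≤κ (0≤𝟙 _)) (0≤𝟙 _)) ψ)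
                       (Π-nonNeg (λ x → +-nonNeg (*-nonNeg 0≤κ (0≤𝟙 _)) 0≤1) φ)

  -- The first product of `W` is at least `κ` to the number of common vertices, and `Π-mem-swap`
  -- moves these factors from `ψ` to `φ`. There every vertex is common or in `C` and so contributes
  -- at least `κ`; the one that is both contributes `κ * κ`, whence the exponent `suc v`.
  W-≥ : (C : Subset n) {φ ψ : Vec (Fin n) v} → Distinct φ → Distinct ψ →
    (∀ i → lookup C (lookup φ i) ≡ false → mem ψ (lookup φ i) ≡ true) →
    (∀ j → lookup C (lookup ψ j) ≡ false → mem φ (lookup ψ j) ≡ true) →
    (∃[ i ] (mem ψ (lookup φ i) ≡ true × lookup C (lookup φ i) ≡ true)) →
    κ ^ suc v ≤ W C φ ψ
  W-≥ {n} {v} C {φ} {ψ} dφ dψ hφ hψ (i , e₁ , e₂) = ≤-trans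
    (≤-trans (Π-≥-extra 0≤κ φ each i extra)
             (≤-reflexive (trans (Π-* (weight ∘ mem ψ) hC φ) (cong (_* Π hC φ) (sym (Π-mem-swap dφ dψ))))))
    (*-monoʳ (Π-nonNeg (λ x → +-nonNeg (*-nonNeg 0≤κ (0≤𝟙 _)) 0≤1) φ)
      (Π-mono ψ (λ y → 0≤weight (mem φ y)) each′))
    where
    hC : Fin n → ℚ
    hC x = κ * 𝟙 (lookup C x) + 1ℚ
    κ≤κ+1 : κ ≤ κ * 1ℚ + 1ℚ
    κ≤κ+1 = subst₂ _≤_ (+-identityʳ κ) (cong (_+ 1ℚ) (sym (*-identityʳ κ))) (+-monoʳ-≤ κ 0≤1)
    each : ∀ i → κ ≤ weight (mem ψ (lookup φ i)) * hC (lookup φ i)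
    each i with lookup C (lookup φ i) | mem ψ (lookup φ i) | hφ i
    ... | true  | true  | _ = ≤-trans κ≤κ+1 (subst (_≤ κ * (κ * 1ℚ + 1ℚ)) (*-identityˡ (κ * 1ℚ + 1ℚ)) (*-monoʳ (≤-trans 0≤κ κ≤κ+1) 1≤κ))
    ... | true  | false | _ = subst (κ ≤_) (sym (*-identityˡ (κ * 1ℚ + 1ℚ))) κ≤κ+1
    ... | false | true  | _ = ≤-reflexive (solve 1 (λ k → k := k :* (k :* con 0ℚ :+ con 1ℚ)) refl κ)
    ... | false | false | h with () ← h refl
    extra : κ * κ ≤ weight (mem ψ (lookup φ i)) * hC (lookup φ i)
    extra rewrite e₁ | e₂ = *-monoˡ 0≤κ κ≤κ+1
    each′ : ∀ j → weight (mem φ (lookup ψ j)) ≤ κ * 𝟙 (mem φ (lookup ψ j)) + 𝟙 (lookup C (lookup ψ j))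
    each′ j with lookup C (lookup ψ j) | mem φ (lookup ψ j) | hψ j
    ... | true  | true  | _ = κ≤κ+1
    ... | true  | false | _ = ≤-reflexive (solve 1 (λ k → con 1ℚ := k :* con 0ℚ :+ con 1ℚ) refl κ)
    ... | false | true  | _ = ≤-reflexive (solve 1 (λ k → k := k :* con 1ℚ :+ con 0ℚ) refl κ)
    ... | false | false | h with () ← h refl

-- Bounding the correlation of a pair

Same : (H K : Graph v) (φ ψ : Vec (Fin n) v) → Set
Same H K φ ψ = ∀ a b → placed H φ a b ≡ placed K ψ a b

same? : (H K : Graph v) (φ ψ : Vec (Fin n) v) → Dec (Same H K φ ψ)
same? H K φ ψ = Fin.all? λ a → Fin.all? λ b → placed H φ a b Bool.≟ placed K ψ a b

¬Same⇒odd : (H K : Graph v) {φ ψ : Vec (Fin n) v} → ¬ Same H K φ ψ → ∃[ a ] ∃[ b ] (placed H φ a b ≢ placed K ψ a b)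
¬Same⇒odd H K {φ} {ψ} ¬s =
  let (a , ¬a) = Fin.¬∀⟶∃¬ _ _ (λ a → Fin.all? λ b → placed H φ a b Bool.≟ placed K ψ a b) ¬s
      (b , ¬b) = Fin.¬∀⟶∃¬ _ _ (λ b → placed H φ a b Bool.≟ placed K ψ a b) ¬a
  in a , b , ¬b

-- A pair with an edge of the symmetric difference outside C has correlation 0,
-- hence the hypothesis.
module _ (C : Subset n) (H K : Graph v) (connH : Connected H) (2≤v : 2 ℕ.≤ v) {φ ψ : Vec (Fin n) v}
         (inside : ∀ a b → placed H φ a b ≢ placed K ψ a b → Inside C a b) where

  -- `K` places edges only between entries of `ψ`, so an edge of `H` with an end elsewhere belongs
  -- to the symmetric difference.
  ¬mem⇒odd : ∀ {x y} → T (adj H x y) → mem ψ (lookup φ y) ≡ false →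
    placed H φ (lookup φ x) (lookup φ y) ≢ placed K ψ (lookup φ x) (lookup φ y)
  ¬mem⇒odd {x} {y} h e eq =
    let (_ , j , _ , _ , q) = placed⁻ K ψ (trans (sym eq) (placed⁺ H φ h))
    in subst T (trans (cong (mem ψ) q) e) (mem-lookup ψ j)

  ¬mem⇒∈C : ∀ y → mem ψ (lookup φ y) ≡ false → lookup C (lookup φ y) ≡ true
  ¬mem⇒∈C y e =
    let (x , h) = neighbour H connH 2≤v y
        odd = ¬mem⇒odd (subst T (adj-sym H y x) h) e
    in Equivalence.to T-≡ (proj₂ (Equivalence.to T-∧ (inside _ _ odd)))

  -- The given edge has an end `x` placed in `C`. If that vertex is not common, a walk in `H` from
  -- the common vertex `i` to `x` leaves the vertex set of `ψ` along some edge. That edge is not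
  -- placed by `K`, hence lies inside `C`, and its first end is common.
  common∈C : ∀ {i} → mem ψ (lookup φ i) ≡ true → ∀ {a b} → placed H φ a b ≡ true → Inside C a b →
    ∃[ i ] (mem ψ (lookup φ i) ≡ true × lookup C (lookup φ i) ≡ true)
  common∈C {i} e {a} {b} pl ins with placed⁻ H φ pl
  ... | x , _ , _ , refl , _ with mem ψ (lookup φ x) in ex
  ...   | true  = x , ex , Equivalence.to T-≡ (proj₁ (Equivalence.to T-∧ ins))
  ...   | false = let (p , q , h , ep , eq) = crossing H (mem ψ ∘ lookup φ) (connH i x) e ex
                  in p , ep , Equivalence.to T-≡ (proj₁ (Equivalence.to T-∧ (inside _ _ (¬mem⇒odd h eq))))

module _ {κ : ℚ} (1≤κ : 1ℚ ≤ κ) (C : Subset n) (H K : Graph v) (connH : Connected H) (connK : Connected K)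
         (2≤v : 2 ℕ.≤ v) {φ ψ : Vec (Fin n) v} (dφ : Distinct φ) (dψ : Distinct ψ) where

  open Weight 1≤κ

  private
    aφ = Π (𝟙 ∘ lookup C) φ
    aψ = Π (𝟙 ∘ lookup C) ψ
    s  = 𝟙 (does (same? H K φ ψ))

    0≤a : (φ : Vec (Fin n) v) → 0ℚ ≤ Π (𝟙 ∘ lookup C) φ
    0≤a = Π-nonNeg (λ x → 0≤𝟙 (lookup C x))

  module _ (u : ℚ) (0≤u : 0ℚ ≤ u) (κu : κ ^ suc v * u ≡ 1ℚ) where

    private
      Wu = W C φ ψ * u
      0≤Wu : 0ℚ ≤ Wu
      0≤Wu = *-nonNeg (0≤W C φ ψ) 0≤u

      sum≥ : ∀ {q} → 1ℚ ≤ q → #G n ≤ #G n * q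
      sum≥ {q} 1≤q = subst (_≤ #G n * q) (*-identityʳ (#G n)) (*-monoˡ (0≤#G n) 1≤q)

      a≤ : ∀ {x y z} → 0ℚ ≤ y → 0ℚ ≤ z → x ≤ x + y + z
      a≤ {x} {y} {z} 0≤y 0≤z = subst (_≤ x + y + z) (trans (cong (_+ 0ℚ) (+-identityʳ x)) (+-identityʳ x))
        (+-mono-≤ (+-monoʳ-≤ x 0≤y) 0≤z)
      b≤ : ∀ {x y z} → 0ℚ ≤ x → 0ℚ ≤ z → y ≤ x + y + z
      b≤ {x} {y} {z} 0≤x 0≤z = subst (_≤ x + y + z) (trans (+-identityʳ (0ℚ + y)) (+-identityˡ y))
        (+-mono-≤ (+-monoˡ-≤ y 0≤x) 0≤z)
      c≤ : ∀ {x y z} → 0ℚ ≤ x → 0ℚ ≤ y → z ≤ x + y + z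
      c≤ {x} {y} {z} 0≤x 0≤y = subst (_≤ x + y + z) (+-identityˡ z)
        (+-monoˡ-≤ z (+-nonNeg 0≤x 0≤y))

    -- Here `u` is `1 / κ ^ (v + 1)`. The three terms account for disjoint pairs inside `C`, for
    -- overlapping pairs with different edges, and for pairs with equal edges.
    ∑χχ-bound : ∑χχ C H K dφ dψ ≤ #G n * (aφ * aψ + Wu + s)
    ∑χχ-bound with Fin.any? (λ a → Fin.any? λ b → ¬? (placed H φ a b Bool.≟ placed K ψ a b) ×-dec ¬? (T? (lookup C a ∧ lookup C b)))
    ... | yes (a , b , odd , out) = ≤-trans (≤-reflexive (∑χχ-odd C H K dφ dψ odd out))
      (*-nonNeg (0≤#G n) (+-nonNeg (+-nonNeg (*-nonNeg (0≤a φ) (0≤a ψ)) 0≤Wu) (0≤𝟙 _)))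
    -- A correlation never exceeds `#G n`, so it suffices that one of the three terms is at least 1.
    ... | no ¬out = ≤-trans (∑χχ≤ C H K dφ dψ) (sum≥ (≥1 (same? H K φ ψ) refl))
      where
      inside : ∀ a b → placed H φ a b ≢ placed K ψ a b → Inside C a b
      inside a b odd with T? (lookup C a ∧ lookup C b)
      ... | yes p = p
      ... | no ¬p = ⊥-elim (¬out (a , b , odd , ¬p))
      inside′ : ∀ a b → placed K ψ a b ≢ placed H φ a b → Inside C a b
      inside′ a b odd = inside a b (odd ∘ sym)
      cover : ∀ {φ ψ : Vec (Fin n) v} → (∀ y → mem ψ (lookup φ y) ≡ false → lookup C (lookup φ y) ≡ true) →
        ∀ i → lookup C (lookup φ i) ≡ false → mem ψ (lookup φ i) ≡ true
      cover {φ} {ψ} h i e with mem ψ (lookup φ i) | h i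
      ... | true  | _ = refl
      ... | false | h′ with () ← trans (sym e) (h′ refl)
      outH = ¬mem⇒∈C C H K connH 2≤v {φ} {ψ} inside
      outK = ¬mem⇒∈C C K H connK 2≤v {ψ} {φ} inside′
      mirror : ∃[ j ] (mem φ (lookup ψ j) ≡ true × lookup C (lookup ψ j) ≡ true) →
        ∃[ i ] (mem ψ (lookup φ i) ≡ true × lookup C (lookup φ i) ≡ true)
      mirror (j , e , c) with mem⇒lookup φ (subst T (sym e) tt)
      ... | i , q = i , trans (cong (mem ψ) q) (Equivalence.to T-≡ (mem-lookup ψ j)) , trans (cong (lookup C) q) c
      ≥1 : (d : Dec (Same H K φ ψ)) → same? H K φ ψ ≡ d → 1ℚ ≤ aφ * aψ + Wu + s
      ≥1 (yes _) e = subst (λ z → 1ℚ ≤ aφ * aψ + Wu + 𝟙 (does z)) (sym e) (c≤ (*-nonNeg (0≤a φ) (0≤a ψ)) 0≤Wu)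
      ≥1 (no ¬s) e with Fin.any? (λ i → mem ψ (lookup φ i) Bool.≟ true)
      -- Each vertex is missed by the other placed graph and therefore lies in `C`, so the first
      -- term equals 1.
      ... | no ¬common = subst (λ z → z ≤ aφ * aψ + Wu + s)
          (cong₂ _*_ (Π-𝟙-inside (lookup C) φ (λ i → outH i (disjoint i))) (Π-𝟙-inside (lookup C) ψ (λ j → outK j (disjoint′ j))))
          (a≤ 0≤Wu (0≤𝟙 _))
        where
        disjoint : ∀ i → mem ψ (lookup φ i) ≡ false
        disjoint i = Bool.¬-not (λ e → ¬common (i , e))
        disjoint′ : ∀ j → mem φ (lookup ψ j) ≡ false
        disjoint′ j = Bool.¬-not (λ e → let (i , q) = mem⇒lookup φ (subst T (sym e) tt)
          in ¬common (i , trans (cong (mem ψ) q) (Equivalence.to T-≡ (mem-lookup ψ j))))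
      ... | yes (i , ei) = ≤-trans (subst (_≤ Wu) κu (*-monoʳ 0≤u (W-≥ C dφ dψ (cover {φ} {ψ} outH) (cover {ψ} {φ} outK) common)))
          (b≤ (*-nonNeg (0≤a φ) (0≤a ψ)) (0≤𝟙 _))
        where
        common : ∃[ i ] (mem ψ (lookup φ i) ≡ true × lookup C (lookup φ i) ≡ true)
        -- An edge of the symmetric difference belongs to `H` or to `K`; in the second case the
        -- argument runs with the roles exchanged, and `mirror` carries the vertex back from `ψ` to
        -- `φ`.
        common = let (a , b , odd) = ¬Same⇒odd H K {φ} {ψ} ¬s in go odd (placed H φ a b) (placed K ψ a b) refl refl
          where
          jq = mem⇒lookup ψ (subst T (sym ei) tt)
          ej : mem φ (lookup ψ (proj₁ jq)) ≡ true
          ej = trans (cong (mem φ) (proj₂ jq)) (Equivalence.to T-≡ (mem-lookup φ i))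
          go : ∀ {a b} → placed H φ a b ≢ placed K ψ a b → ∀ s t → placed H φ a b ≡ s → placed K ψ a b ≡ t →
            ∃[ i ] (mem ψ (lookup φ i) ≡ true × lookup C (lookup φ i) ≡ true)
          go odd true  _     eH eK = common∈C C H K connH 2≤v {φ} {ψ} inside ei eH (inside _ _ odd)
          go odd false true  eH eK = mirror (common∈C C K H connK 2≤v {ψ} {φ} inside′ ej eK (inside _ _ odd))
          go odd false false eH eK = ⊥-elim (odd (trans eH (sym eK)))

  ∑χχ-bound-⊥ : (∀ a b → ¬ Inside C a b) → ∑χχ C H K dφ dψ ≤ #G n * s
  ∑χχ-bound-⊥ empty = go (same? H K φ ψ)
    where
    go : (d : Dec (Same H K φ ψ)) → ∑χχ C H K dφ dψ ≤ #G n * 𝟙 (does d)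
    go (yes _) = subst (∑χχ C H K dφ dψ ≤_) (sym (*-identityʳ (#G n))) (∑χχ≤ C H K dφ dψ)
    go (no ¬s) = let (a , b , odd) = ¬Same⇒odd H K {φ} {ψ} ¬s in
      ≤-trans (≤-reflexive (∑χχ-odd C H K dφ dψ odd (empty a b))) (*-nonNeg (0≤#G n) ≤-refl)

-- Moments of the statistic

injections⇒distinct : {φ : Vec (Fin n) v} → φ ∈ injections v n → Distinct φ
injections⇒distinct {n} {v} φ∈ = proj₂ (∈-filter⁻ distinct? {xs = allVecs (allFin n) v} φ∈)

∑-injections-≤ : (f : Vec (Fin n) v → ℚ) → (∀ φ → 0ℚ ≤ f φ) → ∑ (injections v n) f ≤ ∑ (allVecs (allFin n) v) f
∑-injections-≤ {n} {v} f 0≤f = subst (_≤ ∑ (allVecs (allFin n) v) f) (sym (∑-injections f))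
  (∑-mono (allVecs (allFin n) v) λ φ →
    subst (𝟙 (does (distinct? φ)) * f φ ≤_) (*-identityˡ (f φ)) (*-monoʳ (0≤f φ) (𝟙≤1 (does (distinct? φ)))))

∑-injections-Π-≤ : (g : Fin n → ℚ) → (∀ x → 0ℚ ≤ g x) → ∀ v → ∑ (injections v n) (Π g) ≤ ∑ (allFin n) g ^ v
∑-injections-Π-≤ {n} g 0≤g v = ≤-trans (∑-injections-≤ {v = v} (Π g) (Π-nonNeg 0≤g)) (≤-reflexive (∑-Π (allFin n) g v))

allVecs-unique : {A : Set} {xs : List A} → Unique xs → ∀ n → Unique (allVecs xs n)
allVecs-unique u zero    = [] ∷ []
allVecs-unique u (suc n) = Unique.cartesianProductWith⁺ _∷_ Vec.∷-injective u (allVecs-unique u n)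

allGraphs-unique : ∀ n → Unique (allGraphs n)
allGraphs-unique zero    = [] ∷ []
allGraphs-unique (suc n) = Unique.cartesianProductWith⁺ _∷_ (λ { refl → refl , refl })
  (allVecs-unique (((λ ()) ∷ []) ∷ [] ∷ []) n) (allGraphs-unique n)

∑-𝟙-≤1 : {A : Set} {xs : List A} (b : A → Bool) → Unique xs →
  (∀ {x y} → b x ≡ true → b y ≡ true → x ≡ y) → ∑ xs (𝟙 ∘ b) ≤ 1ℚ
∑-𝟙-≤1 {xs = []} b u h = 0≤1
∑-𝟙-≤1 {xs = x ∷ xs} b (p ∷ u) h with b x in eq
... | false = subst (_≤ 1ℚ) (sym (+-identityˡ (∑ xs (𝟙 ∘ b)))) (∑-𝟙-≤1 b u h)
... | true  = ≤-reflexive (trans (cong (1ℚ +_) (trans (∑-cong-∈ xs others) (∑-0 xs))) (+-identityʳ 1ℚ))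
  where
  others : ∀ {y} → y ∈ xs → 𝟙 (b y) ≡ 0ℚ
  others {y} y∈ = cong 𝟙 (Bool.¬-not (λ e → ListAll.lookup p y∈ (h eq e)))

placed-adj : (K : Graph v) {ψ : Vec (Fin n) v} → Distinct ψ → ∀ x y → placed K ψ (lookup ψ x) (lookup ψ y) ≡ adj K x y
placed-adj K {ψ} d x y with adj K x y in eq
... | true  = placed⁺ K ψ (subst T (sym eq) tt)
... | false = dec-false (placed? K ψ _ _) λ (x′ , y′ , h , p , q) →
  subst T eq (subst₂ (λ i j → T (adj K i j)) (distinct-lookup d p) (distinct-lookup d q) h)

-- An injection `ψ` together with the set of placed edges determines the graph.
Same⇒≡ : (H : Graph v) {K K′ : Graph v} {φ ψ : Vec (Fin n) v} → Distinct ψ →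
  Same H K φ ψ → Same H K′ φ ψ → K ≡ K′
Same⇒≡ H {K} {K′} {φ} {ψ} d s s′ = adj-injective λ x y →
  trans (sym (placed-adj K d x y)) (trans (trans (sym (s _ _)) (s′ _ _)) (placed-adj K′ d x y))

Same⇒mem : (H K : Graph v) → Connected K → 2 ℕ.≤ v → {φ ψ : Vec (Fin n) v} → Same H K φ ψ → ∀ j → mem φ (lookup ψ j) ≡ true
Same⇒mem H K conn 2≤v {φ} {ψ} s j =
  let (y , h) = neighbour K conn 2≤v j
      (i , _ , _ , p , _) = placed⁻ H φ (trans (s _ _) (placed⁺ K ψ h))
  in trans (cong (mem φ) (sym p)) (Equivalence.to T-≡ (mem-lookup φ i))

plant-⊥ : (G : Graph n) → plant ⊥ G ≡ G
plant-⊥ []      = refl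
plant-⊥ (r ∷ G) = cong₂ _∷_ (row r) (plant-⊥ G)
  where
  row : ∀ {n} (r : Vec Bool n) → zipWith (λ d e → e ∨ (false ∧ d)) ⊥ r ≡ r
  row []          = refl
  row (true ∷ r)  = cong (true ∷_) (row r)
  row (false ∷ r) = cong (false ∷_) (row r)

∑-*∑ : {A : Set} (xs ys : List A) (f g : A → ℚ) → ∑ xs f * ∑ ys g ≡ ∑ xs (λ x → ∑ ys (λ y → f x * g y))
∑-*∑ xs ys f g = trans (sym (∑-*ʳ xs (∑ ys g) f)) (∑-cong xs (λ x → sym (∑-*ˡ ys (f x) g)))

∑∑-mono-∈ : {A : Set} (xs : List A) (f g : A → A → ℚ) →
  (∀ {x y} → x ∈ xs → y ∈ xs → f x y ≤ g x y) → ∑ xs (λ x → ∑ xs (f x)) ≤ ∑ xs (λ x → ∑ xs (g x))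
∑∑-mono-∈ xs f g h = ∑-mono-∈ xs {λ x → ∑ xs (f x)} {λ x → ∑ xs (g x)}
  (λ {x} x∈ → ∑-mono-∈ xs {f x} {g x} (λ y∈ → h x∈ y∈))

module Moments (ℋ : GraphSet v) (conn : ∀ H → T (ℋ H) → Connected H) (2≤v : 2 ℕ.≤ v) (n : ℕ) where

  E = elements ℋ
  I = injections v n
  Z = cartesianProduct E I

  #E : ℚ
  #E = ⟦ length E ⟧

  F : Graph n → ℚ
  F G = F[ ℋ ] (signs G)

  E-conn : ∀ {H} → H ∈ E → Connected H
  E-conn {H} H∈ = conn H (proj₂ (∈-filter⁻ (T? ∘ ℋ) {xs = allGraphs v} H∈))

  E-unique : Unique E
  E-unique = Unique.filter⁺ (T? ∘ ℋ) (allGraphs-unique v)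

  ∈Z : ∀ {z} → z ∈ Z → Connected (proj₁ z) × Distinct (proj₂ z)
  ∈Z z∈ = let (H∈ , φ∈) = ∈-cartesianProduct⁻ E I z∈ in E-conn H∈ , injections⇒distinct φ∈

  char : Graph n → Graph v × Vec (Fin n) v → ℚ
  char G (H , φ) = χ H φ (signs G)

  F-Z : ∀ G → F G ≡ ∑ Z (char G)
  F-Z G = sym (∑-cartesianProductWith _,_ E I (char G))

  ∑Z : (f : Graph v × Vec (Fin n) v → ℚ) → ∑ Z f ≡ ∑ E (λ H → ∑ I (λ φ → f (H , φ)))
  ∑Z = ∑-cartesianProductWith _,_ E I

  ∑Z-const : (f : Vec (Fin n) v → ℚ) → ∑ Z (f ∘ proj₂) ≡ #E * ∑ I f
  ∑Z-const f = trans (∑Z (f ∘ proj₂)) (∑-const E (∑ I f))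

  same : (z z′ : Graph v × Vec (Fin n) v) → ℚ
  same (H , φ) (K , ψ) = 𝟙 (does (same? H K φ ψ))

  -- For a fixed `ψ` at most one `K` places the same edges, and none does unless all entries of `ψ`
  -- occur in `φ`, because every vertex of `K` lies on an edge.
  ∑-same-K : ∀ H {φ ψ : Vec (Fin n) v} → Distinct ψ → ∑ E (λ K → same (H , φ) (K , ψ)) ≤ Π (𝟙 ∘ mem φ) ψ
  ∑-same-K H {φ} {ψ} d with Fin.any? (λ j → mem φ (lookup ψ j) Bool.≟ false)
  ... | yes (j , e) = ≤-reflexive (trans (trans (∑-cong-∈ E none) (∑-0 E)) (sym (Π-𝟙-outside (mem φ) ψ j e)))
    where
    none : ∀ {K} → K ∈ E → same (H , φ) (K , ψ) ≡ 0ℚ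
    none {K} K∈ = cong 𝟙 (dec-false (same? H K φ ψ) λ s →
      subst T (trans (sym (Same⇒mem H K (E-conn K∈) 2≤v {φ} {ψ} s j)) e) tt)
  ... | no ¬e = subst (∑ E (λ K → same (H , φ) (K , ψ)) ≤_)
      (sym (Π-𝟙-inside (mem φ) ψ (λ j → Bool.¬-not (λ e → ¬e (j , e)))))
      (∑-𝟙-≤1 (λ K → does (same? H K φ ψ)) E-unique (λ {K} {K′} p q → Same⇒≡ H {φ = φ} d (unyes (same? H K φ ψ) p) (unyes (same? H K′ φ ψ) q)))
    where
    unyes : ∀ {P : Set} (d : Dec P) → does d ≡ true → P
    unyes (yes p) _ = p

  -- `ψ` has to rearrange the `v` entries of `φ`, and `K` is then determined.
  ∑-same : ∀ {z} → Distinct (proj₂ z) → ∑ Z (same z) ≤ ⟦ v ! ⟧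
  ∑-same {H , φ} d = ≤-trans (≤-reflexive (trans (∑Z (same (H , φ))) (∑-swap E I (λ K ψ → same (H , φ) (K , ψ)))))
   (≤-trans (∑-mono-∈ I (λ {ψ} ψ∈ → ∑-same-K H {φ} (injections⇒distinct ψ∈)))
     (≤-reflexive (trans (∑-injections-Π (mem φ) v) (trans (cong (λ s → falling s v) (∑-mem d)) (falling-! v)))))

  ∑I-1 : ∑ I (λ _ → 1ℚ) ≤ ⟦ n ⟧ ^ v
  ∑I-1 = ≤-trans (≤-reflexive (∑-cong I (λ φ → sym (Π-1 φ))))
    (≤-trans (∑-injections-Π-≤ (λ _ → 1ℚ) (λ _ → 0≤1) v)
             (≤-reflexive (cong (_^ v) (trans (∑-allFin-const n 1ℚ) (*-identityʳ ⟦ n ⟧)))))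

  ∑∑-same : ∑ Z (λ z → ∑ Z (same z)) ≤ #E * (⟦ n ⟧ ^ v * ⟦ v ! ⟧)
  ∑∑-same = ≤-trans (∑-mono-∈ Z {λ z → ∑ Z (same z)} {λ _ → ⟦ v ! ⟧} (λ {z} z∈ → ∑-same {z} (proj₂ (∈Z z∈))))
    (≤-trans (≤-reflexive (trans (∑-cong Z (λ _ → sym (*-identityˡ ⟦ v ! ⟧)))
       (trans (∑-*ʳ Z ⟦ v ! ⟧ (λ _ → 1ℚ)) (cong (_* ⟦ v ! ⟧) (∑Z-const (λ _ → 1ℚ))))))
     (≤-trans (≤-reflexive (*-assoc #E _ ⟦ v ! ⟧))
       (*-monoˡ 0≤⟦ length E ⟧ (*-monoʳ 0≤⟦ v ! ⟧ ∑I-1))))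

  module _ (C : Subset n) where

    -- Depends on `C` only through its size, so all sets of size `k` share one mean and the mixture
    -- over `C` needs no between-group variance.
    mean : ℚ
    mean = #E * falling ⟦ ∣ C ∣ ⟧ v

    ∑Z-inside : ∑ Z (Π (𝟙 ∘ lookup C) ∘ proj₂) ≡ mean
    ∑Z-inside = trans (∑Z-const (Π (𝟙 ∘ lookup C)))
      (cong (#E *_) (trans (∑-injections-Π (lookup C) v) (cong (λ s → falling s v) (∑-subset C))))

    first-moment : ∑ (allGraphs n) (λ G → F (plant C G)) ≡ #G n * mean
    first-moment =
      trans (∑-cong (allGraphs n) (λ G → F-Z (plant C G)))
     (trans (∑-swap (allGraphs n) Z (λ G → char (plant C G)))
     (trans (∑-cong-∈ Z (λ {z} z∈ → ∑χ C (proj₁ z) (proj₁ (∈Z z∈)) 2≤v (proj₂ (∈Z z∈))))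
     (trans (∑-*ˡ Z (#G n) (Π (𝟙 ∘ lookup C) ∘ proj₂)) (cong (#G n *_) ∑Z-inside))))

    ∑χχ′ : (z z′ : Graph v × Vec (Fin n) v) → ℚ
    ∑χχ′ z z′ = ∑ (allGraphs n) (λ G → char (plant C G) z * char (plant C G) z′)

    square : ∑ (allGraphs n) (λ G → F (plant C G) * F (plant C G)) ≡ ∑ Z (λ z → ∑ Z (∑χχ′ z))
    square =
      trans (∑-cong (allGraphs n) (λ G → trans (cong₂ _*_ (F-Z (plant C G)) (F-Z (plant C G)))
                (∑-*∑ Z Z (char (plant C G)) (char (plant C G)))))
     (trans (∑-swap (allGraphs n) Z (λ G z → ∑ Z (λ z′ → char (plant C G) z * char (plant C G) z′)))
            (∑-cong Z (λ z → ∑-swap (allGraphs n) Z (λ G z′ → char (plant C G) z * char (plant C G) z′))))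

    module _ {κ : ℚ} (1≤κ : 1ℚ ≤ κ) (u : ℚ) (0≤u : 0ℚ ≤ u) (κu : κ ^ suc v * u ≡ 1ℚ) where

      open Weight 1≤κ

      P : ℚ
      P = (κ * ⟦ v ⟧ + ⟦ ∣ C ∣ ⟧) ^ v * (κ * ⟦ ∣ C ∣ ⟧ + ⟦ n ⟧) ^ v

      -- Dropping the injectivity of the summation vector makes each sum a power of a sum over
      -- single vertices. For the sum over `ψ` that base is `κ v + ∣ C ∣` whatever `φ` is, because
      -- `φ` has exactly `v` different entries; so the two sums separate.
      ∑W : ∑ I (λ φ → ∑ I (λ ψ → W C φ ψ)) ≤ P
      ∑W = ≤-trans (∑-mono-∈ I inner)
        (≤-trans (≤-reflexive (∑-*ˡ I κvk (Π h)))
          (*-monoˡ (^-nonNeg v (+-nonNeg (*-nonNeg 0≤κ 0≤⟦ v ⟧) 0≤⟦ ∣ C ∣ ⟧))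
            (≤-trans (∑-injections-Π-≤ h (λ x → +-nonNeg (*-nonNeg 0≤κ (0≤𝟙 _)) 0≤1) v)
              (≤-reflexive (cong (_^ v) (trans (∑-+ (allFin n) (λ x → κ * 𝟙 (lookup C x)) (λ _ → 1ℚ))
                (cong₂ _+_ (trans (∑-*ˡ (allFin n) κ (𝟙 ∘ lookup C)) (cong (κ *_) (∑-subset C)))
                           (trans (∑-allFin-const n 1ℚ) (*-identityʳ ⟦ n ⟧)))))))))
        where
        κvk = (κ * ⟦ v ⟧ + ⟦ ∣ C ∣ ⟧) ^ v
        h : Fin n → ℚ
        h x = κ * 𝟙 (lookup C x) + 1ℚ
        inner : ∀ {φ} → φ ∈ I → ∑ I (λ ψ → W C φ ψ) ≤ κvk * Π h φ
        inner {φ} φ∈ = ≤-trans (≤-reflexive (∑-*ʳ I (Π h φ) (Π g)))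
          (*-monoʳ (Π-nonNeg (λ x → +-nonNeg (*-nonNeg 0≤κ (0≤𝟙 _)) 0≤1) φ)
            (≤-trans (∑-injections-Π-≤ g (λ y → +-nonNeg (*-nonNeg 0≤κ (0≤𝟙 _)) (0≤𝟙 _)) v)
              (≤-reflexive (cong (_^ v) (trans (∑-+ (allFin n) (λ y → κ * 𝟙 (mem φ y)) (𝟙 ∘ lookup C))
                (cong₂ _+_ (trans (∑-*ˡ (allFin n) κ (𝟙 ∘ mem φ)) (cong (κ *_) (∑-mem (injections⇒distinct φ∈))))
                           (∑-subset C)))))))
          where
          g : Fin n → ℚ
          g y = κ * 𝟙 (mem φ y) + 𝟙 (lookup C y)

      ∑∑W : ∑ Z (λ z → ∑ Z (λ z′ → W C (proj₂ z) (proj₂ z′))) ≤ #E * #E * P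
      ∑∑W = ≤-trans (≤-reflexive
          (trans (∑-cong Z (λ z → ∑Z-const (W C (proj₂ z))))
          (trans (∑Z-const (λ φ → #E * ∑ I (W C φ)))
          (trans (cong (#E *_) (∑-*ˡ I #E (λ φ → ∑ I (W C φ))))
                 (sym (*-assoc #E #E _))))))
        (*-monoˡ (*-nonNeg 0≤⟦ length E ⟧ 0≤⟦ length E ⟧) ∑W)

      second-moment : ∑ (allGraphs n) (λ G → F (plant C G) * F (plant C G)) ≤
        #G n * (mean * mean + #E * #E * P * u + #E * (⟦ n ⟧ ^ v * ⟦ v ! ⟧))
      second-moment = ≤-trans (≤-reflexive square)
        (≤-trans (∑∑-mono-∈ Z ∑χχ′ (λ z z′ → #G n * (a z * a z′ + w z z′ * u + same z z′)) bound)
        (≤-trans (≤-reflexive expand)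
          (*-monoˡ (0≤#G n) (+-mono-≤ (+-monoʳ-≤ (mean * mean) (*-monoʳ 0≤u ∑∑W)) ∑∑-same))))
        where
        a : Graph v × Vec (Fin n) v → ℚ
        a z = Π (𝟙 ∘ lookup C) (proj₂ z)
        w : (z z′ : Graph v × Vec (Fin n) v) → ℚ
        w z z′ = W C (proj₂ z) (proj₂ z′)
        bound : ∀ {z z′} → z ∈ Z → z′ ∈ Z → ∑χχ′ z z′ ≤ #G n * (a z * a z′ + w z z′ * u + same z z′)
        bound {H , φ} {K , ψ} z∈ z′∈ =
          ∑χχ-bound 1≤κ C H K (proj₁ (∈Z z∈)) (proj₁ (∈Z z′∈)) 2≤v (proj₂ (∈Z z∈)) (proj₂ (∈Z z′∈)) u 0≤u κu
        expand : ∑ Z (λ z → ∑ Z (λ z′ → #G n * (a z * a z′ + w z z′ * u + same z z′))) ≡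
          #G n * (mean * mean + ∑ Z (λ z → ∑ Z (w z)) * u + ∑ Z (λ z → ∑ Z (same z)))
        expand =
          trans (∑-cong Z (λ z → ∑-*ˡ Z (#G n) (λ z′ → a z * a z′ + w z z′ * u + same z z′)))
         (trans (∑-*ˡ Z (#G n) (λ z → ∑ Z (λ z′ → a z * a z′ + w z z′ * u + same z z′)))
                (cong (#G n *_)
                  (trans (∑-cong Z (λ z → trans (∑-+ Z (λ z′ → a z * a z′ + w z z′ * u) (same z))
                     (cong (_+ ∑ Z (same z)) (trans (∑-+ Z (λ z′ → a z * a z′) (λ z′ → w z z′ * u))
                        (cong (∑ Z (λ z′ → a z * a z′) +_) (∑-*ʳ Z u (w z)))))))
                  (trans (∑-+ Z (λ z → ∑ Z (λ z′ → a z * a z′) + ∑ Z (w z) * u) (λ z → ∑ Z (same z)))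
                    (cong (_+ ∑ Z (λ z → ∑ Z (same z)))
                      (trans (∑-+ Z (λ z → ∑ Z (λ z′ → a z * a z′)) (λ z → ∑ Z (w z) * u))
                        (cong₂ _+_ (trans (sym (∑-*∑ Z Z a a)) (cong₂ _*_ ∑Z-inside ∑Z-inside))
                                   (∑-*ʳ Z u (λ z → ∑ Z (w z))))))))))

  private
    ¬Inside-⊥ : ∀ (a b : Fin n) → ¬ Inside ⊥ a b
    ¬Inside-⊥ a b = ∧-false (Vec.lookup-replicate a false)

  -- Planting in the empty set changes nothing, and no pair is inside it; only pairs with equal
  -- edges remain.
  second-moment-⊥ : ∑ (allGraphs n) (λ G → F G * F G) ≤ #G n * (#E * (⟦ n ⟧ ^ v * ⟦ v ! ⟧))
  second-moment-⊥ = ≤-trans (≤-reflexive (trans (∑-cong (allGraphs n) (λ G → cong (λ G → F G * F G) (sym (plant-⊥ G)))) (square ⊥)))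
    (≤-trans (∑∑-mono-∈ Z (∑χχ′ ⊥) (λ z z′ → #G n * same z z′) bound)
    (≤-trans (≤-reflexive (trans (∑-cong Z (λ z → ∑-*ˡ Z (#G n) (same z))) (∑-*ˡ Z (#G n) (λ z → ∑ Z (same z)))))
      (*-monoˡ (0≤#G n) ∑∑-same)))
    where
    bound : ∀ {z z′} → z ∈ Z → z′ ∈ Z → ∑χχ′ ⊥ z z′ ≤ #G n * same z z′
    bound {H , φ} {K , ψ} z∈ z′∈ =
      ∑χχ-bound-⊥ {κ = 1ℚ} ≤-refl ⊥ H K (proj₁ (∈Z z∈)) (proj₁ (∈Z z′∈)) 2≤v (proj₂ (∈Z z∈)) (proj₂ (∈Z z′∈)) ¬Inside-⊥

  first-moment-⊥ : ∑ (allGraphs n) F ≡ 0ℚ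
  first-moment-⊥ = trans (∑-cong (allGraphs n) (λ G → cong F (sym (plant-⊥ G))))
    (trans (first-moment ⊥)
      (trans (cong (λ s → #G n * (#E * falling s v)) (trans (cong ⟦_⟧ (∣⊥∣≡0 n)) ⟦0⟧))
        (trans (cong (λ f → #G n * (#E * f)) (falling-0 2≤v))
               (trans (cong (#G n *_) (*-zeroʳ #E)) (*-zeroʳ (#G n))))))
    where
    falling-0 : ∀ {v} → 2 ℕ.≤ v → falling 0ℚ v ≡ 0ℚ
    falling-0 {suc zero} (ℕ.s≤s ())
    falling-0 {suc (suc zero)} _ = trans (cong (λ z → 1ℚ * (0ℚ - z) * (0ℚ - ⟦ 1 ⟧)) ⟦0⟧)
      (solve 1 (λ x → con 1ℚ :* (con 0ℚ :- con 0ℚ) :* x := con 0ℚ) refl (0ℚ - ⟦ 1 ⟧))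
    falling-0 {suc (suc (suc v))} _ = trans (cong (_* (0ℚ - ⟦ suc (suc v) ⟧)) (falling-0 {suc (suc v)} (ℕ.s≤s (ℕ.s≤s ℕ.z≤n))))
      (*-zeroˡ (0ℚ - ⟦ suc (suc v) ⟧))

-- Mean and variance of a uniform law

module _ {A : Set} (μ : Law A) (0<μ : 0ℚ < ∑ μ (λ _ → 1ℚ)) where

  private
    L = ∑ μ (λ _ → 1ℚ)

  ∑≡𝔼 : ∀ (μ : Law A) f → ∑ μ f ≡ ∑ μ (λ _ → 1ℚ) * 𝔼 μ f
  ∑≡𝔼 [] f = refl
  ∑≡𝔼 (x ∷ xs) f = sym (trans (cong (_* 𝔼 (x ∷ xs) f) (trans (∑-const (x ∷ xs) 1ℚ) (*-identityʳ ⟦ l ⟧)))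
    (trans (solve 3 (λ a b c → a :* (b :* c) := b :* (c :* a)) refl ⟦ l ⟧ (∑ (x ∷ xs) f) (ℤ.+ 1 / l))
      (trans (cong (∑ (x ∷ xs) f *_) (trans (/-*-cancel 1 l) ⟦1⟧)) (*-identityʳ _))))
    where
    l = suc (length xs)

  𝔼-≡ : ∀ {f m} → ∑ μ f ≡ L * m → 𝔼 μ f ≡ m
  𝔼-≡ {f} h = ≤-antisym (*-cancelˡ-≤ 0<μ (≤-reflexive eq)) (*-cancelˡ-≤ 0<μ (≤-reflexive (sym eq)))
    where
    eq = trans (sym (∑≡𝔼 μ f)) h

  𝔼-≤ : ∀ {f m} → ∑ μ f ≤ L * m → 𝔼 μ f ≤ m
  𝔼-≤ {f} h = *-cancelˡ-≤ 0<μ (≤-trans (≤-reflexive (sym (∑≡𝔼 μ f))) h)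

  -- Second moment minus squared mean: `X` is the excess of the second moment over `m * m`.
  Var-≤ : ∀ {f m X} → ∑ μ f ≡ L * m → ∑ μ (λ x → f x * f x) ≤ L * (m * m + X) → Var μ f ≤ X
  Var-≤ {f} {m} {X} h₁ h₂ = subst (λ e → 𝔼 μ (λ x → (f x - e) * (f x - e)) ≤ X) (sym (𝔼-≡ h₁)) (𝔼-≤ centred)
    where
    centred : ∑ μ (λ x → (f x - m) * (f x - m)) ≤ L * X
    centred = ≤-trans (≤-reflexive
      (trans (∑-cong μ (λ x → solve 2 (λ f m → (f :- m) :* (f :- m) := f :* f :+ (con (- (1ℚ + 1ℚ)) :* m :* f :+ m :* m :* con 1ℚ)) refl (f x) m))
      (trans (∑-+ μ (λ x → f x * f x) (λ x → - (1ℚ + 1ℚ) * m * f x + m * m * 1ℚ))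
        (cong (∑ μ (λ x → f x * f x) +_)
          (trans (∑-+ μ (λ x → - (1ℚ + 1ℚ) * m * f x) (λ _ → m * m * 1ℚ))
            (cong₂ _+_ (trans (∑-*ˡ μ (- (1ℚ + 1ℚ) * m) f) (cong (- (1ℚ + 1ℚ) * m *_) h₁)) (∑-*ˡ μ (m * m) (λ _ → 1ℚ))))))))
      (≤-trans (+-monoˡ-≤ _ h₂) (≤-reflexive
        (solve 3 (λ L m X → L :* (m :* m :+ X) :+ (con (- (1ℚ + 1ℚ)) :* m :* (L :* m) :+ m :* m :* L) := L :* X) refl L m X)))

0<∑1 : {A : Set} {xs : List A} {x : A} → x ∈ xs → 0ℚ < ∑ xs (λ _ → 1ℚ)
0<∑1 {xs = _ ∷ xs} _ = <-≤-trans (positive⁻¹ 1ℚ)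
  (subst (_≤ 1ℚ + ∑ xs (λ _ → 1ℚ)) (+-identityʳ 1ℚ) (+-monoʳ-≤ 1ℚ (∑-nonNeg xs (λ _ → 0≤1))))

∈-allVecs : {A : Set} {xs : List A} → (∀ x → x ∈ xs) → ∀ {n} (r : Vec A n) → r ∈ allVecs xs n
∈-allVecs h []      = here refl
∈-allVecs h (x ∷ r) = ∈-cartesianProductWith⁺ _∷_ (h x) (∈-allVecs h r)

∈-bools : ∀ b → b ∈ bools
∈-bools true  = here refl
∈-bools false = there (here refl)

∈-allGraphs : (G : Graph n) → G ∈ allGraphs n
∈-allGraphs []      = here refl
∈-allGraphs (r ∷ G) = ∈-cartesianProductWith⁺ _∷_ (∈-allVecs ∈-bools r) (∈-allGraphs G)

empty : ∀ n → Graph n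
empty zero    = []
empty (suc n) = ⊥ ∷ empty n

subset : ∀ {k n} → k ℕ.≤ n → ∃[ C ] (∣_∣ {n} C ≡ k)
subset {n = zero}  ℕ.z≤n       = [] , refl
subset {n = suc n} ℕ.z≤n       = let (C , e) = subset {n = n} ℕ.z≤n in false ∷ C , e
subset             (ℕ.s≤s k≤n) = let (C , e) = subset k≤n in true ∷ C , cong suc e

0<#G : ∀ n → 0ℚ < #G n
0<#G n = 0<∑1 (∈-allGraphs (empty n))

-- The statistic under the null and the planted law

module Variances (ℋ : GraphSet v) (conn : ∀ H → T (ℋ H) → Connected H) (2≤v : 2 ℕ.≤ v) (n : ℕ) where

  open Moments ℋ conn 2≤v n

  𝔼𝒬 : 𝔼 (𝒬 n) F ≡ 0ℚ
  𝔼𝒬 = 𝔼-≡ (𝒬 n) (0<#G n) (trans first-moment-⊥ (sym (*-zeroʳ (#G n))))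

  Var𝒬 : Var (𝒬 n) F ≤ #E * (⟦ n ⟧ ^ v * ⟦ v ! ⟧)
  Var𝒬 = Var-≤ (𝒬 n) (0<#G n) {f = F} {m = 0ℚ} (trans first-moment-⊥ (sym (*-zeroʳ (#G n))))
    (≤-trans second-moment-⊥ (≤-reflexive (cong (#G n *_) (sym (+-identityˡ _)))))

  module _ {k : ℕ} (k≤n : k ℕ.≤ n) where

    private
      S = subsetsOfSize n k
      #S = ∑ S (λ _ → 1ℚ)

      ∈S : ∀ {C} → C ∈ S → ∣ C ∣ ≡ k
      ∈S C∈ = proj₂ (∈-filter⁻ (λ C → ∣ C ∣ ℕ.≟ k) {xs = allVecs bools n} C∈)

      ∑𝒫 : ∀ f → ∑ (𝒫 n k) f ≡ ∑ S (λ C → ∑ (allGraphs n) (λ G → f (plant C G)))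
      ∑𝒫 = ∑-cartesianProductWith plant S (allGraphs n)

      average : ∀ q → ∑ S (λ _ → q) ≡ #S * q
      average q = trans (∑-cong S (λ _ → sym (*-identityˡ q))) (∑-*ʳ S q (λ _ → 1ℚ))

      ∑𝒫-1 : ∑ (𝒫 n k) (λ _ → 1ℚ) ≡ #S * #G n
      ∑𝒫-1 = trans (∑𝒫 (λ _ → 1ℚ)) (average (#G n))

      0<𝒫 : 0ℚ < ∑ (𝒫 n k) (λ _ → 1ℚ)
      0<𝒫 = subst (0ℚ <_) (sym ∑𝒫-1) (*-pos 0<#S (0<#G n))
        where
        0<#S : 0ℚ < #S
        0<#S = let (C , e) = subset k≤n in
          0<∑1 (∈-filter⁺ (λ C → ∣ C ∣ ℕ.≟ k) (∈-allVecs ∈-bools C) e)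

      ∑𝒫-≤ : ∀ {f q} → (∀ C → ∣ C ∣ ≡ k → ∑ (allGraphs n) (λ G → f (plant C G)) ≤ #G n * q) →
        ∑ (𝒫 n k) f ≤ ∑ (𝒫 n k) (λ _ → 1ℚ) * q
      ∑𝒫-≤ {f} {q} h = ≤-trans (≤-reflexive (∑𝒫 f))
        (≤-trans (∑-mono-∈ S (λ {C} C∈ → h C (∈S C∈)))
          (≤-reflexive (trans (average (#G n * q)) (trans (sym (*-assoc #S (#G n) q)) (cong (_* q) (sym ∑𝒫-1))))))

      ∑𝒫-≡ : ∀ {f q} → (∀ C → ∣ C ∣ ≡ k → ∑ (allGraphs n) (λ G → f (plant C G)) ≡ #G n * q) →
        ∑ (𝒫 n k) f ≡ ∑ (𝒫 n k) (λ _ → 1ℚ) * q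
      ∑𝒫-≡ {f} {q} h = trans (∑𝒫 f)
        (trans (∑-cong-∈ S (λ {C} C∈ → h C (∈S C∈)))
          (trans (average (#G n * q)) (trans (sym (*-assoc #S (#G n) q)) (cong (_* q) (sym ∑𝒫-1)))))

      ∑𝒫-F : ∑ (𝒫 n k) F ≡ ∑ (𝒫 n k) (λ _ → 1ℚ) * (#E * falling ⟦ k ⟧ v)
      ∑𝒫-F = ∑𝒫-≡ {f = F} λ C e → subst (λ k → ∑ (allGraphs n) (λ G → F (plant C G)) ≡ #G n * (#E * falling ⟦ k ⟧ v)) e (first-moment C)

    𝔼𝒫 : 𝔼 (𝒫 n k) F ≡ #E * falling ⟦ k ⟧ v
    𝔼𝒫 = 𝔼-≡ (𝒫 n k) 0<𝒫 ∑𝒫-F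

    module _ (1≤k : 1ℚ ≤ ⟦ k ⟧) {u : ℚ} (0≤u : 0ℚ ≤ u) (ku : ⟦ k ⟧ ^ suc v * u ≡ 1ℚ) where

      Var𝒫 : Var (𝒫 n k) F ≤ #E * #E * ((⟦ k ⟧ * ⟦ v ⟧ + ⟦ k ⟧) ^ v * (⟦ k ⟧ * ⟦ k ⟧ + ⟦ n ⟧) ^ v) * u
        + #E * (⟦ n ⟧ ^ v * ⟦ v ! ⟧)
      Var𝒫 = Var-≤ (𝒫 n k) 0<𝒫 {f = F} ∑𝒫-F (∑𝒫-≤ {f = λ G → F G * F G} step)
        where
        -- Only the size of `C` is abstracted as `l`; the weight `κ` is already fixed at `k`.
        X : ℕ → ℚ
        X l = #E * #E * ((⟦ k ⟧ * ⟦ v ⟧ + ⟦ l ⟧) ^ v * (⟦ k ⟧ * ⟦ l ⟧ + ⟦ n ⟧) ^ v) * u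
        m : ℕ → ℚ
        m l = #E * falling ⟦ l ⟧ v
        step : ∀ C → ∣ C ∣ ≡ k → ∑ (allGraphs n) (λ G → F (plant C G) * F (plant C G)) ≤
          #G n * (m k * m k + (X k + #E * (⟦ n ⟧ ^ v * ⟦ v ! ⟧)))
        step C e = ≤-trans (second-moment C 1≤k u 0≤u ku)
          (≤-reflexive (cong (#G n *_) (trans
            (cong (λ l → m l * m l + X l + #E * (⟦ n ⟧ ^ v * ⟦ v ! ⟧)) e)
            (+-assoc (m k * m k) (X k) (#E * (⟦ n ⟧ ^ v * ⟦ v ! ⟧))))))

-- The signal-to-noise inequality

2ℚ : ℚ
2ℚ = 1ℚ + 1ℚ

-- Three error terms, each at most `E² κ ^ (2 v)`, times the factor 4 lost when `κ ^ v` is replaced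
-- by `2 * falling κ v` in a square.
12ℚ : ℚ
12ℚ = (1ℚ + 1ℚ + 1ℚ) * (2ℚ * 2ℚ)

p≤q⇒0≤q-p : ∀ {p q} → p ≤ q → 0ℚ ≤ q - p
p≤q⇒0≤q-p {p} {q} h = subst (_≤ q - p) (+-inverseʳ p) (+-monoˡ-≤ (- p) h)

bernoulli⁻ : ∀ x n → 0ℚ ≤ x → x ≤ 1ℚ → 1ℚ - ⟦ n ⟧ * x ≤ (1ℚ - x) ^ n
bernoulli⁻ x zero 0≤x x≤1 = ≤-reflexive (trans (cong (λ z → 1ℚ - z * x) ⟦0⟧) (cong (λ z → 1ℚ - z) (*-zeroˡ x)))
bernoulli⁻ x (suc n) 0≤x x≤1 = ≤-trans
  (subst (1ℚ - ⟦ suc n ⟧ * x ≤_)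
    (trans (cong (λ z → 1ℚ - z * x + ⟦ n ⟧ * (x * x)) (⟦⟧-suc n))
      (solve 2 (λ n x → con 1ℚ :- (con 1ℚ :+ n) :* x :+ n :* (x :* x) := (con 1ℚ :- x) :* (con 1ℚ :- n :* x)) refl ⟦ n ⟧ x))
    (subst (_≤ 1ℚ - ⟦ suc n ⟧ * x + ⟦ n ⟧ * (x * x)) (+-identityʳ _)
      (+-monoʳ-≤ (1ℚ - ⟦ suc n ⟧ * x) (*-nonNeg 0≤⟦ n ⟧ (*-nonNeg 0≤x 0≤x)))))
  (*-monoˡ (p≤q⇒0≤q-p x≤1) (bernoulli⁻ x n 0≤x x≤1))

module _ {κ w : ℚ} (0≤w : 0ℚ ≤ w) (κw : κ * w ≡ 1ℚ) where

  ^-inverse : ∀ n → κ ^ n * w ^ n ≡ 1ℚ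
  ^-inverse n = trans (sym (^-distrib-* κ w n)) (trans (cong (_^ n) κw) (1^n n))

  -- `falling κ v ≥ (κ - v) ^ v = κ ^ v (1 - v / κ) ^ v ≥ κ ^ v (1 - v² / κ)`, where the last step
  -- is Bernoulli's inequality and the last bracket is at least one half.
  falling-half : ∀ v → 0ℚ ≤ κ → 2ℚ * (⟦ v ⟧ * ⟦ v ⟧) ≤ κ → ⟦ v ⟧ ≤ κ → κ ^ v ≤ 2ℚ * falling κ v
  falling-half v 0≤κ 2vv≤κ v≤κ = ≤-trans (≤-trans step (≤-reflexive split)) (*-monoˡ 0≤2 (falling-lower v v ℕ.≤-refl v≤κ))
    where
    V = ⟦ v ⟧
    x = V * w
    0≤2 : 0ℚ ≤ 2ℚ
    0≤2 = nonNegative⁻¹ 2ℚ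
    x≤1 : x ≤ 1ℚ
    x≤1 = subst (x ≤_) κw (*-monoʳ 0≤w v≤κ)
    2Vx≤1 : 2ℚ * (V * x) ≤ 1ℚ
    2Vx≤1 = subst₂ _≤_ (solve 2 (λ v w → con 2ℚ :* (v :* v) :* w := con 2ℚ :* (v :* (v :* w))) refl V w) κw (*-monoʳ 0≤w 2vv≤κ)
    1≤ : 1ℚ ≤ 2ℚ * (1ℚ - V * x)
    1≤ = subst₂ _≤_ refl (solve 1 (λ y → con 1ℚ :+ con 1ℚ :- con 2ℚ :* y := con 2ℚ :* (con 1ℚ :- y)) refl (V * x))
      (subst (_≤ 1ℚ + 1ℚ - 2ℚ * (V * x)) (solve 0 (con 1ℚ :+ con 1ℚ :- con 1ℚ := con 1ℚ) refl)
        (+-monoʳ-≤ (1ℚ + 1ℚ) (neg-antimono-≤ 2Vx≤1)))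
    step : κ ^ v ≤ κ ^ v * (2ℚ * (1ℚ - x) ^ v)
    step = subst (_≤ κ ^ v * (2ℚ * (1ℚ - x) ^ v)) (*-identityʳ (κ ^ v))
      (*-monoˡ (^-nonNeg v 0≤κ) (≤-trans 1≤ (*-monoˡ 0≤2 (bernoulli⁻ x v (*-nonNeg 0≤⟦ v ⟧ 0≤w) x≤1))))
    split : κ ^ v * (2ℚ * (1ℚ - x) ^ v) ≡ 2ℚ * (κ - V) ^ v
    split = trans (solve 2 (λ a b → a :* (con 2ℚ :* b) := con 2ℚ :* (a :* b)) refl (κ ^ v) ((1ℚ - x) ^ v))
      (cong (2ℚ *_) (trans (sym (^-distrib-* κ (1ℚ - x) v)) (cong (_^ v)
        (trans (solve 3 (λ k v w → k :* (con 1ℚ :- v :* w) := k :- v :* (k :* w)) refl κ V w)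
               (cong (λ z → κ - z) (trans (cong (V *_) κw) (*-identityʳ V)))))))

-- With κ = k and N = n: the hypothesis N ≤ K κ² says k ≥ √(n/K), the density is
-- at least r ^ v, and δ > 1 measures by how much the threshold is exceeded.
module _ {κ w N K δ r E M : ℚ} {v : ℕ} (0≤κ : 0ℚ ≤ κ) (0≤w : 0ℚ ≤ w) (κw : κ * w ≡ 1ℚ) (0≤N : 0ℚ ≤ N) (0≤K : 0ℚ ≤ K)
  (0≤δ : 0ℚ ≤ δ) (0≤M : 0ℚ ≤ M) (0≤E : 0ℚ ≤ E)
  (N≤ : N ≤ K * (κ * κ)) (Kδ≤r : K * δ ≤ r) (E≥ : r ^ v * ⟦ v ! ⟧ ≤ E) (M≤ : M ≤ δ ^ v)
  (κ≥ : M * ((⟦ v ⟧ + 1ℚ) * (1ℚ + K)) ^ v ≤ κ) where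

  private
    V = ⟦ v ⟧
    D = (V + 1ℚ) * (1ℚ + K)
    q = κ ^ v
    0≤V+1 : 0ℚ ≤ V + 1ℚ
    0≤V+1 = +-nonNeg 0≤⟦ v ⟧ 0≤1
    0≤D : 0ℚ ≤ D
    0≤D = *-nonNeg 0≤V+1 (+-nonNeg 0≤1 0≤K)
    0≤q : 0ℚ ≤ q
    0≤q = ^-nonNeg v 0≤κ

  -- Since `N ≤ K κ²`, the two bases multiply to at most `D κ³`. Against `w ^ v` this leaves
  -- `q² D ^ v`, and the one remaining `w = 1 / κ` absorbs `M D ^ v` by the hypothesis on `κ`.
  bad-bound : M * ((κ * V + κ) ^ v * (κ * κ + N) ^ v * w ^ suc v) ≤ q * q
  bad-bound = ≤-trans
    (*-monoˡ 0≤M (*-monoʳ (^-nonNeg (suc v) 0≤w) (≤-trans (≤-reflexive (sym (^-distrib-* (κ * V + κ) (κ * κ + N) v)))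
      (^-mono v (*-nonNeg 0≤κV+κ (+-nonNeg (*-nonNeg 0≤κ 0≤κ) 0≤N)) base))))
    (≤-trans (≤-reflexive shape) (≤-trans (*-monoˡ (*-nonNeg 0≤q 0≤q) (*-monoʳ 0≤w κ≥))
      (≤-reflexive (trans (cong (q * q *_) κw) (*-identityʳ (q * q))))))
    where
    0≤κV+κ : 0ℚ ≤ κ * V + κ
    0≤κV+κ = +-nonNeg (*-nonNeg 0≤κ 0≤⟦ v ⟧) 0≤κ
    base : (κ * V + κ) * (κ * κ + N) ≤ D * (κ * κ * κ)
    base = ≤-trans (*-monoˡ 0≤κV+κ (+-monoʳ-≤ (κ * κ) N≤))
      (≤-reflexive (solve 3 (λ k v K → (k :* v :+ k) :* (k :* k :+ K :* (k :* k)) :=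
        ((v :+ con 1ℚ) :* (con 1ℚ :+ K)) :* (k :* k :* k)) refl κ V K))
    shape : M * ((D * (κ * κ * κ)) ^ v * w ^ suc v) ≡ q * q * (M * D ^ v * w)
    shape = trans (cong (λ z → M * (z * w ^ suc v)) (trans (^-distrib-* D (κ * κ * κ) v)
        (cong (D ^ v *_) (trans (^-distrib-* (κ * κ) κ v) (cong (_* q) (^-distrib-* κ κ v))))))
      (trans (solve 5 (λ m d q w wv → m :* (d :* (q :* q :* q) :* (w :* wv)) := q :* q :* (m :* d :* w) :* (q :* wv))
          refl M (D ^ v) q w (w ^ v))
        (trans (cong (q * q * (M * D ^ v * w) *_) (^-inverse 0≤w κw v)) (*-identityʳ _)))

  -- The threshold enters here: `δ ^ v` pays for `M`, and `(K δ) ^ v v ! ≤ r ^ v v ! ≤ E`.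
  null-bound : M * (N ^ v * ⟦ v ! ⟧) ≤ q * q * E
  null-bound = ≤-trans (*-mono-≤ 0≤M M≤ (*-nonNeg (^-nonNeg v 0≤N) 0≤⟦ v ! ⟧) (*-monoʳ 0≤⟦ v ! ⟧ (^-mono v 0≤N N≤)))
    (≤-trans (≤-reflexive shape) (≤-trans (*-monoˡ (*-nonNeg 0≤q 0≤q) (*-monoʳ 0≤⟦ v ! ⟧ (^-mono v (*-nonNeg 0≤K 0≤δ) Kδ≤r)))
      (*-monoˡ (*-nonNeg 0≤q 0≤q) E≥)))
    where
    shape : δ ^ v * ((K * (κ * κ)) ^ v * ⟦ v ! ⟧) ≡ q * q * ((K * δ) ^ v * ⟦ v ! ⟧)
    shape = trans (cong (λ z → δ ^ v * (z * ⟦ v ! ⟧)) (trans (^-distrib-* K (κ * κ) v) (cong (K ^ v *_) (^-distrib-* κ κ v))))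
      (trans (solve 4 (λ d k q f → d :* (k :* (q :* q) :* f) := q :* q :* (k :* d :* f)) refl (δ ^ v) (K ^ v) q ⟦ v ! ⟧)
        (cong (λ z → q * q * (z * ⟦ v ! ⟧)) (sym (^-distrib-* K δ v))))

  variance-bound : q ≤ 2ℚ * falling κ v →
    M * ((E * E * ((κ * V + κ) ^ v * (κ * κ + N) ^ v) * w ^ suc v + E * (N ^ v * ⟦ v ! ⟧)) + E * (N ^ v * ⟦ v ! ⟧))
      ≤ 12ℚ * ((E * falling κ v) * (E * falling κ v))
  variance-bound q≤2f = ≤-trans (≤-reflexive split)
    (≤-trans (+-mono-≤ (*-monoˡ (*-nonNeg 0≤E 0≤E) bad-bound) (*-monoˡ (*-nonNeg 0≤2 0≤E) null-bound))
    (≤-trans (≤-reflexive (solve 2 (λ e q → e :* e :* (q :* q) :+ con 2ℚ :* e :* (q :* q :* e) := (con 1ℚ :+ con 1ℚ :+ con 1ℚ) :* (e :* e :* (q :* q))) refl E q))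
    (≤-trans (*-monoˡ (nonNegative⁻¹ (1ℚ + 1ℚ + 1ℚ)) (*-monoˡ (*-nonNeg 0≤E 0≤E) (*-mono-≤ 0≤q q≤2f 0≤q q≤2f)))
      (≤-reflexive (solve 2 (λ e f → (con 1ℚ :+ con 1ℚ :+ con 1ℚ) :* (e :* e :* ((con 2ℚ :* f) :* (con 2ℚ :* f))) :=
         (con (1ℚ + 1ℚ + 1ℚ) :* (con 2ℚ :* con 2ℚ)) :* ((e :* f) :* (e :* f))) refl E (falling κ v))))))
    where
    0≤2 : 0ℚ ≤ 2ℚ
    0≤2 = nonNegative⁻¹ 2ℚ
    -- The null term occurs twice, once in each of the two variances, which gives the coefficient 2.
    split : M * ((E * E * ((κ * V + κ) ^ v * (κ * κ + N) ^ v) * w ^ suc v + E * (N ^ v * ⟦ v ! ⟧)) + E * (N ^ v * ⟦ v ! ⟧))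
      ≡ E * E * (M * ((κ * V + κ) ^ v * (κ * κ + N) ^ v * w ^ suc v)) + 2ℚ * E * (M * (N ^ v * ⟦ v ! ⟧))
    split = solve 5 (λ m e p w n → m :* ((e :* e :* p :* w :+ e :* n) :+ e :* n) :=
      e :* e :* (m :* (p :* w)) :+ con 2ℚ :* e :* (m :* n)) refl
      M E ((κ * V + κ) ^ v * (κ * κ + N) ^ v) (w ^ suc v) (N ^ v * ⟦ v ! ⟧)

÷-< : ∀ {p q ε} → 0ℚ < q → p < ε * q → Σ[ nz ∈ NonZero q ] (p ÷ q) {{nz}} < ε
÷-< {p} {q} {ε} 0<q p<εq = nz , *-cancelʳ-<-nonNeg q {{nonNegative (<⇒≤ 0<q)}}
  (subst (_< ε * q) (sym (trans (*-assoc p ((1/ q) {{nz}}) q) (trans (cong (p *_) (*-inverseˡ q {{nz}})) (*-identityʳ p)))) p<εq)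
  where
  nz : NonZero q
  nz = pos⇒nonZero q {{positive 0<q}}

-- Rational consequences of the cut hypotheses

eventually-× : ∀ {P Q : ℕ → Set} → Eventually P → Eventually Q → Eventually (λ n → P n × Q n)
eventually-× (M , p) (N , q) = M ℕ.⊔ N , λ n le → p n (ℕ.≤-trans (ℕ.m≤m⊔n M N) le) , q n (ℕ.≤-trans (ℕ.m≤n⊔m M N) le)

eventually-∘ : ∀ {P : ℕ → Set} {f} → TendsToInfinity f → Eventually P → Eventually (λ n → P (f n))
eventually-∘ {f = f} f→∞ (M , p) = let (N , h) = f→∞ M in N , λ n le → p (f n) (h n le)

inverse : ∀ {x} → 0ℚ < x → ∃[ w ] (0ℚ < w × x * w ≡ 1ℚ)
inverse {x} 0<x = (1/ x) {{nz}} , positive⁻¹ ((1/ x) {{nz}}) {{1/pos⇒pos x {{positive 0<x}}}} , *-inverseʳ x {{nz}}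
  where
  nz : NonZero x
  nz = pos⇒nonZero x {{positive 0<x}}

upper : ∀ x → ∃[ m ] (x ≤ ⟦ m ⟧)
upper x@(mkℚ (ℤ.+ m) d _) = m , ≤-trans
  (subst (_≤ x * ⟦ suc d ⟧) (*-identityʳ x) (*-monoˡ (nonNegative⁻¹ x) (subst (_≤ ⟦ suc d ⟧) ⟦1⟧ (⟦⟧-mono (ℕ.s≤s ℕ.z≤n)))))
  (≤-reflexive (trans (cong (_* ⟦ suc d ⟧) (sym (↥p/↧p≡p x))) (/-*-cancel m (suc d))))
upper x@(mkℚ -[1+ _ ] _ _) = 0 , ≤-trans (nonPositive⁻¹ x) (≤-reflexive (sym ⟦0⟧))

archimedean : ∀ {ε} → 0ℚ < ε → ∀ x → ∃[ m ] (x ≤ ⟦ m ⟧ * ε)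
archimedean {ε} 0<ε x = let (w , 0<w , εw) = inverse 0<ε
                            (m , h) = upper (x * w)
  in m , subst (_≤ ⟦ m ⟧ * ε) (trans (*-assoc x w ε) (trans (cong (x *_) (trans (*-comm w ε) εw)) (*-identityʳ x)))
       (*-monoʳ (<⇒≤ 0<ε) h)

^-monoʳ : ∀ {a m n} → 1ℚ ≤ a → m ℕ.≤ n → a ^ m ≤ a ^ n
^-monoʳ {a} {n = zero} 1≤a ℕ.z≤n = ≤-refl
^-monoʳ {a} {n = suc n} 1≤a ℕ.z≤n = 1≤* 1≤a (^-monoʳ {n = n} 1≤a ℕ.z≤n)
^-monoʳ 1≤a (ℕ.s≤s le) = *-monoˡ (≤-trans 0≤1 1≤a) (^-monoʳ 1≤a le)

^-antimonoʳ : ∀ {a m n} → 0ℚ ≤ a → a ≤ 1ℚ → m ℕ.≤ n → a ^ n ≤ a ^ m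
^-antimonoʳ {a} {n = zero} 0≤a a≤1 ℕ.z≤n = ≤-refl
^-antimonoʳ {a} {n = suc n} 0≤a a≤1 ℕ.z≤n = *-mono-≤ 0≤a a≤1 (^-nonNeg n 0≤a) (^-antimonoʳ {n = n} 0≤a a≤1 ℕ.z≤n)
^-antimonoʳ 0≤a a≤1 (ℕ.s≤s le) = *-monoˡ 0≤a (^-antimonoʳ 0≤a a≤1 le)

1≤2 : 1ℚ ≤ ℤ.+ 2 / 1
1≤2 = subst (_≤ 1ℚ + 1ℚ) (+-identityʳ 1ℚ) (+-monoʳ-≤ 1ℚ 0≤1)

½≤1 : ½ ≤ 1ℚ
½≤1 = subst₂ _≤_ (+-identityˡ ½) (solve 0 (con ½ :+ con ½ := con 1ℚ) refl) (+-monoˡ-≤ ½ (nonNegative⁻¹ ½))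

2^ℤ-mono : ∀ {i j} → i ℤ.≤ j → 2^ℤ i ≤ 2^ℤ j
2^ℤ-mono (ℤ.-≤- n≤m) = ^-antimonoʳ (nonNegative⁻¹ ½) ½≤1 (ℕ.s≤s n≤m)
2^ℤ-mono (ℤ.-≤+ {m} {n}) = ≤-trans (^-antimonoʳ {n = suc m} (nonNegative⁻¹ ½) ½≤1 ℕ.z≤n) (^-monoʳ {n = n} 1≤2 ℕ.z≤n)
2^ℤ-mono (ℤ.+≤+ m≤n) = ^-monoʳ 1≤2 m≤n

0≤2^ℤ : ∀ i → 0ℚ ≤ 2^ℤ i
0≤2^ℤ (ℤ.+ n)    = ^-nonNeg n (≤-trans 0≤1 1≤2)
0≤2^ℤ -[1+ n ] = ^-nonNeg (suc n) (nonNegative⁻¹ ½)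

2^ℤ-^ : ∀ i n → 2^ℤ i ^ n ≡ 2^ℤ (i ℤ.* ℤ.+ n)
2^ℤ-^ (ℤ.+ m) n = trans (sym (^-* (ℤ.+ 2 / 1) m n)) (cong 2^ℤ (ℤ.pos-* m n))
2^ℤ-^ -[1+ m ] zero = sym (cong 2^ℤ (ℤ.*-zeroʳ -[1+ m ]))
2^ℤ-^ -[1+ m ] (suc n) = sym (^-* ½ (suc m) (suc n))

-- `v p ≤ w` with denominators cleared, by way of unnormalised fractions because the product
-- `⟦ v ⟧ * p` is reduced to lowest terms.
cross-multiply : ∀ v p w → ⟦ v ⟧ * p ≤ w → ↥ p ℤ.* ℤ.+ (v ℕ.* ↧ₙ w) ℤ.≤ ↥ w ℤ.* ℤ.+ ↧ₙ p
cross-multiply v p@(mkℚ _ _ _) w@(mkℚ _ _ _) vp≤w = subst₂ ℤ._≤_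
  (trans (cong (ℤ._* ℤ.+ e) (ℤ.*-comm (ℤ.+ v) (↥ p))) (trans (ℤ.*-assoc (↥ p) (ℤ.+ v) (ℤ.+ e)) (cong (↥ p ℤ.*_) (sym (ℤ.pos-* v e)))))
  (cong (λ z → ↥ w ℤ.* ℤ.+ z) (ℕ.*-identityˡ b))
  (ℚᵘ.drop-*≤* (ℚᵘ.≤-trans (ℚᵘ.≤-reflexive (ℚᵘ.≃-sym asᵘ)) (toℚᵘ-mono-≤ vp≤w)))
  where
  b = ↧ₙ p
  e = ↧ₙ w
  asᵘ : toℚᵘ (⟦ v ⟧ * p) ℚᵘ.≃ ℚᵘ.mkℚᵘ (ℤ.+ v) 0 ℚᵘ.* toℚᵘ p
  asᵘ = ℚᵘ.≃-trans (toℚᵘ-homo-* ⟦ v ⟧ p)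
    (ℚᵘ.*-cong (ℚᵘ.≃-trans (ℚᵘ.≃-reflexive (cong toℚᵘ (⟦⟧-/1 v))) (toℚᵘ-fromℚᵘ (ℚᵘ.mkℚᵘ (ℤ.+ v) 0))) (ℚᵘ.≃-refl {toℚᵘ p}))

-- The chain `s ^ v ≤ 2 ^ (v p) ≤ 2 ^ w ≤ r`. Its exponents are rational, so it is carried out after
-- raising everything to the product of the denominators of `p` and `w`, and `^-cancel` takes that
-- root again.
≤2^-trans : ∀ {s r p w} v → 0ℚ ≤ s → 0ℚ ≤ r → s ≤2^ p → ⟦ v ⟧ * p ≤ w → 2^ w ≤ r → s ^ v ≤ r
≤2^-trans {s} {r} {p} {w} v 0≤s 0≤r s≤ vp≤w ≤r = ^-cancel (ℕ.pred (b ℕ.* e)) 0≤r (begin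
  (s ^ v) ^ (b ℕ.* e)          ≡⟨ sym (^-* s v (b ℕ.* e)) ⟩
  s ^ (v ℕ.* (b ℕ.* e))        ≡⟨ cong (s ^_) (trans (sym (ℕ.*-assoc v b e)) (trans (cong (ℕ._* e) (ℕ.*-comm v b)) (ℕ.*-assoc b v e))) ⟩
  s ^ (b ℕ.* (v ℕ.* e))        ≡⟨ ^-* s b (v ℕ.* e) ⟩
  (s ^ b) ^ (v ℕ.* e)          ≤⟨ ^-mono (v ℕ.* e) (^-nonNeg b 0≤s) s≤ ⟩
  2^ℤ (↥ p) ^ (v ℕ.* e)        ≡⟨ 2^ℤ-^ (↥ p) (v ℕ.* e) ⟩
  2^ℤ (↥ p ℤ.* ℤ.+ (v ℕ.* e))    ≤⟨ 2^ℤ-mono exponents ⟩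
  2^ℤ (↥ w ℤ.* ℤ.+ b)            ≡⟨ sym (2^ℤ-^ (↥ w) b) ⟩
  2^ℤ (↥ w) ^ b                ≤⟨ ^-mono b (0≤2^ℤ (↥ w)) ≤r ⟩
  (r ^ e) ^ b                  ≡⟨ sym (^-* r e b) ⟩
  r ^ (e ℕ.* b)                ≡⟨ cong (r ^_) (ℕ.*-comm e b) ⟩
  r ^ (b ℕ.* e)                ∎)
  where
  open ≤-Reasoning
  b = ↧ₙ p
  e = ↧ₙ w
  exponents : ↥ p ℤ.* ℤ.+ (v ℕ.* e) ℤ.≤ ↥ w ℤ.* ℤ.+ b
  exponents = cross-multiply v p w vp≤w

private
  <0-absurd : ∀ {x} → 0ℚ ≤ x → ¬ (x < 0ℚ)
  <0-absurd 0≤x x<0 = <-irrefl refl (≤-<-trans 0≤x x<0)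

-- Unfolding the cuts gives `r² ≤ s ≤ 2 ^ a` with `v a` eventually below the logarithm of the
-- density.
density-lower : ∀ {ℋ : ∀ v → GraphSet v} {r} → 0ℚ < r → r <ʳ √ (c ℋ) →
  Eventually (λ v → (r * r) ^ v ≤ density (ℋ v))
-- The next two clauses discard the default member 0 in the definitions of `√` and `exp₂`, which
-- cannot lie above a positive `r` or above a square.
density-lower 0<r (p , inj₁ refl , r<p) = ⊥-elim (<-irrefl refl (<-trans 0<r r<p))
density-lower 0<r (p , inj₂ (s , inj₁ refl , pp<s) , r<p) =
  ⊥-elim (<0-absurd (*-nonNeg (<⇒≤ (<-trans 0<r r<p)) (<⇒≤ (<-trans 0<r r<p))) pp<s)
density-lower {ℋ} {r} 0<r (p , inj₂ (s , inj₂ (0<s , a , (b , (N , ev) , a<b) , s≤2^a) , pp<s) , r<p) = N , bound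
  where
  rr≤s : r * r ≤ s
  rr≤s = ≤-trans (*-mono-≤ (<⇒≤ 0<r) (<⇒≤ r<p) (<⇒≤ 0<r) (<⇒≤ r<p)) (<⇒≤ pp<s)
  bound : ∀ v → N ℕ.≤ v → (r * r) ^ v ≤ density (ℋ v)
  bound v N≤v with ev v N≤v
  ... | b′ , (w , (r′ , 0<r′ , (_ , refl , r′<d) , 2^w≤r′) , vb′<w) , b<b′ =
    ≤-trans (^-mono v (*-nonNeg (<⇒≤ 0<r) (<⇒≤ 0<r)) rr≤s)
      (≤-trans (≤2^-trans {p = a} {w = w} v (<⇒≤ 0<s) (<⇒≤ 0<r′) s≤2^a
        (≤-trans (*-monoˡ 0≤⟦ v ⟧ (<⇒≤ (<-trans a<b b<b′))) (≤-trans (≤-reflexive (cong (_* b′) (⟦⟧-/1 v))) (<⇒≤ vb′<w))) 2^w≤r′) (<⇒≤ r′<d))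

-- Logarithms of natural numbers and the bound on `v`

fromℕ-below : ∀ {q} n → q < ⟦ n ⟧ → q <ʳ fromℕ n
fromℕ-below {q} n q<n = ℤ.+ n / 1 , refl , subst (q <_) (⟦⟧-/1 n) q<n

fromℕ-above : ∀ {q} n → q <ʳ fromℕ n → q < ⟦ n ⟧
fromℕ-above {q} n (_ , refl , q<n) = subst (q <_) (sym (⟦⟧-/1 n)) q<n

⟦⟧-mkℚ : ∀ m → ⟦ m ⟧ ≡ mkℚ (ℤ.+ m) 0 (Coprime.sym (1-coprimeTo m))
⟦⟧-mkℚ m = trans (⟦⟧-/1 m) (normalize-coprime (Coprime.sym (1-coprimeTo m)))

2^⟦⟧ : ∀ m → 2^ ⟦ m ⟧ ≤ ⟦ 2 ℕ.^ m ⟧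
2^⟦⟧ m = subst₂ (λ i b → 2^ℤ i ≤ ⟦ 2 ℕ.^ m ⟧ ^ b) (sym (cong ↥_ (⟦⟧-mkℚ m))) (sym (cong ↧ₙ_ (⟦⟧-mkℚ m)))
  (≤-reflexive (trans (cong (_^ m) (sym (⟦⟧-/1 2))) (trans (sym (⟦⟧-^ 2 m)) (sym (*-identityʳ ⟦ 2 ℕ.^ m ⟧)))))

log₂-fromℕ-below : ∀ {q} m n → 2 ℕ.^ m ℕ.< n → q < ⟦ m ⟧ → q <ʳ log₂ (fromℕ n)
log₂-fromℕ-below m n 2^m<n q<m = ⟦ m ⟧ , (⟦ 2 ℕ.^ m ⟧ , subst (_< ⟦ 2 ℕ.^ m ⟧) ⟦0⟧ (⟦⟧-mono-< (ℕ.m^n>0 2 m)) ,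
  fromℕ-below n (⟦⟧-mono-< 2^m<n) , 2^⟦⟧ m) , q<m

log₂-fromℕ-above : ∀ {w} m n → w <ʳ log₂ (fromℕ n) → ⟦ m ⟧ ≤ w → 2 ℕ.^ m ℕ.< n
log₂-fromℕ-above m n (w′ , (r , 0<r , r<n , 2^w′≤r) , w<w′) m≤w = ⟦⟧-cancel-< (≤-<-trans
  (≤-trans (≤-reflexive (⟦⟧-^ 2 m))
    -- Applied to `2 ≤ 2 ^ 1`, with `m` in the place of the exponent `v`.
    (≤2^-trans {p = 1ℚ} {w = w′} m 0≤⟦ 2 ⟧ (<⇒≤ 0<r) (≤-reflexive (trans (*-identityʳ ⟦ 2 ⟧) (trans (⟦⟧-/1 2) (sym (*-identityʳ (ℤ.+ 2 / 1))))))
      (≤-trans (≤-reflexive (*-identityʳ ⟦ m ⟧)) (≤-trans m≤w (<⇒≤ w<w′))) 2^w′≤r))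
  (fromℕ-above n r<n))

log : ∀ n → 1 ℕ.≤ n → ∃[ l ] (2 ℕ.^ l ℕ.≤ n × n ℕ.< 2 ℕ.^ suc l)
log (suc zero) _ = 0 , ℕ.≤-refl , ℕ.≤-refl
log (suc (suc n)) _ with log (suc n) (ℕ.s≤s ℕ.z≤n)
... | l , lo , hi with suc (suc n) ℕ.<? 2 ℕ.^ suc l
...   | yes h = l , ℕ.≤-trans lo (ℕ.n≤1+n _) , h
...   | no ¬h = suc l , ℕ.≮⇒≥ ¬h , ℕ.≤-<-trans hi (ℕ.^-monoʳ-< 2 (ℕ.s≤s (ℕ.s≤s ℕ.z≤n)) {suc l} {suc (suc l)} ℕ.≤-refl)

log-≥ : ∀ {l m n} → 2 ℕ.^ m ℕ.≤ n → n ℕ.< 2 ℕ.^ suc l → m ℕ.≤ l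
log-≥ {l} {m} lo hi with m ℕ.≤? l
... | yes h = h
... | no ¬h = ⊥-elim (ℕ.<-irrefl refl (ℕ.≤-<-trans (ℕ.≤-trans (ℕ.^-monoʳ-≤ 2 (ℕ.≰⇒> ¬h)) lo) hi))

-- Collects the rounding losses of `power-bound′`: `v` is seen only as `v - 1`, the constant 5 as 4,
-- and `log₂ (log₂ n)` as `a`, while `4 + a` bounds `log₂ v` from above. The slack between 4 and 3
-- absorbs them, with equality at `a = 20` and `v = 10`.
exponent-bound : ∀ {a v} → 20 ℕ.≤ a → 10 ℕ.≤ v → 3 ℕ.* v ℕ.* (4 ℕ.+ a) ℕ.≤ ℕ.pred v ℕ.* (4 ℕ.* a)
exponent-bound 20≤a 10≤v =
  let (a′ , 20+a′≡a) = ℕ.m≤n⇒∃[o]m+o≡n 20≤a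
      (v′ , 10+v′≡v) = ℕ.m≤n⇒∃[o]m+o≡n 10≤v
  in subst₂ (λ a v → 3 ℕ.* v ℕ.* (4 ℕ.+ a) ℕ.≤ ℕ.pred v ℕ.* (4 ℕ.* a)) 20+a′≡a 10+v′≡v
    (ℕ.≤-trans (ℕ.≤-reflexive (lhs v′ a′)) (ℕ.≤-trans (ℕ.m≤m+n (small v′ a′) (v′ ℕ.* a′ ℕ.+ 6 ℕ.* a′ ℕ.+ 8 ℕ.* v′))
      (ℕ.≤-reflexive (trans (sym (rhs v′ a′)) (cong (ℕ._* (4 ℕ.* (20 ℕ.+ a′))) {9 ℕ.+ v′} {ℕ.pred (10 ℕ.+ v′)} refl)))))
  where
  module S = ℕ-Solver
  small : ℕ → ℕ → ℕ
  small v a = 720 ℕ.+ 30 ℕ.* a ℕ.+ 72 ℕ.* v ℕ.+ 3 ℕ.* (v ℕ.* a)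
  lhs : ∀ v a → 3 ℕ.* (10 ℕ.+ v) ℕ.* (4 ℕ.+ (20 ℕ.+ a)) ≡ small v a
  lhs = S.solve 2 (λ v a → S.con 3 S.:* (S.con 10 S.:+ v) S.:* (S.con 4 S.:+ (S.con 20 S.:+ a)) S.:=
    (S.con 720 S.:+ S.con 30 S.:* a S.:+ S.con 72 S.:* v S.:+ S.con 3 S.:* (v S.:* a))) refl
  rhs : ∀ v a → (9 ℕ.+ v) ℕ.* (4 ℕ.* (20 ℕ.+ a)) ≡ small v a ℕ.+ (v ℕ.* a ℕ.+ 6 ℕ.* a ℕ.+ 8 ℕ.* v)
  rhs = S.solve 2 (λ v a → (S.con 9 S.:+ v) S.:* (S.con 4 S.:* (S.con 20 S.:+ a)) S.:=
    (S.con 720 S.:+ S.con 30 S.:* a S.:+ S.con 72 S.:* v S.:+ S.con 3 S.:* (v S.:* a))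
      S.:+ (v S.:* a S.:+ S.con 6 S.:* a S.:+ S.con 8 S.:* v)) refl

-- Here l = ⌊log₂ n⌋ and a + 3 = ⌊log₂ l⌋.
module _ {n v l a : ℕ} (2^l≤n : 2 ℕ.^ l ℕ.≤ n) (n<2^l : n ℕ.< 2 ℕ.^ suc l)
  (lo : 2 ℕ.^ (3 ℕ.+ a) ℕ.≤ l) (hi : l ℕ.< 2 ℕ.^ (4 ℕ.+ a)) (20≤a : 20 ℕ.≤ a) (10≤v : 10 ℕ.≤ v) where

  private
    -- Lower cuts are open, so each of the two logarithms costs one unit of `3 + a`.
    log₂log₂-below : ⟦ suc a ⟧ <ʳ log₂ (log₂ (fromℕ n))
    log₂log₂-below = ⟦ 2 ℕ.+ a ⟧ ,
      (⟦ 2 ℕ.^ (2 ℕ.+ a) ⟧ , subst (_< ⟦ 2 ℕ.^ (2 ℕ.+ a) ⟧) ⟦0⟧ (⟦⟧-mono-< (ℕ.m^n>0 2 (2 ℕ.+ a))) ,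
        log₂-fromℕ-below (ℕ.pred l) n (ℕ.<-≤-trans (ℕ.^-monoʳ-< 2 (ℕ.s≤s (ℕ.s≤s ℕ.z≤n)) pred<) 2^l≤n) (⟦⟧-mono-< below) , 2^⟦⟧ (2 ℕ.+ a)) ,
      ⟦⟧-mono-< ℕ.≤-refl
      where
      4≤ : 4 ℕ.≤ 2 ℕ.^ (2 ℕ.+ a)
      4≤ = ℕ.^-monoʳ-≤ 2 {2} {2 ℕ.+ a} (ℕ.s≤s (ℕ.s≤s ℕ.z≤n))
      l≥ : suc (suc (2 ℕ.^ (2 ℕ.+ a))) ℕ.≤ l
      l≥ = ℕ.≤-trans (ℕ.≤-trans (ℕ.+-monoˡ-≤ (2 ℕ.^ (2 ℕ.+ a)) {2} {2 ℕ.^ (2 ℕ.+ a)} (ℕ.≤-trans (ℕ.s≤s (ℕ.s≤s ℕ.z≤n)) 4≤))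
        (ℕ.≤-reflexive (cong (2 ℕ.^ (2 ℕ.+ a) ℕ.+_) (sym (ℕ.+-identityʳ _))))) lo
      below : 2 ℕ.^ (2 ℕ.+ a) ℕ.< ℕ.pred l
      below = ℕ.pred-mono-≤ l≥
      pred< : ℕ.pred l ℕ.< l
      pred< = ℕ.≤-reflexive (ℕ.suc-pred l {{ℕ.>-nonZero (ℕ.≤-trans (ℕ.s≤s ℕ.z≤n) l≥)}})

  -- With `m = 3 v (4 + a)`, the hypothesis yields `2 ^ m < n`. Then `v ≤ m ≤ l < 2 ^ (4 + a)`, and
  -- this bound on `v` itself gives `v ^ (3 v) ≤ 2 ^ m`.
  power-bound′ : fromℕ v ≤ʳ (log₂ (fromℕ n) ÷ʳ (fromℕ 5 · log₂ (log₂ (fromℕ n)))) → v ℕ.^ (3 ℕ.* v) ℕ.≤ n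
  power-bound′ h with h ⟦ ℕ.pred v ⟧ (fromℕ-below v (⟦⟧-mono-< (ℕ.≤-reflexive (ℕ.suc-pred v {{ℕ.>-nonZero (ℕ.≤-trans (ℕ.s≤s ℕ.z≤n) 10≤v)}}))))
  ... | x , (s , 0<s , s≥ , xs<log) , v<x = ℕ.≤-trans
      (ℕ.^-monoˡ-≤ (3 ℕ.* v) (ℕ.≤-trans v≤m (ℕ.<⇒≤ m<2^)))
      (ℕ.≤-trans (ℕ.≤-reflexive (trans (ℕ.^-*-assoc 2 (4 ℕ.+ a) (3 ℕ.* v)) (cong (2 ℕ.^_) (ℕ.*-comm (4 ℕ.+ a) (3 ℕ.* v))))) (ℕ.<⇒≤ 2^m<n))
    where
    m = 3 ℕ.* v ℕ.* (4 ℕ.+ a)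
    4a<s : ⟦ 4 ℕ.* a ⟧ < s
    -- `4` and `suc a` lie strictly below the two factors `5` and `log₂ (log₂ n)`, as membership in
    -- open cuts demands.
    4a<s with s≥ ⟦ 4 ℕ.* a ⟧ (_ , inj₂ (⟦ 4 ⟧ , ⟦ suc a ⟧ , 0≤⟦ 4 ⟧ , 0≤⟦ suc a ⟧ ,
               fromℕ-below 5 (⟦⟧-mono-< (ℕ.≤-refl {5})) , log₂log₂-below , refl) ,
               subst (⟦ 4 ℕ.* a ⟧ <_) (⟦⟧-* 4 (suc a)) (⟦⟧-mono-< (ℕ.*-monoʳ-< 4 (ℕ.n<1+n a))))
    ... | _ , refl , lt = lt
    2^m<n : 2 ℕ.^ m ℕ.< n
    2^m<n = log₂-fromℕ-above m n xs<log (≤-trans (⟦⟧-mono (exponent-bound 20≤a 10≤v)) (≤-trans (≤-reflexive (⟦⟧-* (ℕ.pred v) (4 ℕ.* a)))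
      (*-mono-≤ 0≤⟦ ℕ.pred v ⟧ (<⇒≤ v<x) 0≤⟦ 4 ℕ.* a ⟧ (<⇒≤ 4a<s))))
    v≤m : v ℕ.≤ m
    v≤m = ℕ.≤-trans (ℕ.m≤m+n v _) (ℕ.m≤m*n (3 ℕ.* v) (4 ℕ.+ a))
    m<2^ : m ℕ.< 2 ℕ.^ (4 ℕ.+ a)
    m<2^ = ℕ.≤-<-trans (log-≥ (ℕ.<⇒≤ 2^m<n) n<2^l) hi

power-bound : ∀ b {n v} → 20 ℕ.≤ b → 2 ℕ.^ (2 ℕ.^ (3 ℕ.+ b)) ℕ.≤ n → 10 ℕ.≤ v →
  fromℕ v ≤ʳ (log₂ (fromℕ n) ÷ʳ (fromℕ 5 · log₂ (log₂ (fromℕ n)))) → v ℕ.^ (3 ℕ.* v) ℕ.≤ n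
power-bound b {n} {v} 20≤b n≥ 10≤v h =
  let (l , 2^l≤n , n<2^l) = log n (ℕ.≤-trans (ℕ.m^n>0 2 (2 ℕ.^ (3 ℕ.+ b))) n≥)
      l≥ = log-≥ n≥ n<2^l
      (l′ , lo , hi) = log l (ℕ.≤-trans (ℕ.m^n>0 2 (3 ℕ.+ b)) l≥)
      (a , 3+b+a≡l′) = ℕ.m≤n⇒∃[o]m+o≡n (log-≥ {l′} {3 ℕ.+ b} l≥ hi)
  in power-bound′ {n} {v} {l} {b ℕ.+ a} 2^l≤n n<2^l
       (subst (λ m → 2 ℕ.^ m ℕ.≤ l) (sym 3+b+a≡l′) lo) (subst (λ m → l ℕ.< 2 ℕ.^ suc m) (sym 3+b+a≡l′) hi)
       (ℕ.≤-trans 20≤b (ℕ.m≤m+n b a)) 10≤v h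

-- Suppose `k² < q² n` and take `q₁` with `q < q₁ < lam`. Then `k / q` is below `√ n`, and a
-- rational `p` between `k / q₁` and `k / q` satisfies `k < q₁ p`. As `q₁ p` is a member of the
-- product `lam · √ n`, the hypothesis would put `k` strictly below itself.
planted-lower : ∀ {lam q n k} → 1 ℕ.≤ n → 0ℚ < q → q <ʳ lam → (lam · √ (fromℕ n)) ≤ʳ fromℕ k →
  q * q * ⟦ n ⟧ ≤ ⟦ k ⟧ * ⟦ k ⟧
planted-lower {lam} {q} {n} {k} 1≤n 0<q q<lam h with q * q * ⟦ n ⟧ ≤? ⟦ k ⟧ * ⟦ k ⟧
... | yes le = le
... | no ¬le with Extℝ.open↓ lam q<lam
...   | q₁ , q<q₁ , q₁<lam = ⊥-elim (go k refl)
  where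
  0<q₁ : 0ℚ < q₁
  0<q₁ = <-trans 0<q q<q₁
  contra : ∀ {p p′} → 0ℚ ≤ p → p < p′ → p′ * p′ < ⟦ n ⟧ → ⟦ k ⟧ < q₁ * p → Empty.⊥
  contra {p} {p′} 0≤p p<p′ pp<n k<q₁p = <-irrefl refl (fromℕ-above k (h ⟦ k ⟧
    (q₁ * p , inj₂ (q₁ , p , <⇒≤ 0<q₁ , 0≤p , q₁<lam , (p′ , inj₂ (fromℕ-below n pp<n) , p<p′) , refl) , k<q₁p)))
  go : ∀ j → k ≡ j → Empty.⊥
  -- For `k = 0` both quotients vanish, and `1/4 < 1/2 < 1 ≤ √ n` serve instead.
  go zero refl = contra {½ * ½} {½} (*-nonNeg (nonNegative⁻¹ ½) (nonNegative⁻¹ ½))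
    (subst (½ * ½ <_) (*-identityʳ ½) (*-monoʳ-<-pos ½ ½<1))
    (<-≤-trans (<-trans (subst (½ * ½ <_) (*-identityʳ ½) (*-monoʳ-<-pos ½ ½<1)) ½<1) (subst (_≤ ⟦ n ⟧) ⟦1⟧ (⟦⟧-mono 1≤n)))
    (subst (_< q₁ * (½ * ½)) (sym ⟦0⟧) (*-pos 0<q₁ (*-pos (positive⁻¹ ½) (positive⁻¹ ½))))
    where
    ½<1 : ½ < 1ℚ
    ½<1 = subst₂ _<_ (+-identityˡ ½) (solve 0 (con ½ :+ con ½ := con 1ℚ) refl) (+-monoˡ-< ½ (positive⁻¹ ½))
  go (suc j) refl with inverse 0<q | inverse 0<q₁
  ... | w , 0<w , qw | w₁ , 0<w₁ , q₁w₁ = contra (<⇒≤ (<-trans 0<y y<p)) p<x xx<n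
      (subst (_< q₁ * p) (trans (*-comm q₁ y) (trans (*-assoc ⟦ k ⟧ w₁ q₁) (trans (cong (⟦ k ⟧ *_) (trans (*-comm w₁ q₁) q₁w₁)) (*-identityʳ ⟦ k ⟧))))
        (*-monoʳ-<-pos q₁ {{positive 0<q₁}} y<p))
    where
    x = ⟦ k ⟧ * w
    y = ⟦ k ⟧ * w₁
    0<k : 0ℚ < ⟦ k ⟧
    0<k = subst (_< ⟦ k ⟧) ⟦0⟧ (⟦⟧-mono-< (ℕ.s≤s ℕ.z≤n))
    0<y : 0ℚ < y
    0<y = *-pos 0<k 0<w₁
    w₁<w : w₁ < w
    w₁<w = subst₂ _<_ (trans (cong (_* w₁) qw) (*-identityˡ w₁))
      (trans (solve 3 (λ q w r → q :* w :* r := w :* (q :* r)) refl q₁ w w₁) (trans (cong (w *_) q₁w₁) (*-identityʳ w)))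
      (*-monoˡ-<-pos w₁ {{positive 0<w₁}} (*-monoˡ-<-pos w {{positive 0<w}} q<q₁))
    between = <-dense (*-monoʳ-<-pos ⟦ k ⟧ {{positive 0<k}} w₁<w)
    p = proj₁ between
    y<p = proj₁ (proj₂ between)
    p<x = proj₂ (proj₂ between)
    xx<n : x * x < ⟦ n ⟧
    xx<n = subst₂ _<_ (solve 2 (λ k w → k :* k :* (w :* w) := k :* w :* (k :* w)) refl ⟦ k ⟧ w)
      (trans (solve 3 (λ q n w → q :* q :* n :* (w :* w) := (q :* w) :* (q :* w) :* n) refl q ⟦ n ⟧ w)
        (trans (cong (λ z → z * z * ⟦ n ⟧) qw) (*-identityˡ ⟦ n ⟧)))
      (*-monoˡ-<-pos (w * w) {{positive (*-pos 0<w 0<w)}} (≰⇒> ¬le))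

-- Strong separation

-- The ratio is at most `12 / M`, which the last hypothesis places below `ε`.
separation : ∀ {v n k} (ℋ : GraphSet v) → (∀ H → T (ℋ H) → Connected H) → 2 ℕ.≤ v → k ℕ.≤ n →
  ∀ {r K δ M ε} → 0ℚ < r → r ^ v ≤ density ℋ → 0ℚ ≤ K → ⟦ n ⟧ ≤ K * (⟦ k ⟧ * ⟦ k ⟧) →
  0ℚ ≤ δ → K * δ ≤ r → 2ℚ ≤ M → M ≤ δ ^ v → M * ((⟦ v ⟧ + 1ℚ) * (1ℚ + K)) ^ v ≤ ⟦ k ⟧ →
  12ℚ < M * ε →
  let F   = λ G → F[ ℋ ] (signs G)
      gap = 𝔼 (𝒫 n k) F - 𝔼 (𝒬 n) F
  in Σ[ nz ∈ NonZero (gap * gap) ] ((Var (𝒫 n k) F + Var (𝒬 n) F) ÷ (gap * gap)) {{nz}} < ε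
separation {v} {n} {k} ℋ conn 2≤v k≤n {r} {K} {δ} {M} {ε} 0<r dens 0≤K N≤ 0≤δ Kδ≤r 2≤M M≤ κ≥ 12<Mε =
  ÷-< (subst (λ g → 0ℚ < g * g) (sym gap≡) (*-pos 0<g 0<g)) (subst (λ g → Var (𝒫 n k) F + Var (𝒬 n) F < ε * (g * g)) (sym gap≡) small)
  where
  open Moments ℋ conn 2≤v n using (#E; F)
  open Variances ℋ conn 2≤v n
  V = ⟦ v ⟧
  κ = ⟦ k ⟧
  f = falling κ v
  g = #E * f
  gap = 𝔼 (𝒫 n k) F - 𝔼 (𝒬 n) F
  gap≡ : gap ≡ g
  gap≡ = trans (cong₂ _-_ (𝔼𝒫 k≤n) 𝔼𝒬) (+-identityʳ g)
  0<2 : 0ℚ < 2ℚ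
  0<2 = positive⁻¹ 2ℚ
  0<M : 0ℚ < M
  0<M = <-≤-trans 0<2 2≤M
  1≤V : 1ℚ ≤ V
  1≤V = subst (_≤ V) ⟦1⟧ (⟦⟧-mono (ℕ.≤-trans (ℕ.n≤1+n 1) 2≤v))
  V+1≤D : V + 1ℚ ≤ (V + 1ℚ) * (1ℚ + K)
  V+1≤D = subst (_≤ (V + 1ℚ) * (1ℚ + K)) (*-identityʳ (V + 1ℚ))
    (*-monoˡ (+-nonNeg 0≤⟦ v ⟧ 0≤1) (subst (_≤ 1ℚ + K) (+-identityʳ 1ℚ) (+-monoʳ-≤ 1ℚ 0≤K)))
  V≤V+1 : V ≤ V + 1ℚ
  V≤V+1 = subst (_≤ V + 1ℚ) (+-identityʳ V) (+-monoʳ-≤ V 0≤1)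
  2VV≤κ : 2ℚ * (V * V) ≤ κ
  -- `2 v² ≤ M D ^ v` since `2 ≤ M`, `2 ≤ v` and `v ≤ D`; so the growth hypothesis on `k` also
  -- provides what `falling-half` requires.
  2VV≤κ = ≤-trans (*-mono-≤ (<⇒≤ 0<2) 2≤M (*-nonNeg 0≤⟦ v ⟧ 0≤⟦ v ⟧)
    (≤-trans (≤-reflexive (cong (V *_) (sym (*-identityʳ V))))
      (≤-trans (^-monoʳ {V} 1≤V 2≤v) (^-mono v 0≤⟦ v ⟧ (≤-trans V≤V+1 V+1≤D))))) κ≥
  V≤κ : V ≤ κ
  V≤κ = ≤-trans (subst (_≤ 2ℚ * (V * V)) (*-identityˡ V)
    (*-mono-≤ 0≤1 (subst (_≤ 2ℚ) (+-identityʳ 1ℚ) (+-monoʳ-≤ 1ℚ 0≤1)) 0≤⟦ v ⟧ (subst (_≤ V * V) (*-identityʳ V) (*-monoˡ 0≤⟦ v ⟧ 1≤V)))) 2VV≤κ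
  1≤κ : 1ℚ ≤ κ
  1≤κ = ≤-trans 1≤V V≤κ
  0<κ : 0ℚ < κ
  0<κ = <-≤-trans (positive⁻¹ 1ℚ) 1≤κ
  inv = inverse 0<κ
  w = proj₁ inv
  0≤w : 0ℚ ≤ w
  0≤w = <⇒≤ (proj₁ (proj₂ inv))
  κw : κ * w ≡ 1ℚ
  κw = proj₂ (proj₂ inv)
  half : κ ^ v ≤ 2ℚ * f
  half = falling-half 0≤w κw v (<⇒≤ 0<κ) 2VV≤κ V≤κ
  0<f : 0ℚ < f
  0<f = *-cancelˡ-<-nonNeg 2ℚ {{nonNegative (<⇒≤ 0<2)}} (subst (_< 2ℚ * f) (sym (*-zeroʳ 2ℚ)) (<-≤-trans (^-pos v 0<κ) half))
  E≥ : r ^ v * ⟦ v ! ⟧ ≤ #E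
  E≥ = ≤-trans (*-monoʳ 0≤⟦ v ! ⟧ dens) (≤-reflexive (/-*-cancel (length (elements ℋ)) (v !) {{v !≢0}}))
  0<E : 0ℚ < #E
  0<E = <-≤-trans (*-pos (^-pos v 0<r) (subst (_< ⟦ v ! ⟧) ⟦0⟧ (⟦⟧-mono-< (ℕ.>-nonZero⁻¹ (v !) {{v !≢0}})))) E≥
  0<g : 0ℚ < g
  0<g = *-pos 0<E 0<f
  κu : κ ^ suc v * w ^ suc v ≡ 1ℚ
  κu = ^-inverse {κ} {w} 0≤w κw (suc v)
  small : Var (𝒫 n k) F + Var (𝒬 n) F < ε * (g * g)
  small = *-cancelˡ-<-nonNeg M {{nonNegative (<⇒≤ 0<M)}} (≤-<-trans
    (*-monoˡ (<⇒≤ 0<M) (+-mono-≤ (Var𝒫 k≤n 1≤κ (^-nonNeg (suc v) 0≤w) κu) Var𝒬))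
    (≤-<-trans
      (variance-bound {κ} {w} {⟦ n ⟧} {K} {δ} {r} {#E} {M} {v} (<⇒≤ 0<κ) 0≤w κw 0≤⟦ n ⟧ 0≤K 0≤δ (<⇒≤ 0<M) (<⇒≤ 0<E) N≤ Kδ≤r E≥ M≤ κ≥ half)
      (subst (12ℚ * (g * g) <_) (*-assoc M ε (g * g)) (*-monoˡ-<-pos (g * g) {{positive (*-pos 0<g 0<g)}} 12<Mε))))

-- Squared and multiplied by `K₁`, the left side is at most `2 ^ v ((2 v K₁)²) ^ v = (8 K₁² v²) ^ v
-- ≤ v ^ (3 v) ≤ n ≤ K₁ κ²`, where `K₁ M² ≤ v ≤ 2 ^ v` supplies the first power of 2.
growth : ∀ {v n K₁ M : ℕ} {K κ} → 0ℚ ≤ κ → 0ℚ ≤ K → 1ℚ + K ≤ ⟦ K₁ ⟧ → ⟦ n ⟧ ≤ K * (κ * κ) → v ℕ.^ (3 ℕ.* v) ℕ.≤ n →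
  1 ℕ.≤ v → 8 ℕ.* (K₁ ℕ.* K₁) ℕ.≤ v → K₁ ℕ.* (M ℕ.* M) ℕ.≤ v →
  ⟦ M ⟧ * ((⟦ v ⟧ + 1ℚ) * (1ℚ + K)) ^ v ≤ κ
growth {v} {n} {K₁} {M} {K} {κ} 0≤κ 0≤K 1+K≤K₁ N≤ v^3v≤n 1≤v 8KK≤v KMM≤v =
  ^-cancel 1 0≤κ (subst₂ _≤_ (square (⟦ M ⟧ * D ^ v)) (square κ) (*-cancelˡ-≤ 0<K₁ chain))
  where
  open ≤-Reasoning
  V = ⟦ v ⟧
  L = ⟦ K₁ ⟧
  D = (V + 1ℚ) * (1ℚ + K)
  square : ∀ x → x * x ≡ x ^ 2
  square x = cong (x *_) (sym (*-identityʳ x))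
  0<K₁ : 0ℚ < L
  0<K₁ = <-≤-trans (positive⁻¹ 1ℚ) (≤-trans (subst (_≤ 1ℚ + K) (+-identityʳ 1ℚ) (+-monoʳ-≤ 1ℚ 0≤K)) 1+K≤K₁)
  K≤K₁ : K ≤ L
  K≤K₁ = ≤-trans (subst (_≤ 1ℚ + K) (+-identityˡ K) (+-monoˡ-≤ K 0≤1)) 1+K≤K₁
  1≤V : 1ℚ ≤ V
  1≤V = subst (_≤ V) ⟦1⟧ (⟦⟧-mono 1≤v)
  0≤D : 0ℚ ≤ D
  0≤D = *-nonNeg (+-nonNeg 0≤⟦ v ⟧ 0≤1) (+-nonNeg 0≤1 0≤K)
  D≤ : D ≤ (V + V) * L
  D≤ = *-mono-≤ (+-nonNeg 0≤⟦ v ⟧ 0≤1) (+-monoʳ-≤ V 1≤V) (+-nonNeg 0≤1 0≤K) 1+K≤K₁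
  DD = (V + V) * L * ((V + V) * L)
  0≤DD : 0ℚ ≤ DD
  0≤DD = *-nonNeg (≤-trans 0≤D D≤) (≤-trans 0≤D D≤)
  V≤2^v : V ≤ 2ℚ ^ v
  V≤2^v = ≤-trans (subst₂ _≤_ (trans (+-identityˡ _) (*-identityʳ V)) refl (+-monoˡ-≤ (V * 1ℚ) 0≤1)) (bernoulli 1ℚ v 0≤1)
  2DD≤V³ : 2ℚ * DD ≤ V ^ 3
  2DD≤V³ = begin
    2ℚ * DD                          ≡⟨ solve 2 (λ v a → con 2ℚ :* ((v :+ v) :* a :* ((v :+ v) :* a)) := con (2ℚ * 2ℚ * 2ℚ) :* (a :* a) :* (v :* (v :* con 1ℚ))) refl V L ⟩
    2ℚ * 2ℚ * 2ℚ * (L * L) * V ^ 2   ≡⟨ cong (_* V ^ 2) (sym 8KK) ⟩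
    ⟦ 8 ℕ.* (K₁ ℕ.* K₁) ⟧ * V ^ 2    ≤⟨ *-monoʳ (^-nonNeg 2 0≤⟦ v ⟧) (⟦⟧-mono 8KK≤v) ⟩
    V ^ 3                            ∎
    where
    8KK : ⟦ 8 ℕ.* (K₁ ℕ.* K₁) ⟧ ≡ 2ℚ * 2ℚ * 2ℚ * (L * L)
    8KK = trans (⟦⟧-* 8 (K₁ ℕ.* K₁)) (cong₂ _*_ (trans (⟦⟧-/1 8) refl) (⟦⟧-* K₁ K₁))
  chain : L * (⟦ M ⟧ * D ^ v * (⟦ M ⟧ * D ^ v)) ≤ L * (κ * κ)
  chain = begin
    L * (⟦ M ⟧ * D ^ v * (⟦ M ⟧ * D ^ v))   ≡⟨ solve 3 (λ a m d → a :* (m :* d :* (m :* d)) := a :* (m :* m) :* (d :* d)) refl L ⟦ M ⟧ (D ^ v) ⟩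
    L * (⟦ M ⟧ * ⟦ M ⟧) * (D ^ v * D ^ v)   ≡⟨ cong₂ _*_ (sym (trans (⟦⟧-* K₁ (M ℕ.* M)) (cong (L *_) (⟦⟧-* M M)))) (sym (^-distrib-* D D v)) ⟩
    ⟦ K₁ ℕ.* (M ℕ.* M) ⟧ * (D * D) ^ v      ≤⟨ *-mono-≤ 0≤⟦ K₁ ℕ.* (M ℕ.* M) ⟧ (≤-trans (⟦⟧-mono KMM≤v) V≤2^v) (^-nonNeg v (*-nonNeg 0≤D 0≤D)) (^-mono v (*-nonNeg 0≤D 0≤D) (*-mono-≤ 0≤D D≤ 0≤D D≤)) ⟩
    2ℚ ^ v * DD ^ v                         ≡⟨ sym (^-distrib-* 2ℚ DD v) ⟩
    (2ℚ * DD) ^ v                           ≤⟨ ^-mono v (*-nonNeg (nonNegative⁻¹ 2ℚ) 0≤DD) 2DD≤V³ ⟩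
    (V ^ 3) ^ v                             ≡⟨ sym (^-* V 3 v) ⟩
    V ^ (3 ℕ.* v)                           ≡⟨ sym (⟦⟧-^ v (3 ℕ.* v)) ⟩
    ⟦ v ℕ.^ (3 ℕ.* v) ⟧                     ≤⟨ ⟦⟧-mono v^3v≤n ⟩
    ⟦ n ⟧                                   ≤⟨ N≤ ⟩
    K * (κ * κ)                             ≤⟨ *-monoʳ (*-nonNeg 0≤κ 0≤κ) K≤K₁ ⟩
    L * (κ * κ)                             ∎

opaque
  -- The threshold contains `2 ^ (2 ^ 23)`; the variable `b` and the opacity keep this numeral from
  -- being computed.
  power-eventually : (v : ℕ → ℕ) → TendsToInfinity v →
    Eventually (λ n → fromℕ (v n) ≤ʳ (log₂ (fromℕ n) ÷ʳ (fromℕ 5 · log₂ (log₂ (fromℕ n))))) →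
    Eventually (λ n → v n ℕ.^ (3 ℕ.* v n) ℕ.≤ n)
  power-eventually v v→∞ ev = go 20 ℕ.≤-refl
    where
    go : ∀ b → 20 ℕ.≤ b → Eventually (λ n → v n ℕ.^ (3 ℕ.* v n) ℕ.≤ n)
    go b 20≤b = let (N , h) = eventually-× (v→∞ 10) ev in
      N ℕ.⊔ 2 ℕ.^ (2 ℕ.^ (3 ℕ.+ b)) , λ n le →
        let (10≤v , hyp) = h n (ℕ.≤-trans (ℕ.m≤m⊔n N _) le)
        in power-bound b 20≤b (ℕ.≤-trans (ℕ.m≤n⊔m N _) le) 10≤v hyp

module _ {q r : ℚ} (0<q : 0ℚ < q) (0<r : 0ℚ < r) (1<qr : 1ℚ < q * r) where

  private
    inv = inverse 0<q
    w = proj₁ inv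
    qw : q * w ≡ 1ℚ
    qw = proj₂ (proj₂ inv)
    0≤w : 0ℚ ≤ w
    0≤w = <⇒≤ (proj₁ (proj₂ inv))
    -- With `K = w * w = 1 / q²` this makes `K δ = r²`, the base of the density bound.
    δ = q * r * (q * r)
    x = δ - 1ℚ
    1<δ : 1ℚ < δ
    1<δ = *-mono-< 0≤1 1<qr 0≤1 1<qr
    0<x : 0ℚ < x
    0<x = subst (_< x) (+-inverseʳ 1ℚ) (+-monoˡ-< (- 1ℚ) 1<δ)
    K = w * w
    K₁ = proj₁ (upper (1ℚ + K))
    X = proj₁ (archimedean 0<x 1ℚ)

  -- Bernoulli: `δ ^ v ≥ 1 + v x` with `x = δ - 1`, and `X` is chosen with `X x ≥ 1`.
  growth-of-δ : ∀ {M v} → M ℕ.* X ℕ.≤ v → ⟦ M ⟧ ≤ δ ^ v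
  growth-of-δ {M} {v} MX≤v = begin
    ⟦ M ⟧               ≡⟨ sym (*-identityʳ ⟦ M ⟧) ⟩
    ⟦ M ⟧ * 1ℚ          ≤⟨ *-monoˡ 0≤⟦ M ⟧ (proj₂ (archimedean 0<x 1ℚ)) ⟩
    ⟦ M ⟧ * (⟦ X ⟧ * x) ≡⟨ trans (sym (*-assoc ⟦ M ⟧ ⟦ X ⟧ x)) (cong (_* x) (sym (⟦⟧-* M X))) ⟩
    ⟦ M ℕ.* X ⟧ * x     ≤⟨ *-monoʳ (<⇒≤ 0<x) (⟦⟧-mono MX≤v) ⟩
    ⟦ v ⟧ * x           ≡⟨ sym (+-identityˡ (⟦ v ⟧ * x)) ⟩
    0ℚ + ⟦ v ⟧ * x      ≤⟨ +-monoˡ-≤ (⟦ v ⟧ * x) 0≤1 ⟩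
    1ℚ + ⟦ v ⟧ * x      ≤⟨ bernoulli x v (<⇒≤ 0<x) ⟩
    (1ℚ + x) ^ v        ≡⟨ cong (_^ v) (solve 1 (λ d → con 1ℚ :+ (d :- con 1ℚ) := d) refl δ) ⟩
    δ ^ v               ∎
    where open ≤-Reasoning

  separates : (ℋ : ∀ v → GraphSet v) → (∀ v (H : Graph v) → T (ℋ v H) → Connected H) → (v k : ℕ → ℕ) → TendsToInfinity v →
    Eventually (λ v → (r * r) ^ v ≤ density (ℋ v)) → Eventually (λ n → v n ℕ.^ (3 ℕ.* v n) ℕ.≤ n) →
    Eventually (λ n → k n ℕ.≤ n) → Eventually (λ n → q * q * ⟦ n ⟧ ≤ ⟦ k n ⟧ * ⟦ k n ⟧) →
    StronglySeparates (λ n G → F[ ℋ (v n) ] (signs G)) (λ n → 𝒫 n (k n)) 𝒬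
  separates ℋ conn v k v→∞ dens power k≤n k≥ ε 0<ε =
    let (N , h) = eventually-× (eventually-∘ v→∞ dens) (eventually-× power (eventually-× k≤n (eventually-× k≥
                    -- A sum dominates each of its terms: `2 ≤ v`, the two size conditions of
                    -- `growth`, and that of `growth-of-δ`.
                    (v→∞ (2 ℕ.+ (8 ℕ.* (K₁ ℕ.* K₁) ℕ.+ (K₁ ℕ.* (M ℕ.* M) ℕ.+ M ℕ.* X)))))))
    in N , λ n N≤n → let (dens-n , power-n , k≤n-n , k≥-n , v≥) = h n N≤n in at n dens-n power-n k≤n-n k≥-n v≥
    where
    -- The added 1 makes `12 < M ε` strict; the 2 added to `M₀` ensures `2 ≤ M`.
    arch = archimedean 0<ε (12ℚ + 1ℚ)
    M₀ = proj₁ arch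
    M = 2 ℕ.+ M₀
    12<Mε : 12ℚ < ⟦ M ⟧ * ε
    12<Mε = <-≤-trans (subst (_< 12ℚ + 1ℚ) (+-identityʳ 12ℚ) (+-monoʳ-< 12ℚ (positive⁻¹ 1ℚ)))
      (≤-trans (proj₂ arch) (*-monoʳ (<⇒≤ 0<ε) (⟦⟧-mono (ℕ.m≤n+m M₀ 2))))
    2≤M : 2ℚ ≤ ⟦ M ⟧
    2≤M = subst (_≤ ⟦ M ⟧) (trans (⟦⟧-suc 1) (cong (1ℚ +_) ⟦1⟧)) (⟦⟧-mono (ℕ.m≤m+n 2 M₀))
    at : ∀ n → (r * r) ^ v n ≤ density (ℋ (v n)) → v n ℕ.^ (3 ℕ.* v n) ℕ.≤ n → k n ℕ.≤ n → q * q * ⟦ n ⟧ ≤ ⟦ k n ⟧ * ⟦ k n ⟧ →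
      2 ℕ.+ (8 ℕ.* (K₁ ℕ.* K₁) ℕ.+ (K₁ ℕ.* (M ℕ.* M) ℕ.+ M ℕ.* X)) ℕ.≤ v n → _
    at n dens-n power-n k≤n-n k≥-n v≥ =
      separation (ℋ (v n)) (conn (v n)) 2≤v k≤n-n {r * r} {K} {δ} {⟦ M ⟧} {ε}
        (*-pos 0<r 0<r) dens-n (*-nonNeg 0≤w 0≤w) N≤
        (<⇒≤ (<-trans (positive⁻¹ 1ℚ) 1<δ))
        (≤-reflexive Kδ≡rr) 2≤M (growth-of-δ {M} {v n} (ℕ.≤-trans (ℕ.m≤n+m (M ℕ.* X) b) (ℕ.≤-trans (ℕ.m≤n+m (b ℕ.+ M ℕ.* X) a) rest)))
        (growth {v n} {n} {K₁} {M} {K} {⟦ k n ⟧} 0≤⟦ k n ⟧ (*-nonNeg 0≤w 0≤w) (proj₂ (upper (1ℚ + K))) N≤ power-n (ℕ.≤-trans (ℕ.n≤1+n 1) 2≤v)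
          (ℕ.≤-trans (ℕ.m≤m+n a (b ℕ.+ M ℕ.* X)) rest)
          (ℕ.≤-trans (ℕ.m≤m+n b (M ℕ.* X)) (ℕ.≤-trans (ℕ.m≤n+m (b ℕ.+ M ℕ.* X) a) rest)))
        12<Mε
      where
      a = 8 ℕ.* (K₁ ℕ.* K₁)
      b = K₁ ℕ.* (M ℕ.* M)
      2≤v : 2 ℕ.≤ v n
      2≤v = ℕ.≤-trans (ℕ.m≤m+n 2 (a ℕ.+ (b ℕ.+ M ℕ.* X))) v≥
      rest : a ℕ.+ (b ℕ.+ M ℕ.* X) ℕ.≤ v n
      rest = ℕ.≤-trans (ℕ.m≤n+m (a ℕ.+ (b ℕ.+ M ℕ.* X)) 2) v≥
      Kδ≡rr : K * δ ≡ r * r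
      Kδ≡rr = trans (solve 3 (λ q w r → w :* w :* (q :* r :* (q :* r)) := (q :* w) :* (q :* w) :* (r :* r)) refl q w r)
        (trans (cong (λ z → z * z * (r * r)) qw) (*-identityˡ (r * r)))
      N≤ : ⟦ n ⟧ ≤ K * (⟦ k n ⟧ * ⟦ k n ⟧)
      N≤ = subst (_≤ K * (⟦ k n ⟧ * ⟦ k n ⟧))
        (trans (solve 3 (λ q w n → w :* w :* (q :* q :* n) := (q :* w) :* (q :* w) :* n) refl q w ⟦ n ⟧)
          (trans (cong (λ z → z * z * ⟦ n ⟧) qw) (*-identityˡ ⟦ n ⟧)))
        (*-monoˡ (*-nonNeg 0≤w 0≤w) k≥-n)

theorem1p22 : (ℋ : ∀ v → GraphSet v) →
    (∀ v → ClosedUnderRelabeling (ℋ v)) →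
    (∀ v (H : Graph v) → T (ℋ v H) → Connected H) →
    -∞< log-c ℋ →
    (v : ℕ → ℕ) →
    TendsToInfinity v →
    Eventually (λ n → fromℕ (v n) ≤ʳ (log₂ (fromℕ n) ÷ʳ (fromℕ 5 · log₂ (log₂ (fromℕ n))))) →
    (k : ℕ → ℕ) →
    Eventually (λ n → k n ℕ.≤ n) →
    (lam : Extℝ) → IsReal lam →
    recip (√ (c ℋ)) <ᵘ lam →
    Eventually (λ n → (lam · √ (fromℕ n)) ≤ʳ fromℕ (k n)) →
    StronglySeparates (λ n G → F[ ℋ (v n) ] (signs G)) (λ n → 𝒫 n (k n)) 𝒬
-- The strict inequality of cuts provides `1 / r = p < q < lam` for some `r` below `√ (c ℋ)`, whence
-- `1 < q r`. A cut `c ℋ = +∞` is covered as well, since only one such `r` is used.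
theorem1p22 ℋ _ conn _ v v→∞ v≤ k k≤n lam _ (q , (p , (r , 0<r , r<√c , pr≡1) , p<q) , q<lam) k≥ =
  separates 0<q 0<r 1<qr ℋ conn v k v→∞ (density-lower {ℋ} 0<r r<√c) (power-eventually v v→∞ v≤) k≤n
    -- The bound `suc N` guarantees `1 ≤ n`.
    (let (N , h) = k≥ in suc N , λ n N<n → planted-lower {lam} {q} {n} {k n} (ℕ.≤-trans (ℕ.s≤s ℕ.z≤n) N<n) 0<q q<lam (h n (ℕ.≤-trans (ℕ.n≤1+n N) N<n)))
  where
  1<qr : 1ℚ < q * r
  1<qr = subst (_< q * r) pr≡1 (*-monoˡ-<-pos r {{positive 0<r}} p<q)
  0<q : 0ℚ < q
  0<q = *-cancelʳ-<-nonNeg r {{nonNegative (<⇒≤ 0<r)}} (subst (_< q * r) (sym (*-zeroˡ r)) (<-trans (positive⁻¹ 1ℚ) 1<qr))
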